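{- Let $t \in \mathbb{N}$. Then there exists $c \in \mathbb{N}$ such that every graph $G \in \mathcal{X}_t$ that contains neither false twins nor a clique cutset of size at most $2$ is complete or satisfies $\operatorname{tw}(G) \leq c$.
   Context: All graphs are finite and simple. For graphs $G_1=(V_1,E_1)$, $G_2=(V_2,E_2)$, their intersection is $G_1\cap G_2=(V_1\cap V_2,E_1\cap E_2)$. For a graph $G=(V,E)$ and an injective map $\alpha$ defined on $V$, $G^{\alpha}$ is the graph with vertex set $\{\alpha(v): v\in V\}$ and edge set $\{\{\alpha(v),\alpha(w)\}:\{v,w\}\in E\}$. We write $G \xrightarrow{\cap} H$ ($H$ is a self-intersection, or si-subgraph, of $G$) if there exist injective maps $\alpha_1,\dots,\alpha_k$ on $V(G)$ with $H = G^{\alpha_1}\cap\cdots\cap G^{\alpha_k}$ (this notion is invariant under isomorphism of $H$). For $t\in\mathbb{N}$, $S_{t,t,t}$ is the graph obtained from the claw $K_{1,3}$ by subdividing each of its three edges with $t-1$ new vertices, $tS_{t,t,t}$ is the disjoint union of $t$ copies of $S_{t,t,t}$, and $\mathcal{X}_t$ is the class of graphs $G$ such that $G \not\xrightarrow{\cap} tS_{t,t,t}$. Two distinct vertices $x,y$ are false twins if they are non-adjacent and $N(x)=N(y)$. A (possibly empty) set $U\subseteq V(G)$ is a cutset if $G-U$ is disconnected; a clique cutset is a cutset that is a clique (so a graph with no clique cutset of size at most $2$ is in particular connected). $\operatorname{tw}(G)$ denotes treewidth. -}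

module Defs where

open import Data.Nat using (ℕ; zero; suc; _+_; _*_; _≤_; _≡ᵇ_)
open import Data.Bool using (Bool; true; false; _∧_; _∨_)
open import Data.Fin using (Fin; toℕ; remQuot; inject₁; fromℕ) renaming (zero to fz; suc to fs)
open import Data.Fin.Subset using (Subset; _∈_; _∉_; ∣_∣)
open import Data.Product using (Σ; _×_; _,_; ∃; ∃-syntax; proj₁; proj₂)
open import Data.Empty using (⊥)
open import Relation.Nullary using (¬_)
open import Relation.Binary.PropositionalEquality using (_≡_; _≢_)
open import Relation.Binary.Construct.Closure.ReflexiveTransitive using (Star)
open import Function.Bundles using (_⇔_)

record Graph : Set where
  field
    n : ℕ
    E : Fin n → Fin n → Bool
open Graph public

Adj : (G : Graph) → Fin (n G) → Fin (n G) → Set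
Adj G x y = E G x y ≡ true

IsSimple : Graph → Set
IsSimple G = (∀ x y → E G x y ≡ E G y x) × (∀ x → E G x x ≡ false)

Injective : {A B : Set} → (A → B) → Set
Injective f = ∀ x y → f x ≡ f y → x ≡ y

-- Self-intersections.  Vertex labels live in ℕ (a countable universe,
-- enough for finite graphs).  Given k ≥ 1 injective maps α l : V(G) → ℕ,
-- the intersection  G^{α 0} ∩ ... ∩ G^{α (k-1)}  has vertex set
-- { x | ∀ l, x ∈ α l (V G) } and edge set { {x,y} | ∀ l, {x,y} ∈ E(G^{α l}) }.

module _ (G : Graph) {k : ℕ} (α : Fin (suc k) → Fin (n G) → ℕ) where
  InterVertex : ℕ → Set
  InterVertex x = ∀ l → ∃[ v ] α l v ≡ x

  InterEdge : ℕ → ℕ → Set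
  InterEdge x y = ∀ l → ∃[ v ] ∃[ w ] (α l v ≡ x × α l w ≡ y × Adj G v w)

IsoToIntersection : (G : Graph) {k : ℕ} (α : Fin (suc k) → Fin (n G) → ℕ) → Graph → Set
IsoToIntersection G α H =
  Σ (Fin (n H) → ℕ) λ f →
      Injective f
    × (∀ i → InterVertex G α (f i))
    × (∀ x → InterVertex G α x → ∃[ i ] f i ≡ x)
    × (∀ i j → Adj H i j ⇔ InterEdge G α (f i) (f j))

SelfIntersects : Graph → Graph → Set
SelfIntersects G H =
  ∃[ k ] Σ (Fin (suc k) → Fin (n G) → ℕ) λ α →
    (∀ l → Injective (α l)) × IsoToIntersection G α H

-- S_{t,t,t}: vertex 0 is the centre; vertex (suc i) with
-- remQuot t i = (j , p) is the (p+1)-th vertex (from the centre) on leg j.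

S-adj : (t : ℕ) → Fin (suc (3 * t)) → Fin (suc (3 * t)) → Bool
S-adj t fz fz = false
S-adj t fz (fs i) = toℕ (proj₂ (remQuot {3} t i)) ≡ᵇ 0
S-adj t (fs i) fz = toℕ (proj₂ (remQuot {3} t i)) ≡ᵇ 0
S-adj t (fs i) (fs i') =
  let (j , p) = remQuot {3} t i
      (j' , p') = remQuot {3} t i'
  in (toℕ j ≡ᵇ toℕ j') ∧ ((suc (toℕ p) ≡ᵇ toℕ p') ∨ (suc (toℕ p') ≡ᵇ toℕ p))

S : ℕ → Graph
S t = record { n = suc (3 * t) ; E = S-adj t }

copies : ℕ → Graph → Graph
copies t H = record
  { n = t * n H
  ; E = λ a b →
      let (c , u) = remQuot {t} (n H) a
          (c' , u') = remQuot {t} (n H) b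
      in (toℕ c ≡ᵇ toℕ c') ∧ E H u u'
  }

tS : ℕ → Graph
tS t = copies t (S t)

InX : ℕ → Graph → Set
InX t G = ¬ SelfIntersects G (tS t)

FalseTwins : (G : Graph) → Fin (n G) → Fin (n G) → Set
FalseTwins G x y = x ≢ y × ¬ Adj G x y × (∀ z → Adj G x z ⇔ Adj G y z)

HasFalseTwins : Graph → Set
HasFalseTwins G = ∃[ x ] ∃[ y ] FalseTwins G x y

Complete : Graph → Set
Complete G = ∀ x y → x ≢ y → Adj G x y

IsClique : (G : Graph) → Subset (n G) → Set
IsClique G U = ∀ x y → x ∈ U → y ∈ U → x ≢ y → Adj G x y

AdjMinus : (G : Graph) → Subset (n G) → Fin (n G) → Fin (n G) → Set
AdjMinus G U x y = Adj G x y × x ∉ U × y ∉ U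

-- G - U is disconnected: two vertices of G - U not joined by a path in G - U
-- (so the empty graph counts as connected)
IsCutset : (G : Graph) → Subset (n G) → Set
IsCutset G U = ∃[ x ] ∃[ y ] (x ∉ U × y ∉ U × ¬ Star (AdjMinus G U) x y)

HasSmallCliqueCutset : Graph → Set
HasSmallCliqueCutset G = ∃[ U ] (IsCutset G U × IsClique G U × ∣ U ∣ ≤ 2)

Connected : Graph → Set
Connected G = ∀ x y → Star (Adj G) x y

HasCycle : Graph → Set
HasCycle G = ∃[ l ] Σ (Fin (3 + l) → Fin (n G)) λ c →
    Injective c
  × (∀ (i : Fin (2 + l)) → Adj G (c (inject₁ i)) (c (fs i)))
  × Adj G (c (fromℕ (2 + l))) (c fz)

IsTree : Graph → Set
IsTree T = IsSimple T × (1 ≤ n T) × Connected T × ¬ HasCycle T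

record TreeDecomposition (G : Graph) (c : ℕ) : Set where
  field
    T : Graph
    tree : IsTree T
    B : Fin (n T) → Subset (n G)
    vertexCover : ∀ v → ∃[ s ] v ∈ B s
    edgeCover : ∀ u v → Adj G u v → ∃[ s ] (u ∈ B s × v ∈ B s)
    connectedBags : ∀ v s s' → v ∈ B s → v ∈ B s' →
      Star (λ a b → Adj T a b × v ∈ B a × v ∈ B b) s s'
    width : ∀ s → ∣ B s ∣ ≤ suc c

TwAtMost : Graph → ℕ → Set
TwAtMost G c = TreeDecomposition G c

{-# OPTIONS --safe #-}
module Submission where

-- G self-intersects to tS exactly when every non-adjacent pair u, v of tS is sent to a
-- non-adjacent pair by some embedding of tS into G.  Suppose that all embeddings make a
-- fixed pair u, v adjacent.
--
-- In a depth-first decomposition the bag of x consists of the vertices on the stack that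
-- have a neighbour in the component of x.  A large bag gives a subdivided claw with long
-- legs; deleting it and repeating, either the treewidth is bounded or there are many
-- disjoint long claws.
--
-- The forced adjacencies provide shortcuts in these claws, the rerouted claws force further
-- adjacencies, and so on, until a large complete bipartite graph appears.
--
-- If a side of it contains non-adjacent vertices x, y, then u and v can be placed on x and y
-- when their distance is even or infinite.  When it is odd, a vertex adjacent to exactly one
-- of x and y (they are not false twins) repairs the parity.  If a side is a clique, extend it
-- to a maximal clique K.  As G is connected and not complete, some vertex outside K has both
-- a neighbour and a non-neighbour in K.  Since no clique of size at most 2 separates G, there
-- are two disjoint paths (three, if u and v are both centres) from outside into K, along
-- which tS is embedded with one of u, v outside K and the other on a non-neighbour in K.

open import Defs
open import Data.Nat using (ℕ; zero; suc; _+_; _*_; _∸_; _≤_; _<_; z≤n; s≤s; _≤?_; _≡ᵇ_)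
open import Data.Nat.Properties
open import Data.Fin using (Fin; toℕ; inject₁; fromℕ; remQuot; combine) renaming (zero to fz; suc to fs)
import Data.Fin.Properties as Fin
open import Data.Bool using (Bool; true; false; if_then_else_; _∧_; _∨_; not)
open import Data.List using (List; []; _∷_; _++_; [_]; length; reverse; take; filter; applyUpTo; allFin; mapMaybe)
open import Data.List.Properties using (++-assoc; unfold-reverse; length-++; length-reverse; length-take; length-filter; length-mapMaybe; length-tabulate; length-applyUpTo)
open import Data.List.Membership.Propositional using (_∈_; _∉_)
open import Data.List.Membership.Propositional.Properties using (∈-++⁺ˡ; ∈-++⁺ʳ; ∈-++⁻; ∈-filter⁺; ∈-filter⁻; ∈-∃++; ∈-allFin; ∈-applyUpTo⁻)
open import Data.List.Relation.Unary.Any using (here; there)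
open import Data.List.Relation.Unary.Linked as Linked using (Linked; []; [-]; _∷_)
open import Data.Product using (Σ; _×_; _,_; ∃-syntax; proj₁; proj₂)
open import Data.Sum using (_⊎_; inj₁; inj₂)
open import Data.Empty using (⊥; ⊥-elim)
open import Relation.Nullary using (¬_; Dec; yes; no; does; ¬?)
open import Relation.Unary using (Decidable)
open import Relation.Binary.PropositionalEquality using (_≡_; _≢_; refl; sym; trans; cong; cong₂; subst; subst₂)
open import Data.Fin.Relation.Unary.Top using (view; ‵fromℕ; ‵inject₁)
import Data.Bool.Properties as Bool
open import Relation.Nullary.Decidable using (_×-dec_; _⊎-dec_; map′; dec-true; decidable-stable)
open import Relation.Binary.Construct.Closure.ReflexiveTransitive using (Star; ε; _◅_; _◅◅_; gmap)
open import Data.Nat.Tactic.RingSolver using (solve-∀)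
open import Data.Fin.Subset as Subset using (Subset; ∣_∣; ⁅_⁆; _∪_)
import Data.Fin.Subset.Properties as Subset
import Data.Vec as Vec
open import Data.Maybe using (Maybe; just; nothing)
open import Function.Bundles using (_⇔_; mk⇔)
open import Relation.Binary.Definitions using (tri<; tri≈; tri>)
open import Data.Maybe.Properties using (just-injective)
open import Data.List.Relation.Unary.Any.Properties using (reverse⁻)

-- Lists

-- A forced adjacency is strong because it holds in every spider that avoids a reserved family,
-- hence again in every rerouted spider. If depths q and q + e + 2 on a leg are always adjacent, the
-- chord may serve as an edge; the shortened leg is again a leg, so the chord reappears with the
-- same start and its end e + 1 steps further out. Thus depth q is joined to every depth q + 1 + k(e
-- + 1). Recentring the spider at such an end moves the start as well, and both moves together give
-- a half graph, which contains a biclique.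
--
-- The obstacle in a biclique is parity: positions at odd distance land on opposite sides and become
-- adjacent. The way out is to put u on a distinguishing vertex, with the parent of u and v both on
-- one side; the leg beyond u then follows a path back to the biclique, and the colours of the rest
-- of this leg are shifted to fit the end of that path.
--
-- Embeddings are not enumerated, so the existence of a separating embedding is only shown not to
-- fail. This suffices, since the goal is a contradiction and there are finitely many pairs.

module _ {A : Set} where

  Linked-++ˡ : {R : A → A → Set} (xs : List A) {ys : List A} → Linked R (xs ++ ys) → Linked R xs
  Linked-++ˡ [] l = []
  Linked-++ˡ (x ∷ []) l = [-]
  Linked-++ˡ (x ∷ y ∷ xs) (r ∷ l) = r ∷ Linked-++ˡ (y ∷ xs) l

  Linked-++ʳ : {R : A → A → Set} (xs : List A) {ys : List A} → Linked R (xs ++ ys) → Linked R ys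
  Linked-++ʳ [] l = l
  Linked-++ʳ (x ∷ []) {[]} l = []
  Linked-++ʳ (x ∷ []) {y ∷ ys} (r ∷ l) = l
  Linked-++ʳ (x ∷ y ∷ xs) (r ∷ l) = Linked-++ʳ (y ∷ xs) l

  Linked-glue : {R : A → A → Set} (xs : List A) {y : A} {ys : List A} →
    Linked R (xs ++ [ y ]) → Linked R (y ∷ ys) → Linked R (xs ++ y ∷ ys)
  Linked-glue [] l l' = l'
  Linked-glue (x ∷ []) (r ∷ l) l' = r ∷ l'
  Linked-glue (x ∷ x' ∷ xs) (r ∷ l) l' = r ∷ Linked-glue (x' ∷ xs) l l'

  Linked-left : {R : A → A → Set} (xs : List A) {y : A} {ys : List A} →
    Linked R (xs ++ y ∷ ys) → Linked R (xs ++ [ y ])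
  Linked-left xs {y} {ys} l =
    Linked-++ˡ (xs ++ [ y ]) (subst (Linked _) (sym (++-assoc xs [ y ] ys)) l)

  Linked-middle : {R : A → A → Set} (xs : List A) {y z : A} {zs : List A} →
    Linked R (xs ++ y ∷ z ∷ zs) → R y z
  Linked-middle xs l with Linked-++ʳ xs l
  ... | r ∷ _ = r

  Linked-take : {R : A → A → Set} (k : ℕ) {xs : List A} → Linked R xs → Linked R (take k xs)
  Linked-take zero l = []
  Linked-take (suc k) [] = []
  Linked-take (suc zero) [-] = [-]
  Linked-take (suc (suc k)) [-] = [-]
  Linked-take (suc zero) (r ∷ l) = [-]
  Linked-take (suc (suc k)) (r ∷ l) = r ∷ Linked-take (suc k) l

  Linked-reverse : {R : A → A → Set} → (∀ {x y} → R x y → R y x) →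
    (xs : List A) → Linked R xs → Linked R (reverse xs)
  Linked-reverse s [] l = []
  Linked-reverse s (x ∷ []) l = [-]
  Linked-reverse s (x ∷ y ∷ xs) (r ∷ l) =
    subst (Linked _) (sym eq) (Linked-glue (reverse xs) (subst (Linked _) (unfold-reverse y xs) (Linked-reverse s (y ∷ xs) l)) (s r ∷ [-]))
    where
      eq : reverse (x ∷ y ∷ xs) ≡ reverse xs ++ y ∷ [ x ]
      eq = trans (unfold-reverse x (y ∷ xs)) (trans (cong (_++ [ x ]) (unfold-reverse y xs)) (++-assoc (reverse xs) [ y ] [ x ]))

  reverse-++-∷ : (xs : List A) (y : A) → reverse (xs ++ [ y ]) ≡ y ∷ reverse xs
  reverse-++-∷ [] y = refl
  reverse-++-∷ (x ∷ xs) y = trans (unfold-reverse x (xs ++ [ y ])) (trans (cong (_++ [ x ]) (reverse-++-∷ xs y)) (cong (y ∷_) (sym (unfold-reverse x xs))))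

  -- Indices past the end give the default value d.
  nth : A → List A → ℕ → A
  nth d [] k = d
  nth d (x ∷ xs) zero = x
  nth d (x ∷ xs) (suc k) = nth d xs k

  nth-∈ : ∀ d xs {k} → k < length xs → nth d xs k ∈ xs
  nth-∈ d (x ∷ xs) {zero} k< = here refl
  nth-∈ d (x ∷ xs) {suc k} (s≤s k<) = there (nth-∈ d xs k<)

  nth-linked : {R : A → A → Set} → ∀ d xs {k} → Linked R xs → suc k < length xs → R (nth d xs k) (nth d xs (suc k))
  nth-linked d (x ∷ y ∷ xs) {zero} (r ∷ l) k< = r
  nth-linked d (x ∷ y ∷ xs) {suc k} (r ∷ l) (s≤s k<) = nth-linked d (y ∷ xs) l k<
  nth-linked d (x ∷ []) {zero} l (s≤s ())
  nth-linked d (x ∷ []) {suc k} l (s≤s ())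

  nth-++ : ∀ d xs {ys} {y} {k} → length xs ≡ k → nth d (xs ++ y ∷ ys) k ≡ y
  nth-++ d [] refl = refl
  nth-++ d (x ∷ xs) refl = nth-++ d xs refl

  split-at : ∀ d (xs : List A) k → k < length xs →
    ∃[ P ] ∃[ R ] (xs ≡ P ++ nth d xs k ∷ R × length P ≡ k × length xs ≡ suc k + length R)
  split-at d (x ∷ xs) zero k< = [] , xs , refl , refl , refl
  split-at d (x ∷ xs) (suc k) (s≤s k<) with split-at d xs k k<
  ... | P , R , e , l , l' = x ∷ P , R , cong (x ∷_) e , cong suc l , cong suc l'

-- Vertex lists without repetitions

module _ {n : ℕ} where
  private V = Fin n

  open import Data.List.Membership.DecPropositional (Fin._≟_ {n}) public using (_∈?_)

  δ : V → V → ℕ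
  δ v x = if does (v Fin.≟ x) then 1 else 0

  cnt : V → List V → ℕ
  cnt v [] = 0
  cnt v (x ∷ xs) = δ v x + cnt v xs

  -- Bounding multiplicities turns the distinctness of a rearranged list into arithmetic: legs are
  -- cut, reversed and reassembled, and `Distinct-mono` needs only a comparison of counts instead of
  -- a permutation.
  record Distinct (xs : List V) : Set where
    constructor distinct
    field cnt≤1 : ∀ v → cnt v xs ≤ 1
  open Distinct public

  cnt-++ : ∀ v xs ys → cnt v (xs ++ ys) ≡ cnt v xs + cnt v ys
  cnt-++ v [] ys = refl
  cnt-++ v (x ∷ xs) ys = trans (cong (δ v x +_) (cnt-++ v xs ys)) (sym (+-assoc (δ v x) (cnt v xs) (cnt v ys)))

  cnt-reverse : ∀ v xs → cnt v (reverse xs) ≡ cnt v xs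
  cnt-reverse v [] = refl
  cnt-reverse v (x ∷ xs) = trans (cong (cnt v) (unfold-reverse x xs)) (trans (cnt-++ v (reverse xs) [ x ])
    (trans (+-comm (cnt v (reverse xs)) (δ v x + 0)) (cong₂ _+_ (+-identityʳ (δ v x)) (cnt-reverse v xs))))

  cnt-take : ∀ v k xs → cnt v (take k xs) ≤ cnt v xs
  cnt-take v zero xs = z≤n
  cnt-take v (suc k) [] = z≤n
  cnt-take v (suc k) (x ∷ xs) = +-monoʳ-≤ (δ v x) (cnt-take v k xs)

  cnt-filter : {P : V → Set} (P? : Decidable P) → ∀ v xs → cnt v (filter P? xs) ≤ cnt v xs
  cnt-filter P? v [] = z≤n
  cnt-filter P? v (x ∷ xs) with P? x
  ... | yes _ = +-monoʳ-≤ (δ v x) (cnt-filter P? v xs)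
  ... | no _ = ≤-trans (cnt-filter P? v xs) (m≤n+m _ (δ v x))

  δ-refl : ∀ v → δ v v ≡ 1
  δ-refl v with v Fin.≟ v
  ... | yes _ = refl
  ... | no ¬e = ⊥-elim (¬e refl)

  δ-≢ : ∀ {v x} → v ≢ x → δ v x ≡ 0
  δ-≢ {v} {x} ne with v Fin.≟ x
  ... | yes e = ⊥-elim (ne e)
  ... | no _ = refl

  ∈⇒cnt : ∀ {v xs} → v ∈ xs → 1 ≤ cnt v xs
  ∈⇒cnt {v} {x ∷ xs} (here refl) = subst (λ k → 1 ≤ k + cnt v xs) (sym (δ-refl v)) (s≤s z≤n)
  ∈⇒cnt {v} {x ∷ xs} (there m) = ≤-trans (∈⇒cnt m) (m≤n+m _ (δ v x))

  ∉⇒cnt : ∀ {v} xs → v ∉ xs → cnt v xs ≡ 0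
  ∉⇒cnt [] _ = refl
  ∉⇒cnt {v} (x ∷ xs) v∉ = cong₂ _+_ (δ-≢ (λ e → v∉ (here e))) (∉⇒cnt xs (λ m → v∉ (there m)))

  cnt⇒∈ : ∀ {v} xs → 1 ≤ cnt v xs → v ∈ xs
  cnt⇒∈ {v} (x ∷ xs) p with v Fin.≟ x
  ... | yes e = here e
  ... | no _ = there (cnt⇒∈ xs p)

  Distinct-mono : ∀ {xs ys} → (∀ v → cnt v ys ≤ cnt v xs) → Distinct xs → Distinct ys
  Distinct-mono le d = distinct λ v → ≤-trans (le v) (cnt≤1 d v)

  Distinct-[] : Distinct []
  Distinct-[] = distinct λ _ → z≤n

  Distinct-++ : ∀ {xs ys} → Distinct xs → Distinct ys → (∀ {v} → v ∈ xs → v ∈ ys → ⊥) → Distinct (xs ++ ys)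
  cnt≤1 (Distinct-++ {xs} {ys} dx dy dis) v with v ∈? xs
  ... | yes m = subst (_≤ 1) (sym (trans (cnt-++ v xs ys) (trans (cong (cnt v xs +_) (∉⇒cnt ys (dis m))) (+-identityʳ _)))) (cnt≤1 dx v)
  ... | no ¬m = subst (_≤ 1) (sym (trans (cnt-++ v xs ys) (cong (_+ cnt v ys) (∉⇒cnt xs ¬m)))) (cnt≤1 dy v)

  Distinct-[-] : ∀ x → Distinct [ x ]
  cnt≤1 (Distinct-[-] x) v with v Fin.≟ x
  ... | yes _ = ≤-refl
  ... | no _ = z≤n

  Distinct-∷ : ∀ {x xs} → x ∉ xs → Distinct xs → Distinct (x ∷ xs)
  Distinct-∷ {x} x∉ d = Distinct-++ {[ x ]} (Distinct-[-] x) d (λ { (here refl) m → x∉ m })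

  Distinct-++ˡ : ∀ xs {ys} → Distinct (xs ++ ys) → Distinct xs
  Distinct-++ˡ xs {ys} = Distinct-mono (λ v → subst (cnt v xs ≤_) (sym (cnt-++ v xs ys)) (m≤m+n _ _))

  Distinct-++ʳ : ∀ xs {ys} → Distinct (xs ++ ys) → Distinct ys
  Distinct-++ʳ xs {ys} = Distinct-mono (λ v → subst (cnt v ys ≤_) (sym (cnt-++ v xs ys)) (m≤n+m _ _))

  Distinct-disjoint : ∀ xs {ys v} → Distinct (xs ++ ys) → v ∈ xs → v ∈ ys → ⊥
  Distinct-disjoint xs {ys} {v} d m m' =
    <⇒≱ (≤-refl {2}) (≤-trans (+-mono-≤ (∈⇒cnt m) (∈⇒cnt m')) (subst (_≤ 1) (cnt-++ v xs ys) (cnt≤1 d v)))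

  Distinct-head : ∀ {x xs} → Distinct (x ∷ xs) → x ∉ xs
  Distinct-head {x} {xs} d = Distinct-disjoint [ x ] d (here refl)

  Distinct-filter : {P : V → Set} (P? : Decidable P) → ∀ {xs} → Distinct xs → Distinct (filter P? xs)
  Distinct-filter P? {xs} = Distinct-mono (λ v → cnt-filter P? v xs)

  nth-injective : ∀ d xs {i j} → Distinct xs → i < length xs → j < length xs → nth d xs i ≡ nth d xs j → i ≡ j
  nth-injective d (x ∷ xs) {zero} {zero} D i< j< e = refl
  nth-injective d (x ∷ xs) {zero} {suc j} D i< (s≤s j<) e = ⊥-elim (Distinct-head D (subst (_∈ xs) (sym e) (nth-∈ d xs j<)))
  nth-injective d (x ∷ xs) {suc i} {zero} D (s≤s i<) j< e = ⊥-elim (Distinct-head D (subst (_∈ xs) e (nth-∈ d xs i<)))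
  nth-injective d (x ∷ xs) {suc i} {suc j} D (s≤s i<) (s≤s j<) e = cong suc (nth-injective d xs (Distinct-++ʳ [ x ] D) i< j< e)

  Distinct-applyUpTo : ∀ (f : ℕ → V) k → (∀ {i j} → i < k → j < k → f i ≡ f j → i ≡ j) → Distinct (applyUpTo f k)
  Distinct-applyUpTo f zero inj = Distinct-[]
  Distinct-applyUpTo f (suc k) inj = Distinct-∷ (λ m → nope m) (Distinct-applyUpTo (λ i → f (suc i)) k (λ i< j< e → suc-injective (inj (s≤s i<) (s≤s j<) e)))
    where
      nope : f 0 ∉ applyUpTo (λ i → f (suc i)) k
      nope m with ∈-applyUpTo⁻ (λ i → f (suc i)) m
      ... | i , i< , e with inj (s≤s z≤n) (s≤s i<) e
      ... | ()

  without : List V → List V → List V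
  without S = filter (λ x → ¬? (x ∈? S))

  private
    remove-one : ∀ s xs → Distinct xs → length xs ≤ suc (length (filter (λ x → ¬? (x Fin.≟ s)) xs))
    remove-one s [] d = z≤n
    remove-one s (x ∷ xs) d with x Fin.≟ s
    ... | no _ = s≤s (remove-one s xs (Distinct-++ʳ [ x ] d))
    ... | yes refl = s≤s (≤-reflexive (sym (cong length (all xs (Distinct-head d)))))
      where
        all : ∀ ys → s ∉ ys → filter (λ x → ¬? (x Fin.≟ s)) ys ≡ ys
        all [] _ = refl
        all (y ∷ ys) s∉ with y Fin.≟ s
        ... | yes e = ⊥-elim (s∉ (here (sym e)))
        ... | no _ = cong (y ∷_) (all ys (λ m → s∉ (there m)))

    without-∷ : ∀ s S xs → filter (λ x → ¬? (x Fin.≟ s)) (without S xs) ≡ without (s ∷ S) xs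
    without-∷ s S [] = refl
    without-∷ s S (x ∷ xs) with x ∈? S
    ... | yes p with x Fin.≟ s
    ... | yes _ = without-∷ s S xs
    ... | no _ = without-∷ s S xs
    without-∷ s S (x ∷ xs) | no _ with x Fin.≟ s
    ... | yes _ = without-∷ s S xs
    ... | no _ = cong (x ∷_) (without-∷ s S xs)

  -- As `xs` has no repetitions, each entry of `S` deletes at most one entry.
  length-without : ∀ S xs → Distinct xs → length xs ≤ length S + length (without S xs)
  length-without [] [] d = z≤n
  length-without [] (x ∷ xs) d = s≤s (length-without [] xs (Distinct-++ʳ [ x ] d))
  length-without (s ∷ S) xs d = ≤-trans (length-without S xs d)
    (≤-trans (+-monoʳ-≤ (length S) (remove-one s (without S xs) (Distinct-filter _ d)))
      (≤-reflexive (trans (+-suc (length S) _) (cong (λ l → suc (length S + length l)) (without-∷ s S xs)))))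

  fresh : ∀ S xs → Distinct xs → length S < length xs → ∃[ x ] (x ∈ xs × x ∉ S)
  fresh S xs d lt with without S xs in eq
  ... | [] = ⊥-elim (<⇒≱ lt (≤-trans (length-without S xs d) (≤-reflexive (trans (cong (λ l → length S + length l) eq) (+-identityʳ _)))))
  ... | x ∷ _ = x , ∈-filter⁻ (λ x → ¬? (x ∈? S)) {xs = xs} (subst (x ∈_) (sym eq) (here refl))

-- Walks and trees

module _ {n : ℕ} {R : Fin n → Fin n → Set} where
  private V = Fin n

  -- Walks whose inner vertices lie in the list, as in Warshall's algorithm.
  data Via : List V → V → V → Set where
    stay : ∀ {a b} → a ≡ b → Via [] a b
    direct : ∀ {a b} → R a b → Via [] a b
    skip : ∀ {v vs a b} → Via vs a b → Via (v ∷ vs) a b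
    through : ∀ {v vs a b} → Via vs a v → Via vs v b → Via (v ∷ vs) a b

  via? : (∀ a b → Dec (R a b)) → ∀ vs a b → Dec (Via vs a b)
  via? R? [] a b with a Fin.≟ b | R? a b
  ... | yes e | _ = yes (stay e)
  ... | no _ | yes r = yes (direct r)
  ... | no ¬e | no ¬r = no λ { (stay e) → ¬e e ; (direct r) → ¬r r }
  via? R? (v ∷ vs) a b with via? R? vs a b | via? R? vs a v | via? R? vs v b
  ... | yes p | _ | _ = yes (skip p)
  ... | no _ | yes p | yes q = yes (through p q)
  ... | no ¬p | no ¬q | _ = no λ { (skip p) → ¬p p ; (through q _) → ¬q q }
  ... | no ¬p | yes _ | no ¬q = no λ { (skip p) → ¬p p ; (through _ q) → ¬q q }

  Via⇒Star : ∀ {vs a b} → Via vs a b → Star R a b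
  Via⇒Star (stay refl) = ε
  Via⇒Star (direct r) = r ◅ ε
  Via⇒Star (skip p) = Via⇒Star p
  Via⇒Star (through p q) = Via⇒Star p ◅◅ Via⇒Star q

  -- Where `c` itself is released as an inner vertex, closed walks at `c` are dropped and the two
  -- remaining parts are joined. Where both walks use an earlier listed vertex, everything between
  -- its two visits is dropped.
  Via-trans : ∀ {vs a b c} → c ∈ vs → Via vs a c → Via vs c b → Via vs a b
  Via-trans (here refl) p q = through (to p) (from q)
    where
      to : ∀ {vs a c} → Via (c ∷ vs) a c → Via vs a c
      to (skip p) = p
      to (through p _) = p
      from : ∀ {vs c b} → Via (c ∷ vs) c b → Via vs c b
      from (skip p) = p
      from (through _ p) = p
  Via-trans (there m) (skip p) (skip q) = skip (Via-trans m p q)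
  Via-trans (there m) (skip p) (through q q') = through (Via-trans m p q) q'
  Via-trans (there m) (through p p') (skip q) = through p (Via-trans m p' q)
  Via-trans (there m) (through p p') (through q q') = through p q'

  Via-base : ∀ vs {a b} → Via [] a b → Via vs a b
  Via-base [] p = p
  Via-base (v ∷ vs) p = skip (Via-base vs p)

  Star⇒Via : ∀ {a b} → Star R a b → Via (allFin n) a b
  Star⇒Via ε = Via-base (allFin n) (stay refl)
  Star⇒Via (r ◅ s) = Via-trans (∈-allFin _) (Via-base (allFin n) (direct r)) (Star⇒Via s)

  star? : (∀ a b → Dec (R a b)) → ∀ a b → Dec (Star R a b)
  star? R? a b = map′ Via⇒Star Star⇒Via (via? R? (allFin n) a b)

  record FirstHit (K : V → Set) (y : V) : Set where
    field
      rest inner : List V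
      last : V
      split : y ∷ rest ≡ inner ++ [ last ]
      linked : Linked R (y ∷ rest)
      unique : Distinct (y ∷ rest)
      last∈ : K last
      inner∉ : ∀ {v} → v ∈ inner → ¬ K v

  -- Loop erasure of a walk, stopped at its first vertex in K.
  firstHit : {K : V → Set} → Decidable K → ∀ {y k} → Star R y k → K k → FirstHit K y
  firstHit K? {y} s k∈ with K? y
  ... | yes y∈ = record { rest = [] ; inner = [] ; last = y ; split = refl ; linked = [-] ; unique = Distinct-[-] y ; last∈ = y∈ ; inner∉ = λ () }
  firstHit K? {y} ε k∈ | no y∉ = ⊥-elim (y∉ k∈)
  firstHit {K} K? {y} (_◅_ {j = z} r s) k∈ | no y∉ = erase (y ∈? (z ∷ rest))
    where
      open FirstHit (firstHit K? s k∈)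
      erase : Dec (y ∈ z ∷ rest) → FirstHit K y
      erase (no y∉p) = record
        { rest = z ∷ rest ; inner = y ∷ inner ; last = last ; split = cong (y ∷_) split
        ; linked = r ∷ linked ; unique = Distinct-∷ y∉p unique ; last∈ = last∈
        ; inner∉ = λ { (here refl) → y∉ ; (there m) → inner∉ m } }
      erase (yes y∈p) with ∈-++⁻ inner (subst (y ∈_) split y∈p)
      ... | inj₂ (here refl) = ⊥-elim (y∉ last∈)
      ... | inj₁ y∈i with ∈-∃++ y∈i
      ... | A , B , i≡ = record
        { rest = B ++ [ last ] ; inner = y ∷ B ; last = last ; split = refl
        ; linked = Linked-++ʳ A (subst (Linked R) eq linked)
        ; unique = Distinct-++ʳ A (subst Distinct eq unique) ; last∈ = last∈
        ; inner∉ = λ m → inner∉ (subst (_ ∈_) (sym i≡) (∈-++⁺ʳ A m)) }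
        where
          eq : z ∷ rest ≡ A ++ y ∷ B ++ [ last ]
          eq = trans split (trans (cong (_++ [ last ]) i≡) (++-assoc A (y ∷ B) [ last ]))

  Linked-all : {P : V → Set} → (∀ {a b} → R a b → P b) → ∀ {y ws} → P y → Linked R (y ∷ ws) → ∀ {v} → v ∈ y ∷ ws → P v
  Linked-all f py l (here refl) = py
  Linked-all f py (r ∷ l) (there m) = Linked-all f (f r) l m

  Star-last : {P : V → Set} → (∀ {a b} → R a b → P b) → ∀ {a b} → P a → Star R a b → P b
  Star-last f pa ε = pa
  Star-last f pa (r ◅ s) = Star-last f (f r) s

addLeaf : (T : Graph) → Fin (n T) → Graph
addLeaf T p = record { n = suc (n T) ; E = E' }
  where
    E' : Fin (suc (n T)) → Fin (suc (n T)) → Bool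
    E' fz fz = false
    E' fz (fs j) = does (j Fin.≟ p)
    E' (fs i) fz = does (i Fin.≟ p)
    E' (fs i) (fs j) = E T i j

addLeaf-edge : ∀ T p → Adj (addLeaf T p) fz (fs p)
addLeaf-edge T p = dec-true (p Fin.≟ p) refl

addLeaf-nbr : ∀ T p j → Adj (addLeaf T p) fz j → j ≡ fs p
addLeaf-nbr T p (fs j) a with j Fin.≟ p
... | yes refl = refl

addLeaf-simple : ∀ T p → IsSimple T → IsSimple (addLeaf T p)
addLeaf-simple T p (s , i) = sy , ir
  where
    sy : ∀ x y → E (addLeaf T p) x y ≡ E (addLeaf T p) y x
    sy fz fz = refl
    sy fz (fs y) = refl
    sy (fs x) fz = refl
    sy (fs x) (fs y) = s x y
    ir : ∀ x → E (addLeaf T p) x x ≡ false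
    ir fz = refl
    ir (fs x) = i x

addLeaf-tree : ∀ T p → IsTree T → IsTree (addLeaf T p)
addLeaf-tree T p (simple , _ , conn , acyclic) = addLeaf-simple T p simple , s≤s z≤n , conn' , λ (l , c , inj , path , close) → noCycle l c inj path close
  where
    T' = addLeaf T p
    sym' : ∀ {x y} → Adj T' x y → Adj T' y x
    sym' {x} {y} a = trans (proj₁ (addLeaf-simple T p simple) y x) a
    conn' : Connected T'
    conn' fz fz = ε
    conn' fz (fs y) = addLeaf-edge T p ◅ gmap fs (λ a → a) (conn p y)
    conn' (fs x) fz = gmap fs (λ a → a) (conn x p) ◅◅ (sym' {fz} {fs p} (addLeaf-edge T p) ◅ ε)
    conn' (fs x) (fs y) = gmap fs (λ a → a) (conn x y)
    noCycle : ∀ l (c : Fin (3 + l) → Fin (suc (n T))) → Injective c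
      → (∀ (i : Fin (2 + l)) → Adj T' (c (inject₁ i)) (c (fs i))) → Adj T' (c (fromℕ (2 + l))) (c fz) → ⊥
    noCycle l c inj path close with Fin.any? (λ i → c i Fin.≟ fz)
    ... | no ¬z = acyclic (l , c' , (λ x y e → inj x y (trans (eq x) (trans (cong fs e) (sym (eq y)))))
                , (λ i → subst₂ (Adj T') (eq (inject₁ i)) (eq (fs i)) (path i))
                , subst₂ (Adj T') (eq (fromℕ (2 + l))) (eq fz) close)
      where
        pre : ∀ i → ∃[ y ] c i ≡ fs y
        pre i with c i in e
        ... | fz = ⊥-elim (¬z (i , e))
        ... | fs y = y , refl
        c' : Fin (3 + l) → Fin (n T)
        c' i = proj₁ (pre i)
        eq : ∀ i → c i ≡ fs (c' i)
        eq i = proj₂ (pre i)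
    ... | yes (i , ci) = two i ci
      where
        -- Both cycle neighbours of a leaf would be its parent.
        clash : ∀ i j k → c i ≡ fz → Adj T' (c i) (c j) → Adj T' (c i) (c k) → j ≡ k
        clash i j k e a b = inj j k (trans (addLeaf-nbr T p _ (subst (λ z → Adj T' z (c j)) e a)) (sym (addLeaf-nbr T p _ (subst (λ z → Adj T' z (c k)) e b))))
        two : ∀ i → c i ≡ fz → ⊥
        two fz e with clash fz (fs fz) (fromℕ (2 + l)) e (path fz) (sym' {c (fromℕ (2 + l))} close)
        ... | ()
        two (fs i) e with view i
        ... | ‵fromℕ with clash (fromℕ (2 + l)) (inject₁ (fromℕ (suc l))) fz e (sym' {c (inject₁ (fromℕ (suc l)))} (path (fromℕ (suc l)))) close
        ... | ()
        two (fs i) e | ‵inject₁ j with clash (fs (inject₁ j)) (inject₁ (inject₁ j)) (fs (fs j)) e (sym' {c (inject₁ (inject₁ j))} (path (inject₁ j))) (path (fs j))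
        ... | q = <⇒≢ (m<n⇒m<1+n (n<1+n (toℕ j))) (trans (sym (trans (Fin.toℕ-inject₁ (inject₁ j)) (Fin.toℕ-inject₁ j))) (cong toℕ q))

-- Depth-first tree decompositions

fromList : ∀ {n} → List (Fin n) → Subset n
fromList [] = Subset.⊥
fromList (x ∷ xs) = ⁅ x ⁆ ∪ fromList xs

∈-fromList⁺ : ∀ {n} {x : Fin n} {xs} → x ∈ xs → x Subset.∈ fromList xs
∈-fromList⁺ {x = x} (here refl) = Subset.x∈p∪q⁺ (inj₁ (Subset.x∈⁅x⁆ x))
∈-fromList⁺ (there m) = Subset.x∈p∪q⁺ (inj₂ (∈-fromList⁺ m))

∈-fromList⁻ : ∀ {n} {x : Fin n} xs → x Subset.∈ fromList xs → x ∈ xs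
∈-fromList⁻ [] m = ⊥-elim (Subset.∉⊥ m)
∈-fromList⁻ (y ∷ xs) m with Subset.x∈p∪q⁻ ⁅ y ⁆ (fromList xs) m
... | inj₁ m' = here (Subset.x∈⁅y⁆⇒x≡y y m')
... | inj₂ m' = there (∈-fromList⁻ xs m')

∣p∪q∣≤∣p∣+∣q∣ : ∀ {n} (p q : Subset n) → ∣ p ∪ q ∣ ≤ ∣ p ∣ + ∣ q ∣
∣p∪q∣≤∣p∣+∣q∣ Vec.[] Vec.[] = z≤n
∣p∪q∣≤∣p∣+∣q∣ (true Vec.∷ p) (true Vec.∷ q) = s≤s (≤-trans (∣p∪q∣≤∣p∣+∣q∣ p q) (+-monoʳ-≤ ∣ p ∣ (n≤1+n ∣ q ∣)))
∣p∪q∣≤∣p∣+∣q∣ (true Vec.∷ p) (false Vec.∷ q) = s≤s (∣p∪q∣≤∣p∣+∣q∣ p q)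
∣p∪q∣≤∣p∣+∣q∣ (false Vec.∷ p) (true Vec.∷ q) = ≤-trans (s≤s (∣p∪q∣≤∣p∣+∣q∣ p q)) (≤-reflexive (sym (+-suc ∣ p ∣ ∣ q ∣)))
∣p∪q∣≤∣p∣+∣q∣ (false Vec.∷ p) (false Vec.∷ q) = ∣p∪q∣≤∣p∣+∣q∣ p q

∣fromList∣ : ∀ {n} (xs : List (Fin n)) → ∣ fromList xs ∣ ≤ length xs
∣fromList∣ {n} [] = ≤-reflexive (Subset.∣⊥∣≡0 n)
∣fromList∣ (x ∷ xs) = ≤-trans (∣p∪q∣≤∣p∣+∣q∣ ⁅ x ⁆ (fromList xs)) (+-mono-≤ (≤-reflexive (Subset.∣⁅x⁆∣≡1 x)) (∣fromList∣ xs))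

module Walks (G : Graph) (simple : IsSimple G) where
  V = Fin (n G)
  infix 4 _~_
  _~_ : V → V → Set
  x ~ y = Adj G x y

  _~?_ : ∀ x y → Dec (x ~ y)
  x ~? y = E G x y Bool.≟ true

  ~-sym : ∀ {x y} → x ~ y → y ~ x
  ~-sym {x} {y} a = trans (proj₁ simple y x) a

  ~⇒≢ : ∀ {x y} → x ~ y → x ≢ y
  ~⇒≢ {x} a refl with trans (sym a) (proj₂ simple x)
  ... | ()

  record Off (D : List V) (x y : V) : Set where
    constructor off
    field
      adj : x ~ y
      left : x ∉ D
      right : y ∉ D
  open Off public

  off? : ∀ D x y → Dec (Off D x y)
  off? D x y = map′ (λ (a , b , c) → off a b c) (λ (off a b c) → a , b , c) (x ~? y ×-dec ¬? (x ∈? D) ×-dec ¬? (y ∈? D))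

  off-sym : ∀ {D x y} → Off D x y → Off D y x
  off-sym (off a b c) = off (~-sym a) c b

  star-sym : ∀ {D x y} → Star (Off D) x y → Star (Off D) y x
  star-sym ε = ε
  star-sym (r ◅ s) = star-sym s ◅◅ (off-sym r ◅ ε)

  linked-adj : ∀ {D xs} → Linked (Off D) xs → Linked _~_ xs
  linked-adj = Linked.map adj

  -- The reserved vertices `Res` enter the distinctness condition, so that disjointness from them is
  -- carried through every rerouting by the same count.
  record IsSpider (Res : List V) (c : V) (X Y Z : List V) : Set where
    constructor spider
    field
      legX : Linked _~_ (c ∷ X)
      legY : Linked _~_ (c ∷ Y)
      legZ : Linked _~_ (c ∷ Z)
      unique : Distinct (c ∷ X ++ Y ++ Z ++ Res)
  open IsSpider public

  record HasSpider (L : ℕ) (Res : List V) : Set where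
    field
      c : V
      X Y Z : List V
      isSpider : IsSpider Res c X Y Z
      lengthX : length X ≡ L
      lengthY : length Y ≡ L
      lengthZ : length Z ≡ L

  cnt-spider : ∀ (v c : V) (X Y Z R : List V) → cnt v (c ∷ X ++ Y ++ Z ++ R) ≡ δ v c + (cnt v X + (cnt v Y + (cnt v Z + cnt v R)))
  cnt-spider v c X Y Z R = cong (δ v c +_) (trans (cnt-++ v X _) (cong (cnt v X +_) (trans (cnt-++ v Y _) (cong (cnt v Y +_) (cnt-++ v Z R)))))

-- Skipping `k` entries with property `Q` leaves room for a leg of length `k` before the chosen one,
-- while the count of later entries pays for the remaining legs.
pick : ∀ {A : Set} {Q : A → Set} (Q? : Decidable Q) k xs → k < length (filter Q? xs) →
  ∃[ L ] ∃[ a ] ∃[ R ] (xs ≡ L ++ a ∷ R × Q a × k ≤ length L × length (filter Q? xs) ≤ suc k + length (filter Q? R))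
pick Q? k (x ∷ xs) lt with Q? x
pick Q? zero (x ∷ xs) lt | yes q = [] , x , xs , refl , q , z≤n , ≤-refl
pick Q? (suc k) (x ∷ xs) (s≤s lt) | yes q with pick Q? k xs lt
... | L , a , R , e , qa , le , le' = x ∷ L , a , R , cong (x ∷_) e , qa , s≤s le , s≤s le'
pick Q? k (x ∷ xs) lt | no _ with pick Q? k xs lt
... | L , a , R , e , qa , le , le' = x ∷ L , a , R , cong (x ∷_) e , qa , m≤n⇒m≤1+n le , le'

module DFS (G : Graph) (simple : IsSimple G) (L : ℕ) (X : List (Fin (n G))) (X! : Distinct X) where
  open Walks G simple

  -- D is the set of processed vertices, so the walk stays in the component of y in G - D.
  Attached : List V → V → V → Set
  Attached D y w = w ∈ D × ∃[ z ] (Star (Off D) y z × z ~ w)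

  attached? : ∀ D y w → Dec (Attached D y w)
  attached? D y w = (w ∈? D) ×-dec Fin.any? (λ z → star? (off? D) y z ×-dec (z ~? w))

  attached-trans : ∀ {D y y' w} → Star (Off D) y y' → Attached D y' w → Attached D y w
  attached-trans s (w∈ , z , s' , a) = w∈ , z , (s ◅◅ s') , a

  -- The deleted set `X` lies in every bag. To it come the processed vertex and at most 1 + 3L
  -- attached stack vertices, because one more would give a spider.
  bound : ℕ
  bound = length X + (2 + (L + L + L))

  -- Every unprocessed vertex carries its own stack and its own tree node, so the search never has
  -- to backtrack: a component that is not entered keeps its front. The field `stack-top` guarantees
  -- that the next vertex can prolong the stack as a path.
  record Front {k : ℕ} (bag : Fin k → List V) (D : List V) (y : V) : Set where
    field
      node : Fin k
      stack : List V
      stack-linked : Linked _~_ stack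
      stack-unique : Distinct stack
      stack∈D : ∀ {v} → v ∈ stack → v ∈ D
      stack∉X : ∀ {v} → v ∈ stack → v ∉ X
      stack-top : ∀ {p ps} → stack ≡ p ∷ ps → Attached D y p
      attached∈stack : ∀ {w} → Attached D y w → w ∈ X ⊎ w ∈ stack
      attached∈bag : ∀ {w} → Attached D y w → w ∈ bag node
      X⊆bag : ∀ {v} → v ∈ X → v ∈ bag node

  record State (D : List V) : Set where
    field
      T : Graph
      tree : IsTree T
      bag : Fin (n T) → List V
      X⊆D : ∀ {v} → v ∈ X → v ∈ D
      bag⊆D : ∀ s {v} → v ∈ bag s → v ∈ D
      vertex-cover : ∀ {v} → v ∈ D → ∃[ s ] v ∈ bag s
      edge-cover : ∀ {u v} → u ∈ D → v ∈ D → u ~ v → ∃[ s ] (u ∈ bag s × v ∈ bag s)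
      connected : ∀ v s s' → v ∈ bag s → v ∈ bag s' → Star (λ a b → Adj T a b × v ∈ bag a × v ∈ bag b) s s'
      width : ∀ s → length (bag s) ≤ bound
      front : ∀ y → y ∉ D → Front bag D y

  initial : State X
  initial = record
    { T = record { n = 1 ; E = λ _ _ → false }
    ; tree = ((λ _ _ → refl) , (λ _ → refl)) , s≤s z≤n , (λ { fz fz → ε }) , λ (l , c , inj , _) → noCycle l c inj
    ; bag = λ _ → X
    ; X⊆D = λ m → m
    ; bag⊆D = λ _ m → m
    ; vertex-cover = λ m → fz , m
    ; edge-cover = λ m m' _ → fz , m , m'
    ; connected = λ { v fz fz _ _ → ε }
    ; width = λ _ → m≤m+n _ _
    ; front = λ y y∉ → record
      { node = fz ; stack = [] ; stack-linked = [] ; stack-unique = Distinct-[] ; stack∈D = λ () ; stack∉X = λ ()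
      ; stack-top = λ () ; attached∈stack = λ a → inj₁ (proj₁ a) ; attached∈bag = proj₁ ; X⊆bag = λ m → m }
    }
    where
      noCycle : ∀ l (c : Fin (3 + l) → Fin 1) → Injective c → ⊥
      noCycle l c inj with inj fz (fs fz) (one (c fz) (c (fs fz)))
        where
          one : (a b : Fin 1) → a ≡ b
          one fz fz = refl
      ... | ()

  -- Two attached vertices, the centre `a` and a further one `b`, cut the stack into three long
  -- stretches. Two legs follow the stack from `a` in both directions; the third passes through the
  -- unprocessed component to `b` and continues on the stack beyond it. The number 3L + 2 counts
  -- `a`, `b` and L attached vertices in each stretch.
  spiderOnStack : ∀ {D} {P : List V} {y} → (∀ {v} → v ∈ X → v ∈ D) → y ∉ D → Linked _~_ P → Distinct P →
    (∀ {v} → v ∈ P → v ∈ D) → (∀ {v} → v ∈ P → v ∉ X) →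
    2 + (L + L + L) ≤ length (filter (attached? D y) P) → HasSpider L X
  spiderOnStack {D} {P} {y} X⊆D y∉ lP uP P⊆D P∉X big = build
    where
      Q? = attached? D y
      rest≥ : ∀ {r} → 2 + (L + L + L) ≤ suc L + r → suc (L + L) ≤ r
      rest≥ le = +-cancelˡ-≤ (suc L) (suc (L + L)) _ (≤-trans (≤-reflexive (cong suc (trans (+-suc L (L + L)) (cong suc (sym (+-assoc L L L)))))) le)
      build : HasSpider L X
      build with pick Q? L P (≤-trans (s≤s (≤-trans (m≤m+n L L) (≤-trans (m≤m+n (L + L) L) (n≤1+n _)))) big)
      ... | P₁ , a , S , refl , (a∈D , z , yz , z~a) , len₁ , le₁ with ≤-trans big le₁
      ... | le₁' with pick Q? L S (≤-trans (s≤s (m≤m+n L L)) (rest≥ le₁'))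
      ... | P₂ , b , P₃ , refl , (b∈D , z' , yz' , z'~b) , len₂ , le₃ = record
        { c = a ; X = take L (reverse P₁) ; Y = take L P₂ ; Z = take L (Q ++ b ∷ P₃)
        ; isSpider = spider
            (Linked-take (suc L) (subst (Linked _~_) (reverse-++-∷ P₁ a) (Linked-reverse ~-sym (P₁ ++ [ a ]) (Linked-left P₁ lP))))
            (Linked-take (suc L) (Linked-++ˡ (a ∷ P₂) (Linked-++ʳ P₁ lP)))
            (Linked-take (suc L) (subst (λ xs → Linked _~_ (a ∷ xs)) (sym Q-split)
              (Linked-glue (a ∷ inner) (subst (λ xs → Linked _~_ (a ∷ xs)) split (~-sym z~a ∷ linked-adj linked))
                 (subst (_~ b) (sym last∈) z'~b ∷ Linked-++ʳ P₂ (Linked-++ʳ (P₁ ++ [ a ]) (subst (Linked _~_) (sym (++-assoc P₁ [ a ] _)) lP))))))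
            (Distinct-mono count all!)
        ; lengthX = trans (length-take L _) (m≤n⇒m⊓n≡m (≤-trans len₁ (≤-reflexive (sym (length-reverse P₁)))))
        ; lengthY = trans (length-take L _) (m≤n⇒m⊓n≡m len₂)
        ; lengthZ = trans (length-take L _) (m≤n⇒m⊓n≡m (≤-trans len₃ (≤-trans (n≤1+n _) (≤-trans (m≤n+m _ (length Q)) (≤-reflexive (sym (length-++ Q))))))) }
        where
          open FirstHit (firstHit {R = Off D} (λ v → v Fin.≟ z') (star-sym yz ◅◅ yz') refl) renaming (unique to Q!)
          Q = z ∷ rest
          len₃ : L ≤ length P₃
          len₃ = ≤-trans (+-cancelˡ-≤ (suc L) L _ (≤-trans (rest≥ le₁') le₃)) (length-filter Q? P₃)
          Q-split : Q ++ b ∷ P₃ ≡ inner ++ last ∷ b ∷ P₃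
          Q-split = trans (cong (_++ b ∷ P₃) split) (++-assoc inner [ last ] (b ∷ P₃))
          Q∉D : ∀ {v} → v ∈ Q → v ∉ D
          Q∉D = Linked-all right (Star-last right y∉ yz) linked
          all! : Distinct ((P₁ ++ a ∷ P₂ ++ b ∷ P₃) ++ (Q ++ X))
          all! = Distinct-++ uP (Distinct-++ Q! X! (λ m m' → Q∉D m (X⊆D m'))) λ m m' → case (∈-++⁻ Q m') m
            where
              case : ∀ {v} → v ∈ Q ⊎ v ∈ X → v ∈ P₁ ++ a ∷ P₂ ++ b ∷ P₃ → ⊥
              case (inj₁ q) m = Q∉D q (P⊆D m)
              case (inj₂ x) m = P∉X m x
          count : ∀ v → cnt v (a ∷ take L (reverse P₁) ++ take L P₂ ++ take L (Q ++ b ∷ P₃) ++ X) ≤ cnt v ((P₁ ++ a ∷ P₂ ++ b ∷ P₃) ++ (Q ++ X))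
          count v = ≤-trans (≤-reflexive (cnt-spider v a (take L (reverse P₁)) (take L P₂) (take L (Q ++ b ∷ P₃)) X))
            (≤-trans (+-monoʳ-≤ (δ v a) (+-mono-≤ (cnt-take v L (reverse P₁)) (+-mono-≤ (cnt-take v L P₂) (+-monoˡ-≤ (cnt v X) (cnt-take v L (Q ++ b ∷ P₃))))))
              (≤-reflexive eq))
            where
              arith : ∀ a p₁ p₂ q b p₃ x → a + (p₁ + (p₂ + ((q + (b + p₃)) + x))) ≡ (p₁ + (a + (p₂ + (b + p₃)))) + (q + x)
              arith = solve-∀
              eq : δ v a + (cnt v (reverse P₁) + (cnt v P₂ + (cnt v (Q ++ b ∷ P₃) + cnt v X))) ≡ cnt v ((P₁ ++ a ∷ P₂ ++ b ∷ P₃) ++ (Q ++ X))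
              eq rewrite cnt-reverse v P₁ | cnt-++ v Q (b ∷ P₃) | cnt-++ v (P₁ ++ a ∷ P₂ ++ b ∷ P₃) (Q ++ X) | cnt-++ v Q X | cnt-++ v P₁ (a ∷ P₂ ++ b ∷ P₃) | cnt-++ v P₂ (b ∷ P₃)
                = arith (δ v a) (cnt v P₁) (cnt v P₂) (cnt v Q) (δ v b) (cnt v P₃) (cnt v X)

  forget : ∀ {D x z y} → Star (Off (x ∷ D)) z y → Star (Off D) z y
  forget = gmap (λ v → v) λ (off a l r) → off a (λ m → l (there m)) (λ m → r (there m))

  off-∷ : ∀ {D x z y} → Off D z y → z ≢ x → y ≢ x → Off (x ∷ D) z y
  off-∷ (off a l r) z≢ y≢ = off a (λ { (here e) → z≢ e ; (there m) → l m }) (λ { (here e) → y≢ e ; (there m) → r m })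

  -- Shows that each piece into which the component of `x` falls is attached to `x`, the new stack
  -- top.
  stop-before : ∀ {D x z} → Star (Off D) z x → z ≢ x → ∃[ y ] (Star (Off (x ∷ D)) z y × y ~ x)
  stop-before ε z≢x = ⊥-elim (z≢x refl)
  stop-before {x = x} (_◅_ {j = y} r s) z≢x with y Fin.≟ x
  ... | yes refl = _ , ε , adj r
  ... | no y≢x with stop-before s y≢x
  ... | y' , s' , a = y' , off-∷ r z≢x y≢x ◅ s' , a

  -- Processing `x` does not affect a component that does not contain it.
  bypass : ∀ {D x z y} → ¬ Star (Off D) z x → Star (Off D) z y → Star (Off (x ∷ D)) z y
  bypass ¬s ε = ε
  bypass ¬s (r ◅ s) = off-∷ r (λ { refl → ¬s ε }) (λ { refl → ¬s (r ◅ ε) }) ◅ bypass (λ s' → ¬s (r ◅ s')) s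

  record Next {k : ℕ} (bag : Fin k → List V) (D : List V) : Set where
    field
      x : V
      x∉D : x ∉ D
      frontier : Front bag D x
      top~x : ∀ {p ps} → Front.stack frontier ≡ p ∷ ps → p ~ x

  -- Replaces `y` by a vertex of its component adjacent to the stack top. Attachment depends only on
  -- the component, so the front carries over.
  next : ∀ {k} {bag : Fin k → List V} {D y} → y ∉ D → Front bag D y → Next bag D
  next {bag = bag} {D} {y} y∉ F with Front.stack F in eq
  ... | [] = record { x = y ; x∉D = y∉ ; frontier = F ; top~x = λ e → ⊥-elim (case (trans (sym eq) e)) }
    where
      case : ∀ {p} {ps : List V} → _≡_ {A = List V} [] (p ∷ ps) → ⊥
      case ()
  ... | p ∷ ps with Front.stack-top F eq
  ... | p∈D , x , yx , x~p = record
    { x = x ; x∉D = Star-last right y∉ yx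
    ; frontier = record
      { node = node ; stack = stack ; stack-linked = stack-linked ; stack-unique = stack-unique ; stack∈D = stack∈D ; stack∉X = stack∉X
      ; stack-top = λ e → proj₁ (stack-top e) , back (stack-top e)
      ; attached∈stack = λ a → attached∈stack (attached-trans yx a) ; attached∈bag = λ a → attached∈bag (attached-trans yx a) ; X⊆bag = X⊆bag }
    ; top~x = λ e → subst (_~ x) (heads (trans (sym eq) e)) (~-sym x~p) }
    where
      open Front F
      back : ∀ {w} → Attached D y w → ∃[ z ] (Star (Off D) x z × z ~ w)
      back (_ , z , s , a) = z , star-sym yx ◅◅ s , a
      heads : ∀ {a b : V} {as bs : List V} → _≡_ {A = List V} (a ∷ as) (b ∷ bs) → a ≡ b
      heads refl = refl

  -- The new bag becomes a leaf at `node`, whose bag contains `X` and everything attached to the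
  -- component. Hence each vertex of the new bag other than `x` already lies in the bag of `node`,
  -- and its bags stay connected.
  process : ∀ {D} (S : State D) (N : Next (State.bag S) D) →
    length (filter (attached? D (Next.x N)) (Front.stack (Next.frontier N))) ≤ 1 + (L + L + L) →
    State (Next.x N ∷ D)
  process {D} S N small = record
    { T = addLeaf T node ; tree = addLeaf-tree T node tree ; bag = bag' ; X⊆D = λ m → there (X⊆D m)
    ; bag⊆D = λ { fz m → new⊆ m ; (fs s) m → there (bag⊆D s m) }
    ; vertex-cover = λ { (here refl) → fz , x∈new ; (there m) → fs (proj₁ (vertex-cover m)) , proj₂ (vertex-cover m) }
    ; edge-cover = edges
    ; connected = conn
    ; width = λ { fz → small' ; (fs s) → width s }
    ; front = fronts }
    where
      open State S
      open Next N
      open Front frontier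
      back : List V
      back = filter (attached? D x) stack
      new : List V
      new = X ++ x ∷ back
      bag' : Fin (suc (n T)) → List V
      bag' fz = new
      bag' (fs s) = bag s
      x∈new : x ∈ new
      x∈new = ∈-++⁺ʳ X (here refl)
      new⁻ : ∀ {v} → v ∈ new → v ≡ x ⊎ (v ∈ bag node × v ∈ D)
      new⁻ m with ∈-++⁻ X m
      ... | inj₁ m' = inj₂ (X⊆bag m' , X⊆D m')
      ... | inj₂ (here e) = inj₁ e
      ... | inj₂ (there m') with ∈-filter⁻ (attached? D x) {xs = stack} m'
      ... | v∈ , a = inj₂ (attached∈bag a , stack∈D v∈)
      new⊆ : ∀ {v} → v ∈ new → v ∈ x ∷ D
      new⊆ m with new⁻ m
      ... | inj₁ e = here e
      ... | inj₂ (_ , m') = there m'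
      new⁺ : ∀ {w} → Attached D x w → w ∈ new
      new⁺ a with attached∈stack a
      ... | inj₁ m = ∈-++⁺ˡ m
      ... | inj₂ m = ∈-++⁺ʳ X (there (∈-filter⁺ (attached? D x) m a))
      small' : length new ≤ bound
      small' = ≤-trans (≤-reflexive (length-++ X)) (+-monoʳ-≤ (length X) (s≤s small))
      edges : ∀ {u v} → u ∈ x ∷ D → v ∈ x ∷ D → u ~ v → ∃[ s ] (u ∈ bag' s × v ∈ bag' s)
      edges (here refl) (here refl) a = ⊥-elim (~⇒≢ a refl)
      edges (here refl) (there m) a = fz , x∈new , new⁺ (m , x , ε , a)
      edges (there m) (here refl) a = fz , new⁺ (m , x , ε , ~-sym a) , x∈new
      edges (there m) (there m') a with edge-cover m m' a
      ... | s , i , j = fs s , i , j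
      Step : V → Fin (suc (n T)) → Fin (suc (n T)) → Set
      Step v a b = Adj (addLeaf T node) a b × v ∈ bag' a × v ∈ bag' b
      old : ∀ {v s} → v ∈ new → v ∈ bag s → v ∈ bag node
      old m m' with new⁻ m
      ... | inj₁ refl = ⊥-elim (x∉D (bag⊆D _ m'))
      ... | inj₂ (i , _) = i
      conn : ∀ v s s' → v ∈ bag' s → v ∈ bag' s' → Star (Step v) s s'
      conn v fz fz m m' = ε
      conn v fz (fs s') m m' = (addLeaf-edge T node , m , old m m') ◅ gmap fs (λ a → a) (connected v node s' (old m m') m')
      conn v (fs s) fz m m' = gmap fs (λ a → a) (connected v s node m (old m' m)) ◅◅
        ((trans (proj₁ (addLeaf-simple T node (proj₁ tree)) (fs node) fz) (addLeaf-edge T node) , old m' m , m') ◅ ε)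
      conn v (fs s) (fs s') m m' = gmap fs (λ a → a) (connected v s s' m m')
      fronts : ∀ z → z ∉ x ∷ D → Front bag' (x ∷ D) z
      fronts z z∉ with star? (off? D) z x
      ... | yes zx = record
        { node = fz ; stack = x ∷ stack
        ; stack-linked = extend stack-linked top~x
        ; stack-unique = Distinct-∷ (λ m → x∉D (stack∈D m)) stack-unique
        ; stack∈D = λ { (here e) → here e ; (there m) → there (stack∈D m) }
        ; stack∉X = λ { (here refl) m → x∉D (X⊆D m) ; (there m) → stack∉X m }
        ; stack-top = λ { refl → here refl , stop-before zx (λ e → z∉ (here e)) }
        ; attached∈stack = λ { (here refl , _) → inj₂ (here refl) ; (there m , y , s , a) → shift (attached∈stack (att m s a)) }
        ; attached∈bag = λ { (here refl , _) → x∈new ; (there m , y , s , a) → new⁺ (att m s a) }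
        ; X⊆bag = λ m → ∈-++⁺ˡ m }
        where
          att : ∀ {w y} → w ∈ D → Star (Off (x ∷ D)) z y → y ~ w → Attached D x w
          att m s a = m , _ , star-sym zx ◅◅ forget s , a
          shift : ∀ {w} → w ∈ X ⊎ w ∈ stack → w ∈ X ⊎ w ∈ x ∷ stack
          shift (inj₁ m) = inj₁ m
          shift (inj₂ m) = inj₂ (there m)
          extend : ∀ {ps : List V} → Linked _~_ ps → (∀ {q qs} → ps ≡ q ∷ qs → q ~ x) → Linked _~_ (x ∷ ps)
          extend [] f = [-]
          extend [-] f = ~-sym (f refl) ∷ [-]
          extend (r ∷ l) f = ~-sym (f refl) ∷ r ∷ l
      ... | no ¬zx = record
        { node = fs F.node ; stack = F.stack ; stack-linked = F.stack-linked ; stack-unique = F.stack-unique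
        ; stack∈D = λ m → there (F.stack∈D m) ; stack∉X = F.stack∉X
        ; stack-top = λ e → top (F.stack-top e)
        ; attached∈stack = λ a → F.attached∈stack (att a) ; attached∈bag = λ a → F.attached∈bag (att a)
        ; X⊆bag = F.X⊆bag }
        where
          module F = Front (front z (λ m → z∉ (there m)))
          top : ∀ {w} → Attached D z w → Attached (x ∷ D) z w
          top (m , y , s , a) = there m , y , bypass ¬zx s , a
          att : ∀ {w} → Attached (x ∷ D) z w → Attached D z w
          att (here refl , y , s , a) = ⊥-elim (¬zx (forget s ◅◅ (off a (Star-last right (λ m → z∉ (there m)) (forget s)) x∉D ◅ ε)))
          att (there m , y , s , a) = m , y , forget s , a

  unprocessed : List V → List V
  unprocessed D = filter (λ v → ¬? (v ∈? D)) (allFin (n G))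

  unprocessed-∷ : ∀ {D : List V} {x} → x ∉ D → ∀ vs → x ∈ vs →
    length (filter (λ v → ¬? (v ∈? (x ∷ D))) vs) < length (filter (λ v → ¬? (v ∈? D)) vs)
  unprocessed-∷ {D} {x} x∉ vs m = strict vs m
    where
      P? = λ v → ¬? (v ∈? (x ∷ D))
      Q? = λ v → ¬? (v ∈? D)
      weak : ∀ vs → length (filter P? vs) ≤ length (filter Q? vs)
      weak [] = z≤n
      weak (v ∷ vs) with v Fin.≟ x | v ∈? D
      ... | yes _ | yes _ = weak vs
      ... | yes _ | no _ = m≤n⇒m≤1+n (weak vs)
      ... | no _ | yes _ = weak vs
      ... | no _ | no _ = s≤s (weak vs)
      strict : ∀ vs → x ∈ vs → length (filter P? vs) < length (filter Q? vs)
      strict (v ∷ vs) (here refl) with v Fin.≟ v | v ∈? D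
      ... | yes _ | yes m = ⊥-elim (x∉ m)
      ... | yes _ | no _ = s≤s (weak vs)
      ... | no ¬e | _ = ⊥-elim (¬e refl)
      strict (v ∷ vs) (there m) with v Fin.≟ x | v ∈? D
      ... | yes _ | yes _ = strict vs m
      ... | yes _ | no _ = m≤n⇒m≤1+n (strict vs m)
      ... | no _ | yes _ = strict vs m
      ... | no _ | no _ = s≤s (strict vs m)

  finish : ∀ {D} → State D → (∀ v → v ∈ D) → ∀ {w} → bound ≤ suc w → TwAtMost G w
  finish S all le = record
    { T = T ; tree = tree ; B = λ s → fromList (bag s)
    ; vertexCover = λ v → proj₁ (vertex-cover (all v)) , ∈-fromList⁺ (proj₂ (vertex-cover (all v)))
    ; edgeCover = λ u v a → let (s , i , j) = edge-cover (all u) (all v) a in s , ∈-fromList⁺ i , ∈-fromList⁺ j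
    ; connectedBags = λ v s s' i j → gmap (λ a → a) (λ (a , i , j) → a , ∈-fromList⁺ i , ∈-fromList⁺ j)
        (connected v s s' (∈-fromList⁻ (bag s) i) (∈-fromList⁻ (bag s') j))
    ; width = λ s → ≤-trans (∣fromList∣ (bag s)) (≤-trans (width s) le) }
    where open State S

  explore : ∀ {w} → bound ≤ suc w → ∀ fuel {D} → State D → length (unprocessed D) ≤ fuel → TwAtMost G w ⊎ HasSpider L X
  explore le fuel {D} S len with unprocessed D in eq
  ... | [] = inj₁ (finish S all le)
    where
      all : ∀ v → v ∈ D
      all v with v ∈? D
      ... | yes m = m
      ... | no ¬m with subst (v ∈_) eq (∈-filter⁺ (λ v → ¬? (v ∈? D)) (∈-allFin v) ¬m)
      ... | ()
  explore {w} le (suc fuel) {D} S len | y ∷ ys = go (_ ≤? _)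
    where
      y∉ : y ∉ D
      y∉ = proj₂ (∈-filter⁻ (λ v → ¬? (v ∈? D)) {xs = allFin (n G)} (subst (y ∈_) (sym eq) (here refl)))
      N = next y∉ (State.front S y y∉)
      open Next N
      open Front frontier
      go : Dec (length (filter (attached? D x) stack) ≤ 1 + (L + L + L)) → TwAtMost G w ⊎ HasSpider L X
      go (yes small) = explore le fuel (process S N small)
        (≤-pred (≤-trans (unprocessed-∷ {D} x∉D (allFin (n G)) (∈-allFin x)) (subst (λ l → length l ≤ suc fuel) (sym eq) len)))
      go (no big) = inj₂ (spiderOnStack (State.X⊆D S) x∉D stack-linked stack-unique stack∈D stack∉X (≰⇒> big))

  tw⊎spider : ∀ {w} → bound ≤ suc w → TwAtMost G w ⊎ HasSpider L X
  tw⊎spider le = explore le _ initial ≤-refl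

-- Disjoint spiders, and the positions of tS

module Family (G : Graph) (simple : IsSimple G) (L : ℕ) where
  open Walks G simple

  -- The index list collects all vertices used so far; it is the set deleted before the search for
  -- the next spider.
  data Spiders : ℕ → List V → Set where
    none : Spiders 0 []
    add : ∀ {k Res} → Spiders k Res → (S : HasSpider L Res) →
      Spiders (suc k) (HasSpider.c S ∷ HasSpider.X S ++ HasSpider.Y S ++ HasSpider.Z S ++ Res)

  spiders-unique : ∀ {k Res} → Spiders k Res → Distinct Res
  spiders-unique none = Distinct-[]
  spiders-unique (add _ S) = IsSpider.unique (HasSpider.isSpider S)

  spiders-size : ∀ {k Res} → Spiders k Res → length Res ≡ k * suc (L + (L + L))
  spiders-size none = refl
  spiders-size {suc k} (add {Res = Res} F S) = cong suc (trans (length-++ X) (trans (cong (length X +_) (trans (length-++ Y) (cong (length Y +_) (length-++ Z)))) eq))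
    where
      open HasSpider S
      arith : ∀ L r → L + (L + (L + r)) ≡ (L + (L + L)) + r
      arith = solve-∀
      eq : length X + (length Y + (length Z + length Res)) ≡ (L + (L + L)) + k * suc (L + (L + L))
      eq rewrite lengthX | lengthY | lengthZ | spiders-size F = arith L (k * suc (L + (L + L)))

  -- All k(3L + 1) vertices of the deleted spiders lie in every bag, next to at most 3L + 2 others.
  width : ℕ → ℕ
  width k = k * suc (L + (L + L)) + (2 + (L + L + L))

  width-suc : ∀ k → width k ≤ width (suc k)
  width-suc k = +-monoˡ-≤ (2 + (L + L + L)) (m≤n+m (k * suc (L + (L + L))) (suc (L + (L + L))))

  tw⊎spiders : ∀ k {w} → width k ≤ suc w → TwAtMost G w ⊎ ∃[ Res ] Spiders k Res
  tw⊎spiders zero le = inj₂ ([] , none)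
  tw⊎spiders (suc k) le with tw⊎spiders k (≤-trans (width-suc k) le)
  ... | inj₁ tw = inj₁ tw
  ... | inj₂ (Res , F) with DFS.tw⊎spider G simple L Res (spiders-unique F)
       (≤-trans (≤-trans (≤-reflexive (cong (_+ (2 + (L + L + L))) (spiders-size F))) (width-suc k)) le)
  ... | inj₁ tw = inj₁ tw
  ... | inj₂ S = inj₂ (_ , add F S)

data SPos (t : ℕ) : Set where
  ctr : SPos t
  leg : Fin 3 → Fin t → SPos t

data Down {t} : SPos t → SPos t → Set where
  first : ∀ {i s} → toℕ s ≡ 0 → Down ctr (leg i s)
  next : ∀ {i s s'} → suc (toℕ s) ≡ toℕ s' → Down (leg i s) (leg i s')

Pos : ℕ → Set
Pos t = Fin t × SPos t

PAdj : ∀ {t} → Pos t → Pos t → Set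
PAdj (k , a) (k' , b) = k ≡ k' × (Down a b ⊎ Down b a)

_≟S_ : ∀ {t} (a b : SPos t) → Dec (a ≡ b)
ctr ≟S ctr = yes refl
ctr ≟S leg _ _ = no λ ()
leg _ _ ≟S ctr = no λ ()
leg i s ≟S leg j s' with i Fin.≟ j | s Fin.≟ s'
... | yes refl | yes refl = yes refl
... | no ne | _ = no λ { refl → ne refl }
... | yes _ | no ne = no λ { refl → ne refl }

_≟P_ : ∀ {t} (p q : Pos t) → Dec (p ≡ q)
(k , a) ≟P (k' , b) with k Fin.≟ k' | a ≟S b
... | yes refl | yes refl = yes refl
... | no ne | _ = no λ { refl → ne refl }
... | yes _ | no ne = no λ { refl → ne refl }

module Coding (t : ℕ) where
  size : ℕ
  size = t * suc (3 * t)

  decodeS : Fin (suc (3 * t)) → SPos t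
  decodeS fz = ctr
  decodeS (fs i) = leg (proj₁ (remQuot {3} t i)) (proj₂ (remQuot {3} t i))

  encodeS : SPos t → Fin (suc (3 * t))
  encodeS ctr = fz
  encodeS (leg i s) = fs (combine i s)

  decode : Fin size → Pos t
  decode a = proj₁ (remQuot {t} (suc (3 * t)) a) , decodeS (proj₂ (remQuot {t} (suc (3 * t)) a))

  encode : Pos t → Fin size
  encode (k , a) = combine k (encodeS a)

  decodeS-encodeS : ∀ a → decodeS (encodeS a) ≡ a
  decodeS-encodeS ctr = refl
  decodeS-encodeS (leg i s) = cong (λ (j , p) → leg j p) (Fin.remQuot-combine {3} {t} i s)

  encodeS-decodeS : ∀ a → encodeS (decodeS a) ≡ a
  encodeS-decodeS fz = refl
  encodeS-decodeS (fs i) = cong fs (Fin.combine-remQuot {3} t i)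

  decode-encode : ∀ p → decode (encode p) ≡ p
  decode-encode (k , a) = trans (cong (λ (j , z) → j , decodeS z) (Fin.remQuot-combine {t} {suc (3 * t)} k (encodeS a))) (cong (k ,_) (decodeS-encodeS a))

  encode-decode : ∀ a → encode (decode a) ≡ a
  encode-decode a = trans (cong (combine (proj₁ (remQuot {t} (suc (3 * t)) a))) (encodeS-decodeS _)) (Fin.combine-remQuot {t} (suc (3 * t)) a)

  decode-injective : ∀ {a b} → decode a ≡ decode b → a ≡ b
  decode-injective {a} {b} e = trans (sym (encode-decode a)) (trans (cong encode e) (encode-decode b))

  encode-injective : ∀ {p q} → encode p ≡ encode q → p ≡ q
  encode-injective {p} {q} e = trans (sym (decode-encode p)) (trans (cong decode e) (decode-encode q))

  private
    ≡ᵇ⇒ : ∀ {m n} → (m ≡ᵇ n) ≡ true → m ≡ n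
    ≡ᵇ⇒ {zero} {zero} _ = refl
    ≡ᵇ⇒ {suc m} {suc n} e = cong suc (≡ᵇ⇒ {m} {n} e)

    ⇒≡ᵇ : ∀ {m n} → m ≡ n → (m ≡ᵇ n) ≡ true
    ⇒≡ᵇ {m} refl = go m
      where
        go : ∀ m → (m ≡ᵇ m) ≡ true
        go zero = refl
        go (suc m) = go m

    ∧⇒ : ∀ {x y} → x ∧ y ≡ true → x ≡ true × y ≡ true
    ∧⇒ {true} {true} _ = refl , refl

    ∨⇒ : ∀ {x y} → x ∨ y ≡ true → x ≡ true ⊎ y ≡ true
    ∨⇒ {true} _ = inj₁ refl
    ∨⇒ {false} e = inj₂ e

    ∨-trueʳ : ∀ x → x ∨ true ≡ true
    ∨-trueʳ true = refl
    ∨-trueʳ false = refl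

  private
    leg-adj : Fin 3 → Fin t → Fin 3 → Fin t → Bool
    leg-adj j p j' p' = (toℕ j ≡ᵇ toℕ j') ∧ ((suc (toℕ p) ≡ᵇ toℕ p') ∨ (suc (toℕ p') ≡ᵇ toℕ p))

    leg-adj⇒ : ∀ j p j' p' → leg-adj j p j' p' ≡ true → Down (leg j p) (leg j' p') ⊎ Down (leg j' p') (leg j p)
    leg-adj⇒ j p j' p' e with ∧⇒ {toℕ j ≡ᵇ toℕ j'} e
    ... | e₁ , e₂ with Fin.toℕ-injective (≡ᵇ⇒ {toℕ j} {toℕ j'} e₁) | ∨⇒ {suc (toℕ p) ≡ᵇ toℕ p'} e₂
    ... | refl | inj₁ q = inj₁ (next (≡ᵇ⇒ {suc (toℕ p)} {toℕ p'} q))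
    ... | refl | inj₂ q = inj₂ (next (≡ᵇ⇒ {suc (toℕ p')} {toℕ p} q))

    leg-adj⇐ : ∀ j p j' p' → Down (leg j p) (leg j' p') ⊎ Down (leg j' p') (leg j p) → leg-adj j p j' p' ≡ true
    leg-adj⇐ j p j p' (inj₁ (next e)) = cong₂ _∧_ (⇒≡ᵇ {toℕ j} refl) (cong (_∨ (suc (toℕ p') ≡ᵇ toℕ p)) (⇒≡ᵇ e))
    leg-adj⇐ j p j p' (inj₂ (next e)) = cong₂ _∧_ (⇒≡ᵇ {toℕ j} refl) (trans (cong ((suc (toℕ p) ≡ᵇ toℕ p') ∨_) (⇒≡ᵇ e)) (∨-trueʳ (suc (toℕ p) ≡ᵇ toℕ p')))

  S-adj⇒ : ∀ a b → S-adj t a b ≡ true → Down (decodeS a) (decodeS b) ⊎ Down (decodeS b) (decodeS a)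
  S-adj⇒ fz (fs i) e = inj₁ (first (≡ᵇ⇒ e))
  S-adj⇒ (fs i) fz e = inj₂ (first (≡ᵇ⇒ e))
  S-adj⇒ (fs i) (fs i') e = leg-adj⇒ (proj₁ (remQuot {3} t i)) _ (proj₁ (remQuot {3} t i')) _ e

  S-adj⇐ : ∀ a b → Down (decodeS a) (decodeS b) ⊎ Down (decodeS b) (decodeS a) → S-adj t a b ≡ true
  S-adj⇐ fz fz (inj₁ ())
  S-adj⇐ fz fz (inj₂ ())
  S-adj⇐ fz (fs i) (inj₁ (first e)) = ⇒≡ᵇ e
  S-adj⇐ (fs i) fz (inj₂ (first e)) = ⇒≡ᵇ e
  S-adj⇐ (fs i) (fs i') d = leg-adj⇐ (proj₁ (remQuot {3} t i)) _ (proj₁ (remQuot {3} t i')) _ d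

  adj⇒ : ∀ a b → Adj (tS t) a b → PAdj (decode a) (decode b)
  adj⇒ a b e with ∧⇒ {toℕ (proj₁ (remQuot {t} (suc (3 * t)) a)) ≡ᵇ toℕ (proj₁ (remQuot {t} (suc (3 * t)) b))} e
  ... | e₁ , e₂ = Fin.toℕ-injective (≡ᵇ⇒ e₁) , S-adj⇒ _ _ e₂

  adj⇐ : ∀ a b → PAdj (decode a) (decode b) → Adj (tS t) a b
  adj⇐ a b (e , d) rewrite ⇒≡ᵇ (cong toℕ e) = S-adj⇐ _ _ d

-- Embeddings of tS

module Embeddings (G : Graph) (simple : IsSimple G) (t : ℕ) where
  open Walks G simple
  open Coding t

  record Emb : Set where
    field
      φ : Pos t → V
      injective : ∀ {p q} → φ p ≡ φ q → p ≡ q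
      edge : ∀ k {a b} → Down a b → φ (k , a) ~ φ (k , b)
  open Emb public

  PAdj⇒~ : (e : Emb) → ∀ {p q} → PAdj p q → φ e p ~ φ e q
  PAdj⇒~ e (refl , inj₁ d) = edge e _ d
  PAdj⇒~ e (refl , inj₂ d) = ~-sym (edge e _ d)

  module _ (any : Emb) (good : ∀ p q → p ≢ q → ¬ PAdj p q → ∃[ e ] ¬ (φ e p ~ φ e q)) where
    private
      m = size

      pairEmb : ∀ i j → ∃[ e ] (i ≢ j → ¬ Adj (tS t) i j → ¬ (φ e (decode i) ~ φ e (decode j)))
      pairEmb i j with i Fin.≟ j | E (tS t) i j Bool.≟ true
      ... | yes e | _ = any , λ ne → ⊥-elim (ne e)
      ... | no _ | yes a = any , λ _ na → ⊥-elim (na a)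
      ... | no ne | no na with good (decode i) (decode j) (λ e → ne (decode-injective e)) (λ a → na (adj⇐ i j a))
      ... | e , bad = e , λ _ _ → bad

      -- The first embedding occurs twice, so that labels outside tS are not shared.
      embs : Fin (2 + m * m) → Emb
      embs fz = any
      embs (fs fz) = any
      embs (fs (fs a)) = proj₁ (pairEmb (proj₁ (remQuot {m} m a)) (proj₂ (remQuot {m} m a)))

      ψ : Fin (2 + m * m) → Fin m → V
      ψ l i = φ (embs l) (decode i)

      ψ-injective : ∀ l {i j} → ψ l i ≡ ψ l j → i ≡ j
      ψ-injective l e = decode-injective (injective (embs l) e)

      hit? : ∀ l v → Dec (∃[ i ] ψ l i ≡ v)
      hit? l v = Fin.any? (λ i → ψ l i Fin.≟ v)

      out : Fin (2 + m * m) → V → ℕ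
      out l v = m + toℕ (combine l v)

      label : ∀ l v → Dec (∃[ i ] ψ l i ≡ v) → ℕ
      label l v (yes (i , _)) = toℕ i
      label l v (no _) = out l v

      α : Fin (2 + m * m) → V → ℕ
      α l v = label l v (hit? l v)

      small≢out : ∀ (i : Fin m) l v → toℕ i ≢ out l v
      small≢out i l v e = <⇒≱ (Fin.toℕ<n i) (≤-trans (m≤m+n m _) (≤-reflexive (sym e)))

      out-injective : ∀ {l l' v v'} → out l v ≡ out l' v' → l ≡ l' × v ≡ v'
      out-injective e = Fin.combine-injective _ _ _ _ (Fin.toℕ-injective (+-cancelˡ-≡ m _ _ e))

      α-injective : ∀ l → Injective (α l)
      α-injective l v w e with hit? l v | hit? l w
      ... | yes (i , p) | yes (j , q) = trans (sym p) (trans (cong (ψ l) (Fin.toℕ-injective e)) q)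
      ... | yes (i , _) | no _ = ⊥-elim (small≢out i l w e)
      ... | no _ | yes (i , _) = ⊥-elim (small≢out i l v (sym e))
      ... | no _ | no _ = proj₂ (out-injective {l} {l} e)

      α-ψ : ∀ l i → α l (ψ l i) ≡ toℕ i
      α-ψ l i with hit? l (ψ l i)
      ... | yes (j , e) = cong toℕ (ψ-injective l e)
      ... | no ¬h = ⊥-elim (¬h (i , refl))

      α⁻ : ∀ l {v} i → α l v ≡ toℕ i → v ≡ ψ l i
      α⁻ l {v} i e = α-injective l v (ψ l i) (trans e (sym (α-ψ l i)))

      common : ∀ x → InterVertex G α x → ∃[ i ] toℕ i ≡ x
      common x h with h fz | h (fs fz)
      ... | v , e | w , e' with hit? fz v | hit? (fs fz) w
      ... | yes (i , _) | _ = i , e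
      ... | no _ | yes (i , _) = i , e'
      ... | no _ | no _ with out-injective {fz} {fs fz} {v} {w} (trans e (sym e'))
      ... | () , _

      edges : ∀ i j → Adj (tS t) i j ⇔ InterEdge G α (toℕ i) (toℕ j)
      edges i j = mk⇔ to from
        where
          to : Adj (tS t) i j → InterEdge G α (toℕ i) (toℕ j)
          to a l = ψ l i , ψ l j , α-ψ l i , α-ψ l j , PAdj⇒~ (embs l) (adj⇒ i j a)
          adj-at : ∀ l → InterEdge G α (toℕ i) (toℕ j) → ψ l i ~ ψ l j
          adj-at l h with h l
          ... | v , w , e , e' , a = subst₂ _~_ (α⁻ l i e) (α⁻ l j e') a
          from : InterEdge G α (toℕ i) (toℕ j) → Adj (tS t) i j
          from h with E (tS t) i j Bool.≟ true
          ... | yes a = a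
          ... | no na = ⊥-elim (proj₂ (pairEmb i j) i≢j na
                  (subst₂ (λ i' j' → φ (proj₁ (pairEmb i' j')) (decode i) ~ φ (proj₁ (pairEmb i' j')) (decode j))
                    (cong proj₁ (Fin.remQuot-combine {m} {m} i j)) (cong proj₂ (Fin.remQuot-combine {m} {m} i j))
                    (adj-at (fs (fs (combine i j))) h)))
            where
              i≢j : i ≢ j
              i≢j e = ~⇒≢ (adj-at fz h) (cong (ψ fz) e)

    -- The positions of `tS` carry the same labels below `size` in all embeddings, whereas the other
    -- labels are private to one of them. The edges survive, and each non-edge is destroyed by the
    -- embedding chosen for that pair.
    selfIntersects : SelfIntersects G (tS t)
    selfIntersects = suc (m * m) , α , α-injective , toℕ , (λ x y e → Fin.toℕ-injective e)
      , (λ i l → ψ l i , α-ψ l i) , common , edges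

  module _ (arm : Fin 3 → List V) (D : Distinct (arm fz ++ arm (fs fz) ++ arm (fs (fs fz)))) where
    private
      D' = Distinct-++ʳ (arm fz) D

    arms-disjoint : ∀ i j {v} → v ∈ arm i → v ∈ arm j → i ≡ j
    arms-disjoint fz fz _ _ = refl
    arms-disjoint (fs fz) (fs fz) _ _ = refl
    arms-disjoint (fs (fs fz)) (fs (fs fz)) _ _ = refl
    arms-disjoint fz (fs fz) m m' = ⊥-elim (Distinct-disjoint (arm fz) D m (∈-++⁺ˡ m'))
    arms-disjoint fz (fs (fs fz)) m m' = ⊥-elim (Distinct-disjoint (arm fz) D m (∈-++⁺ʳ (arm (fs fz)) m'))
    arms-disjoint (fs fz) (fs (fs fz)) m m' = ⊥-elim (Distinct-disjoint (arm (fs fz)) D' m m')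
    arms-disjoint (fs fz) fz m m' = ⊥-elim (Distinct-disjoint (arm fz) D m' (∈-++⁺ˡ m))
    arms-disjoint (fs (fs fz)) fz m m' = ⊥-elim (Distinct-disjoint (arm fz) D m' (∈-++⁺ʳ (arm (fs fz)) m))
    arms-disjoint (fs (fs fz)) (fs fz) m m' = ⊥-elim (Distinct-disjoint (arm (fs fz)) D' m' m)

    arm-distinct : ∀ i → Distinct (arm i)
    arm-distinct fz = Distinct-++ˡ (arm fz) D
    arm-distinct (fs fz) = Distinct-++ˡ (arm (fs fz)) D'
    arm-distinct (fs (fs fz)) = Distinct-++ʳ (arm (fs fz)) D'

  arm⊆ : ∀ (arm : Fin 3 → List V) i {v} → v ∈ arm i → v ∈ arm fz ++ arm (fs fz) ++ arm (fs (fs fz))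
  arm⊆ arm fz m = ∈-++⁺ˡ m
  arm⊆ arm (fs fz) m = ∈-++⁺ʳ (arm fz) (∈-++⁺ˡ m)
  arm⊆ arm (fs (fs fz)) m = ∈-++⁺ʳ (arm fz) (∈-++⁺ʳ (arm (fs fz)) m)

  record Tripod : Set where
    field
      centre : V
      arm : Fin 3 → List V
      linked : ∀ i → Linked _~_ (centre ∷ arm i)
      long : ∀ i → t ≤ length (arm i)
      distinct-arms : Distinct (centre ∷ arm fz ++ arm (fs fz) ++ arm (fs (fs fz)))
    support : List V
    support = centre ∷ arm fz ++ arm (fs fz) ++ arm (fs (fs fz))

    private
      arms! = Distinct-++ʳ [ centre ] distinct-arms

    place : SPos t → V
    place ctr = centre
    place (leg i s) = nth centre (arm i) (toℕ s)

    inArm : ∀ i (s : Fin t) → toℕ s < length (arm i)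
    inArm i s = ≤-trans (Fin.toℕ<n s) (long i)

    place∈ : ∀ a → place a ∈ support
    place∈ ctr = here refl
    place∈ (leg i s) = there (arm⊆ arm i (nth-∈ centre (arm i) (inArm i s)))

    place-injective : ∀ a b → place a ≡ place b → a ≡ b
    place-injective ctr ctr e = refl
    place-injective ctr (leg i s) e = ⊥-elim (Distinct-head distinct-arms (subst (_∈ _) (sym e) (arm⊆ arm i (nth-∈ centre (arm i) (inArm i s)))))
    place-injective (leg i s) ctr e = ⊥-elim (Distinct-head distinct-arms (subst (_∈ _) e (arm⊆ arm i (nth-∈ centre (arm i) (inArm i s)))))
    place-injective (leg i s) (leg j s') e with arms-disjoint arm arms! i j (nth-∈ centre (arm i) (inArm i s)) (subst (_∈ arm j) (sym e) (nth-∈ centre (arm j) (inArm j s')))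
    ... | refl = cong (leg i) (Fin.toℕ-injective (nth-injective centre (arm i) (arm-distinct arm arms! i) (inArm i s) (inArm i s') e))

    place-edge : ∀ {a b} → Down a b → place a ~ place b
    place-edge (first {i} {s} e) rewrite e =
      nth-linked centre (centre ∷ arm i) (linked i) (s≤s (≤-trans (s≤s z≤n) (inArm i s)))
    place-edge (next {i} {s} {s'} e) = subst (λ k → nth centre (arm i) (toℕ s) ~ nth centre (arm i) k) e
      (nth-linked centre (arm i) (Linked.tail (linked i)) (subst (_< length (arm i)) (sym e) (inArm i s')))

  fromTripods : (F : Fin t → Tripod) → (∀ k k' {v} → v ∈ Tripod.support (F k) → v ∈ Tripod.support (F k') → k ≡ k') → Emb
  fromTripods F disj = record { φ = f ; injective = λ {p} {q} → inj p q ; edge = λ k d → Tripod.place-edge (F k) d }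
    where
      f : Pos t → V
      f (k , a) = Tripod.place (F k) a
      inj : ∀ p q → f p ≡ f q → p ≡ q
      inj (k , a) (k' , b) e with disj k k' (Tripod.place∈ (F k) a) (subst (_∈ Tripod.support (F k')) (sym e) (Tripod.place∈ (F k') b))
      ... | refl = cong (k ,_) (Tripod.place-injective (F k) a b e)

  -- Prescribed positions can occupy `size` vertices of a side, and `size` more must stay free
  -- because position `p` takes the free vertex with index `encode p`; hence the factor 2. The
  -- vertex `d` is the default of `nth`.
  module Fill (d : V) (A : Bool → List V) (A! : ∀ g → Distinct (A g))
    (cross : ∀ {a b} → a ∈ A false → b ∈ A true → a ~ b) (large : ∀ g → size + size ≤ length (A g)) where

    -- The exception for `y` itself admits members of the side, as needed in a clique.
    CompleteTo : V → Bool → Set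
    CompleteTo y g = ∀ {a} → a ∈ A g → a ≢ y → y ~ a

    Fits : Maybe V → Bool → Maybe V → Bool → Set
    Fits (just x) _ (just y) _ = x ~ y
    Fits (just x) _ nothing h = CompleteTo x h
    Fits nothing g (just y) _ = CompleteTo y g
    Fits nothing g nothing h = g ≢ h

    module _ (ψ : Pos t → Maybe V) (γ : Pos t → Bool)
      (ψ-injective : ∀ {p q x} → ψ p ≡ just x → ψ q ≡ just x → p ≡ q)
      (fits : ∀ k {a b} → Down a b → Fits (ψ (k , a)) (γ (k , a)) (ψ (k , b)) (γ (k , b))) where
      private
        placed : List V
        placed = mapMaybe (λ a → ψ (decode a)) (allFin size)

        ∈-mapMaybe : ∀ {B : Set} {f : B → Maybe V} {b x} bs → b ∈ bs → f b ≡ just x → x ∈ mapMaybe f bs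
        ∈-mapMaybe (b ∷ bs) (here refl) e rewrite e = here refl
        ∈-mapMaybe {f = f} (c ∷ bs) (there m) e with f c
        ... | just _ = there (∈-mapMaybe bs m e)
        ... | nothing = ∈-mapMaybe bs m e

        placed∈ : ∀ {p x} → ψ p ≡ just x → x ∈ placed
        placed∈ {p} e = ∈-mapMaybe (allFin size) (∈-allFin (encode p)) (trans (cong ψ (decode-encode p)) e)

        free : Bool → List V
        free g = without placed (A g)

        free-long : ∀ g → size ≤ length (free g)
        free-long g = +-cancelˡ-≤ size _ _ (≤-trans (large g) (≤-trans (length-without placed (A g) (A! g))
          (+-monoˡ-≤ _ (≤-trans (length-mapMaybe _ (allFin size)) (≤-reflexive (length-tabulate (λ i → i)))))))

        free< : ∀ g p → toℕ (encode p) < length (free g)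
        free< g p = ≤-trans (Fin.toℕ<n (encode p)) (free-long g)

        val : Maybe V → Bool → ℕ → V
        val (just x) g k = x
        val nothing g k = nth d (free g) k

        f : Pos t → V
        f p = val (ψ p) (γ p) (toℕ (encode p))

        free∈ : ∀ {g v} → v ∈ free g → v ∈ A g × v ∉ placed
        free∈ {g} m = ∈-filter⁻ (λ v → ¬? (v ∈? placed)) {xs = A g} m

        A-disjoint : ∀ {g h v} → v ∈ A g → v ∈ A h → g ≡ h
        A-disjoint {false} {false} _ _ = refl
        A-disjoint {true} {true} _ _ = refl
        A-disjoint {false} {true} m m' = ⊥-elim (~⇒≢ (cross m m') refl)
        A-disjoint {true} {false} m m' = ⊥-elim (~⇒≢ (cross m' m) refl)

        free-injective : ∀ g h {i j} → i < length (free g) → j < length (free h) → nth d (free g) i ≡ nth d (free h) j → i ≡ j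
        free-injective g h i< j< e with A-disjoint {g} {h} (proj₁ (free∈ {g} (nth-∈ d (free g) i<))) (subst (_∈ A h) (sym e) (proj₁ (free∈ {h} (nth-∈ d (free h) j<))))
        ... | refl = nth-injective d (free g) (Distinct-filter _ (A! g)) i< j< e

        inj : ∀ p q → f p ≡ f q → p ≡ q
        inj p q e with ψ p in ep | ψ q in eq
        ... | just x | just y = ψ-injective ep (trans eq (cong just (sym e)))
        ... | just x | nothing = ⊥-elim (proj₂ (free∈ {γ q} (nth-∈ d (free (γ q)) (free< (γ q) q))) (subst (_∈ placed) e (placed∈ ep)))
        ... | nothing | just y = ⊥-elim (proj₂ (free∈ {γ p} (nth-∈ d (free (γ p)) (free< (γ p) p))) (subst (_∈ placed) (sym e) (placed∈ eq)))
        ... | nothing | nothing = encode-injective (Fin.toℕ-injective (free-injective (γ p) (γ q) (free< (γ p) p) (free< (γ q) q) e))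

        edges : ∀ {mx g my h i j} → Fits mx g my h → i < length (free g) → j < length (free h) →
          (∀ {x} → mx ≡ just x → x ∈ placed) → (∀ {x} → my ≡ just x → x ∈ placed) → val mx g i ~ val my h j
        edges {just x} {g} {just y} F _ _ _ _ = F
        edges {just x} {g} {nothing} {h} F i< j< px _ =
          F (proj₁ (free∈ {h} (nth-∈ d (free h) j<))) (λ e → proj₂ (free∈ {h} (nth-∈ d (free h) j<)) (subst (_∈ placed) (sym e) (px refl)))
        edges {nothing} {g} {just y} {h} F i< j< _ py =
          ~-sym (F (proj₁ (free∈ {g} (nth-∈ d (free g) i<))) (λ e → proj₂ (free∈ {g} (nth-∈ d (free g) i<)) (subst (_∈ placed) (sym e) (py refl))))
        edges {nothing} {g} {nothing} {h} F i< j< _ _ = both g h F (proj₁ (free∈ {g} (nth-∈ d (free g) i<))) (proj₁ (free∈ {h} (nth-∈ d (free h) j<)))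
          where
            both : ∀ g h → g ≢ h → ∀ {a b} → a ∈ A g → b ∈ A h → a ~ b
            both false false ne _ _ = ⊥-elim (ne refl)
            both true true ne _ _ = ⊥-elim (ne refl)
            both false true _ m m' = cross m m'
            both true false _ m m' = ~-sym (cross m' m)

      fill : Σ Emb λ e → ∀ {p x} → ψ p ≡ just x → φ e p ≡ x
      fill = record { φ = f ; injective = λ {p} {q} → inj p q
                    ; edge = λ k {a} {b} D → edges {ψ (k , a)} (fits k D) (free< _ (k , a)) (free< _ (k , b)) placed∈ placed∈ }
           , λ {p} e → cong (λ m → val m (γ p) (toℕ (encode p))) e

-- Bicliques from forced chords

module _ {A : Set} where
  split-++ : ∀ i {j} (xs : List A) → length xs ≡ i + j → ∃[ ys ] ∃[ zs ] (xs ≡ ys ++ zs × length ys ≡ i × length zs ≡ j)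
  split-++ zero xs e = [] , xs , refl , refl , e
  split-++ (suc i) (x ∷ xs) e with split-++ i xs (suc-injective e)
  ... | ys , zs , e₁ , e₂ , e₃ = x ∷ ys , zs , cong (x ∷_) e₁ , cong suc e₂ , e₃

  nth-++ʳ : ∀ d (xs : List A) {ys} k → nth d (xs ++ ys) (length xs + k) ≡ nth d ys k
  nth-++ʳ d [] k = refl
  nth-++ʳ d (x ∷ xs) k = nth-++ʳ d xs k

  -- Treats together the cases that `a` is the centre (`P` empty) and that it lies on the leg; the
  -- head stays `c` in both.
  regrow : ∀ {c a} {X S : List A} P → c ∷ X ≡ P ++ a ∷ S → ∀ S' → ∃[ X' ] c ∷ X' ≡ P ++ a ∷ S'
  regrow [] refl S' = S' , refl
  regrow (p ∷ P) refl S' = P ++ _ ∷ S' , refl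

  carve : ∀ d i j (xs : List A) → i + suc j < length xs →
    ∃[ P ] ∃[ M ] ∃[ R ] (xs ≡ P ++ nth d xs i ∷ M ++ nth d xs (i + suc j) ∷ R × length P ≡ i × length M ≡ j × length xs ≡ i + suc j + suc (length R))
  carve d i j xs lt with split-at d xs i (≤-trans (s≤s (m≤m+n i (suc j))) lt)
  ... | P , S , eq , lP , lS with split-at d S j (+-cancelˡ-< (suc i) j _ (≤-trans (s≤s (≤-reflexive (sym (+-suc i j)))) (≤-trans lt (≤-reflexive lS))))
  ... | M , R , eq' , lM , lR = P , M , R , trans eq (cong (λ s → P ++ nth d xs i ∷ s) (trans eq' (cong (λ y → M ++ y ∷ R) same))) , lP , lM
      , trans lS (trans (cong (suc i +_) lR) (arith i j (length R)))
    where
      arith : ∀ i j r → suc i + (suc j + r) ≡ i + suc j + suc r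
      arith = solve-∀
      same : nth d S j ≡ nth d xs (i + suc j)
      same = trans (sym (nth-++ʳ d P (suc j))) (cong₂ (nth d) (sym eq) (cong (_+ suc j) lP))

  length-split : ∀ (P : List A) {a} (M : List A) {b R} → length (P ++ a ∷ M ++ b ∷ R) ≡ length P + suc (length M + suc (length R))
  length-split P M = trans (length-++ P) (cong (λ k → length P + suc k) (length-++ M))

module Bicliques (G : Graph) (simple : IsSimple G) where
  open Walks G simple

  record Biclique (N : ℕ) : Set where
    field
      left right : List V
      left! : Distinct left
      right! : Distinct right
      length-left : length left ≡ N
      length-right : length right ≡ N
      cross : ∀ {a b} → a ∈ left → b ∈ right → a ~ b

  biclique : ∀ N (f g : ℕ → V) → (∀ {i j} → i < N → j < N → f i ≡ f j → i ≡ j) → (∀ {i j} → i < N → j < N → g i ≡ g j → i ≡ j) →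
    (∀ {i j} → i < N → j < N → f i ~ g j) → Biclique N
  biclique N f g f! g! cr = record
    { left = applyUpTo f N ; right = applyUpTo g N ; left! = Distinct-applyUpTo f N f! ; right! = Distinct-applyUpTo g N g!
    ; length-left = length-applyUpTo f N ; length-right = length-applyUpTo g N
    ; cross = λ m m' → let (i , i< , e) = ∈-applyUpTo⁻ f m ; (j , j< , e') = ∈-applyUpTo⁻ g m' in subst₂ _~_ (sym e) (sym e') (cr i< j<) }

  -- Rerouting spiders along forced chords

  module Rerouting (Res : List V) where

    -- The centre has depth 0, so a and b have depths q and q + 1 + e.
    LegChord : ℕ → ℕ → ℕ → Set
    LegChord q e L = ∀ {c X Y Z} → IsSpider Res c X Y Z → L ≤ length X → L ≤ length Y → L ≤ length Z →
      ∀ P {a} M {b R} → c ∷ X ≡ P ++ a ∷ M ++ b ∷ R → length P ≡ q → length M ≡ e → a ~ b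

    -- Here a and b have depths p + 1 and q + 1.
    CrossChord : ℕ → ℕ → ℕ → Set
    CrossChord p q L = ∀ {c X Y Z} → IsSpider Res c X Y Z → L ≤ length X → L ≤ length Y → L ≤ length Z →
      ∀ P {a R} Q {b S} → X ≡ P ++ a ∷ R → Y ≡ Q ++ b ∷ S → length P ≡ p → length Q ≡ q → a ~ b

    cnt-legs : ∀ v c X Y Z → cnt v (c ∷ X ++ Y ++ Z ++ Res) ≡ cnt v (c ∷ X) + (cnt v Y + (cnt v Z + cnt v Res))
    cnt-legs v c X Y Z = trans (cnt-++ v (c ∷ X) _) (cong (cnt v (c ∷ X) +_) (trans (cnt-++ v Y _) (cong (cnt v Y +_) (cnt-++ v Z Res))))

    cnt-split : ∀ v P (a : V) M b R → cnt v (P ++ a ∷ M ++ b ∷ R) ≡ cnt v P + (δ v a + (cnt v M + (δ v b + cnt v R)))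
    cnt-split v P a M b R = trans (cnt-++ v P _) (cong (λ k → cnt v P + (δ v a + k)) (cnt-++ v M _))

    -- Leaving out `M` produces another spider disjoint from `Res`, to which a forced chord applies
    -- once more.
    shortcut : ∀ {c X Y Z} → IsSpider Res c X Y Z → ∀ P {a} M {m R} → c ∷ X ≡ P ++ a ∷ M ++ m ∷ R → a ~ m →
      ∃[ X' ] (c ∷ X' ≡ P ++ a ∷ m ∷ R × IsSpider Res c X' Y Z)
    shortcut {c} {X} {Y} {Z} S P {a} M {m} {R} e a~m with regrow P e (m ∷ R)
    ... | X' , e' = X' , e' , spider
        (subst (Linked _~_) (sym e') (Linked-glue P (Linked-left P lX) (a~m ∷ Linked-++ʳ (a ∷ M) (Linked-++ʳ P lX))))
        (legY S) (legZ S) (Distinct-mono le (unique S))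
      where
        lX = subst (Linked _~_) e (legX S)
        le : ∀ v → cnt v (c ∷ X' ++ Y ++ Z ++ Res) ≤ cnt v (c ∷ X ++ Y ++ Z ++ Res)
        le v = subst₂ _≤_ (sym (cnt-legs v c X' Y Z)) (sym (cnt-legs v c X Y Z)) (+-monoˡ-≤ _
          (subst₂ (λ xs ys → cnt v xs ≤ cnt v ys) (sym e') (sym e)
            (subst₂ _≤_ (sym (cnt-++ v P (a ∷ m ∷ R))) (sym (cnt-split v P a M m R))
              (+-monoʳ-≤ (cnt v P) (+-monoʳ-≤ (δ v a) (m≤n+m _ (cnt v M)))))))

    -- The segment M between a and b is skipped in steps of e + 1.
    stretch : ∀ {q e L} → LegChord q (suc e) L → ∀ k {c X Y Z} → IsSpider Res c X Y Z → L ≤ length Y → L ≤ length Z →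
      ∀ P {a} M {b R} → c ∷ X ≡ P ++ a ∷ M ++ b ∷ R → length P ≡ q → length M ≡ k * suc e → L ≤ length R → a ~ b
    stretch chord zero S LY LZ P [] eq lP lM LR = Linked-middle P (subst (Linked _~_) eq (legX S))
    stretch {q} {e} {L} chord (suc k) {c} {X} S LY LZ P {a} M {b} {R} eq lP lM LR
      with split-++ (k * suc e) M (trans lM (+-comm (suc e) (k * suc e)))
    ... | M₁ , m ∷ M₂ , refl , lM₁ , lM₂ = via (shortcut S P M₁ eq' a~m)
      where
        eq' : c ∷ X ≡ P ++ a ∷ M₁ ++ m ∷ M₂ ++ b ∷ R
        eq' = trans eq (cong (λ xs → P ++ a ∷ xs) (++-assoc M₁ (m ∷ M₂) (b ∷ R)))
        a~m : a ~ m
        a~m = stretch chord k S LY LZ P M₁ eq' lP lM₁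
          (≤-trans LR (≤-trans (n≤1+n _) (≤-trans (m≤n+m _ (length M₂)) (≤-reflexive (sym (length-++ M₂))))))
        via : ∃[ X' ] (c ∷ X' ≡ P ++ a ∷ m ∷ M₂ ++ b ∷ R × IsSpider Res c X' _ _) → a ~ b
        -- Now `m` follows `a` directly, so exactly e + 1 vertices separate `a` from `b`, as in the
        -- given chord.
        via (X' , e' , S') = chord S' long LY LZ P (m ∷ M₂) e' lP lM₂
          where
            long : L ≤ length X'
            long = ≤-pred (≤-trans (s≤s LR) (≤-trans (m≤n+m (suc (length R)) (length P + suc (length (m ∷ M₂))))
              (≤-reflexive (trans (+-assoc (length P) _ _) (trans (sym (length-split P (m ∷ M₂))) (sym (cong length e')))))))

    -- Besides the two directions along the leg, the chord opens a third way out of `b`: over `a`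
    -- back to the old centre and out along `Y`. The leg `Z` is given up.
    recentre : ∀ {c X Y Z} → IsSpider Res c X Y Z → ∀ P {a} M {b R} → c ∷ X ≡ P ++ a ∷ M ++ b ∷ R → a ~ b →
      IsSpider Res b R (reverse M) (a ∷ reverse P ++ Y)
    recentre {c} {X} {Y} {Z} S P {a} M {b} {R} e a~b = spider
        (Linked-++ʳ (a ∷ M) (Linked-++ʳ P lX))
        (subst (Linked _~_) (reverse-++-∷ M b) (Linked-reverse ~-sym (M ++ [ b ]) (Linked-left M (Linked-++ʳ [ a ] (Linked-++ʳ P lX)))))
        (~-sym a~b ∷ back P e)
        (Distinct-mono le (unique S))
      where
        lX = subst (Linked _~_) e (legX S)
        back : ∀ P → c ∷ X ≡ P ++ a ∷ M ++ b ∷ R → Linked _~_ (a ∷ reverse P ++ Y)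
        back [] refl = legY S
        back (p ∷ P) e@refl = subst (λ xs → Linked _~_ (a ∷ xs))
          (sym (trans (cong (_++ Y) (unfold-reverse p P)) (++-assoc (reverse P) [ p ] Y)))
          (Linked-glue (a ∷ reverse P)
            (subst (Linked _~_) (trans (reverse-++-∷ (p ∷ P) a) (cong (a ∷_) (unfold-reverse p P)))
              (Linked-reverse ~-sym (p ∷ P ++ [ a ]) (Linked-left (p ∷ P) (legX S))))
            (legY S))
        arith : ∀ b r m a p y z x → b + (r + (m + ((a + (p + y)) + x))) + z ≡ (p + (a + (m + (b + r)))) + (y + (z + x))
        arith = solve-∀
        le : ∀ v → cnt v (b ∷ R ++ reverse M ++ (a ∷ reverse P ++ Y) ++ Res) ≤ cnt v (c ∷ X ++ Y ++ Z ++ Res)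
        le v = ≤-trans (m≤m+n _ (cnt v Z)) (≤-reflexive (trans (cong (_+ cnt v Z) eq₁)
          (trans (arith (δ v b) (cnt v R) (cnt v M) (δ v a) (cnt v P) (cnt v Y) (cnt v Z) (cnt v Res))
            (trans (cong (_+ (cnt v Y + (cnt v Z + cnt v Res))) (trans (sym (cnt-split v P a M b R)) (cong (cnt v) (sym e)))) (sym (cnt-legs v c X Y Z))))))
          where
            eq₁ : cnt v (b ∷ R ++ reverse M ++ (a ∷ reverse P ++ Y) ++ Res) ≡ δ v b + (cnt v R + (cnt v M + ((δ v a + (cnt v P + cnt v Y)) + cnt v Res)))
            eq₁ = trans (cnt-spider v b R (reverse M) (a ∷ reverse P ++ Y) Res)
              (cong (λ k → δ v b + (cnt v R + k)) (cong₂ _+_ (cnt-reverse v M)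
                (cong (λ k → (δ v a + k) + cnt v Res) (trans (cnt-++ v (reverse P) Y) (cong (_+ cnt v Y) (cnt-reverse v P))))))

    -- The new centre b can be any late vertex of one residue class modulo e + 1 on the leg, so
    -- stretching from it relates every such class member a' to every later one b' of the next.
    half-graph : ∀ {q e L} → LegChord q (suc e) L → ∀ {c X Y Z} → IsSpider Res c X Y Z → L ≤ length Y → L ≤ length Z →
      ∀ k' k → L ≤ k' → ∀ P {a} M {b R} → c ∷ X ≡ P ++ a ∷ M ++ b ∷ R → length P ≡ q → length M ≡ k' * suc e →
      ∀ Q {a'} M' {b' R'} → b ∷ R ≡ Q ++ a' ∷ M' ++ b' ∷ R' → length Q ≡ q → length M' ≡ k * suc e → L ≤ length R' → a' ~ b'
    half-graph {q} {e} {L} chord {c} {X} {Y} S LY LZ k' k Lk' P {a} M {b} {R} eq lP lM Q {a'} M' {b'} {R'} eq' lQ lM' LR' =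
      stretch chord k (recentre S P M eq a~b)
        -- The inward leg at `b` is the reversed segment `M`; its length is the reason for the
        -- condition on `k'`.
        (≤-trans Lk' (≤-trans (m≤m*n k' (suc e)) (≤-reflexive (trans (sym lM) (sym (length-reverse M))))))
        (≤-trans LY (≤-trans (m≤n+m _ (suc (length (reverse P)))) (≤-reflexive (sym (length-++ (a ∷ reverse P))))))
        Q M' eq' lQ lM' LR'
      where
        LR : L ≤ length R
        LR = ≤-pred (≤-trans (s≤s LR') (≤-trans (m≤n+m _ (length Q + suc (length M')))
          (≤-reflexive (trans (+-assoc (length Q) _ _) (trans (sym (length-split Q M')) (cong length (sym eq')))))))
        a~b : a ~ b
        a~b = stretch chord k' S LY LZ P M eq lP lM LR

    -- Taking the first N members of one class against N later ones of the other leaves only pairs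
    -- in the right order, so the half graph contains all their edges. The index `i` selects the new
    -- centre at depth `s (L + i)`, and `α i` lies `q` beyond it. The offset L inside `s` keeps the
    -- inward leg long, the final L the outward one.
    legChord⇒biclique : ∀ {q e L} → LegChord q (suc e) L → ∀ N {c X Y Z} → IsSpider Res c X Y Z → L ≤ length Y → L ≤ length Z →
      q + suc (q + suc ((L + N + N) * suc e)) + L ≤ length X → Biclique N
    legChord⇒biclique {q} {e} {L} chord N {c} {X} {Y} {Z} S LY LZ big =
      biclique N (λ i → x (α i)) (λ j → x (β j))
        (λ i< j< E → α-injective (nth-injective c W W! (α< i<) (α< j<) E))
        (λ i< j< E → β-injective (nth-injective c W W! (β< i<) (β< j<) E))
        adjacent
      where
        W = c ∷ X
        x = nth c W
        W! : Distinct W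
        W! = Distinct-++ˡ W (unique S)
        s = λ k → q + suc (k * suc e)
        α β : ℕ → ℕ
        α i = s (L + i) + q
        β j = q + suc (s (L + N + j))
        s-injective : ∀ {i j} → s i ≡ s j → i ≡ j
        s-injective {i} {j} E = *-cancelʳ-≡ i j (suc e) (suc-injective (+-cancelˡ-≡ q _ _ E))
        α-injective : ∀ {i j} → α i ≡ α j → i ≡ j
        α-injective E = +-cancelˡ-≡ L _ _ (s-injective (+-cancelʳ-≡ q _ _ E))
        β-injective : ∀ {i j} → β i ≡ β j → i ≡ j
        β-injective E = +-cancelˡ-≡ (L + N) _ _ (s-injective (suc-injective (+-cancelˡ-≡ q _ _ E)))
        s-mono : ∀ {i j} → i ≤ j → s i ≤ s j
        s-mono le = +-monoʳ-≤ q (s≤s (*-monoˡ-≤ (suc e) le))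
        β+L< : ∀ {j} → j < N → β j + L < length W
        β+L< j< = s≤s (≤-trans (+-monoˡ-≤ L (+-monoʳ-≤ q (s≤s (s-mono (+-monoʳ-≤ (L + N) (<⇒≤ j<)))))) big)
        β< : ∀ {j} → j < N → β j < length W
        β< j< = ≤-trans (s≤s (m≤m+n _ L)) (β+L< j<)
        α< : ∀ {i} → i < N → α i < length W
        α< {i} i< = ≤-trans (s≤s (≤-trans (≤-reflexive (+-comm (s (L + i)) q)) (+-monoʳ-≤ q
          (≤-trans (s-mono (+-mono-≤ (m≤m+n L N) (≤-refl {i}))) (n≤1+n _))))) (β< i<)
        adjacent : ∀ {i j} → i < N → j < N → x (α i) ~ x (β j)
        adjacent {i} {j} i< j< = subst₂ _~_ (shift q) (trans (shift (s k)) (cong x joined))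
            (half-graph chord S LY LZ k' k (m≤m+n L i) P M eq lP lM Q M' eq' lQ lM' long)
          where
            k' = L + i
            -- Chosen so that the far end `s k' + s k` does not depend on `i`; the subtraction is
            -- exact because i < N.
            k = N + j ∸ i
            arith₁ : ∀ q e a b → (q + suc (a * suc e)) + (q + suc (b * suc e)) ≡ q + suc (q + suc ((a + b) * suc e))
            arith₁ = solve-∀
            joined : s k' + s k ≡ β j
            joined = trans (arith₁ q e k' k) (cong (λ z → q + suc (s z))
              (trans (+-assoc L i k) (trans (cong (L +_) (m+[n∸m]≡n (≤-trans (<⇒≤ i<) (m≤m+n N j)))) (sym (+-assoc L N j)))))
            within : s k' + s k + L < length W
            within = subst (λ z → z + L < length W) (sym joined) (β+L< j<)
            C₁ = carve c q (k' * suc e) W (≤-trans (s≤s (≤-trans (m≤m+n (s k') (s k)) (m≤m+n _ L))) within)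
            P = proj₁ C₁
            M = proj₁ (proj₂ C₁)
            R = proj₁ (proj₂ (proj₂ C₁))
            eq = proj₁ (proj₂ (proj₂ (proj₂ C₁)))
            lP = proj₁ (proj₂ (proj₂ (proj₂ (proj₂ C₁))))
            lM = proj₁ (proj₂ (proj₂ (proj₂ (proj₂ (proj₂ C₁)))))
            lR = proj₂ (proj₂ (proj₂ (proj₂ (proj₂ (proj₂ C₁)))))
            b = x (s k')
            C₂ = carve c q (k * suc e) (b ∷ R) (+-cancelˡ-< (s k') _ _ (≤-trans (s≤s (m≤m+n _ L)) (subst (s k' + s k + L <_) lR within)))
            Q = proj₁ C₂
            M' = proj₁ (proj₂ C₂)
            R' = proj₁ (proj₂ (proj₂ C₂))
            eq' = proj₁ (proj₂ (proj₂ (proj₂ C₂)))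
            lQ = proj₁ (proj₂ (proj₂ (proj₂ (proj₂ C₂))))
            lM' = proj₁ (proj₂ (proj₂ (proj₂ (proj₂ (proj₂ C₂)))))
            lR' = proj₂ (proj₂ (proj₂ (proj₂ (proj₂ (proj₂ C₂)))))
            long : L ≤ length R'
            long = ≤-pred (+-cancelˡ-≤ (s k' + s k) _ _ (≤-trans (≤-reflexive (+-suc _ L)) (≤-trans within
              (≤-reflexive (trans lR (trans (cong (s k' +_) lR') (sym (+-assoc (s k') (s k) _))))))))
            shift : ∀ z → nth c (b ∷ R) z ≡ x (s k' + z)
            shift z = trans (sym (nth-++ʳ c (P ++ x q ∷ M) z)) (cong₂ (nth c)
              (trans (++-assoc P (x q ∷ M) (b ∷ R)) (sym eq))
              (cong (_+ z) (trans (length-++ P) (cong₂ (λ p m → p + suc m) lP lM))))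

    -- Recentring at the vertex u of depth p + 1 puts c at depth p + 1 on the leg running back
    -- through c, and b at depth q + 1 on the leg running outwards.
    crossChord⇒legChord : ∀ {p q L} → CrossChord p q L → LegChord 0 (p + suc q) (p + suc q + L)
    crossChord⇒legChord {p} {q} {L} chord {c} {X} {Y} {Z} S LX LY LZ [] {a} M {b} {R} refl lP lM
      with split-++ p M lM | split-at c Y q (≤-trans (≤-trans (m≤n+m (suc q) p) (m≤m+n _ L)) LY)
    ... | M₁ , u ∷ M₂ , refl , lM₁ , lM₂ | Y₁ , Y₂ , eqY , lY₁ , lY₂ =
      chord crossed long-back long-X long-Y (reverse M₁) M₂ refl refl (trans (length-reverse M₁) lM₁) (suc-injective lM₂)
      where
        w = nth c Y q
        L≤ : L ≤ p + suc q + L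
        L≤ = m≤n+m L (p + suc q)
        eqX : (M₁ ++ u ∷ M₂) ++ b ∷ R ≡ M₁ ++ u ∷ M₂ ++ b ∷ R
        eqX = ++-assoc M₁ (u ∷ M₂) (b ∷ R)
        -- The forced chord is used twice: here it supplies the first edge of the new leg through
        -- `w`, and then it is applied to the spider centred at `u`.
        u~w : u ~ w
        u~w = chord S (≤-trans L≤ LX) (≤-trans L≤ LY) (≤-trans L≤ LZ) M₁ Y₁ eqX eqY lM₁ lY₁
        lX : Linked _~_ ((c ∷ M₁) ++ u ∷ M₂ ++ b ∷ R)
        lX = subst (λ xs → Linked _~_ (c ∷ xs)) eqX (legX S)
        lY : Linked _~_ ((c ∷ Y₁) ++ w ∷ Y₂)
        lY = subst (λ xs → Linked _~_ (c ∷ xs)) eqY (legY S)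
        turn : reverse ((c ∷ M₁) ++ [ u ]) ≡ (u ∷ reverse M₁) ++ [ c ]
        turn = trans (reverse-++-∷ (c ∷ M₁) u) (cong (u ∷_) (unfold-reverse c M₁))
        long-back : L ≤ length (reverse M₁ ++ c ∷ Z)
        long-back = ≤-trans (≤-trans L≤ LZ) (≤-trans (n≤1+n _) (≤-trans (m≤n+m _ (length (reverse M₁))) (≤-reflexive (sym (length-++ (reverse M₁))))))
        long-X : L ≤ length (M₂ ++ b ∷ R)
        long-X = ≤-trans (+-cancelˡ-≤ (p + suc q) _ _ (≤-trans LX (≤-reflexive (trans (length-++ (M₁ ++ u ∷ M₂)) (cong (_+ suc (length R)) lM)))))
          (≤-trans (m≤n+m _ (length M₂)) (≤-reflexive (sym (length-++ M₂))))
        long-Y : L ≤ length (w ∷ Y₂)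
        long-Y = +-cancelˡ-≤ (suc q) _ _ (≤-trans (+-monoˡ-≤ L (m≤n+m (suc q) p)) (≤-trans (≤-trans LY (≤-reflexive lY₂)) (+-monoʳ-≤ (suc q) (n≤1+n _))))
        arith : ∀ m₁ u m₂ b r y₁ w y₂ z c x → y₁ + (u + ((m₁ + (c + z)) + ((m₂ + (b + r)) + ((w + y₂) + x)))) ≡ c + ((m₁ + (u + (m₂ + (b + r)))) + ((y₁ + (w + y₂)) + (z + x)))
        arith = solve-∀
        le : ∀ v → cnt v (u ∷ (reverse M₁ ++ c ∷ Z) ++ (M₂ ++ b ∷ R) ++ (w ∷ Y₂) ++ Res) ≤ cnt v (c ∷ ((M₁ ++ u ∷ M₂) ++ b ∷ R) ++ Y ++ Z ++ Res)
        le v = ≤-trans (m≤n+m _ (cnt v Y₁)) (≤-reflexive (trans (cong (cnt v Y₁ +_) eq₁) (trans (arith (cnt v M₁) (δ v u) (cnt v M₂) (δ v b) (cnt v R) (cnt v Y₁) (δ v w) (cnt v Y₂) (cnt v Z) (δ v c) (cnt v Res)) (sym eq₂))))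
          where
            eq₁ : cnt v (u ∷ (reverse M₁ ++ c ∷ Z) ++ (M₂ ++ b ∷ R) ++ (w ∷ Y₂) ++ Res)
              ≡ δ v u + ((cnt v M₁ + (δ v c + cnt v Z)) + ((cnt v M₂ + (δ v b + cnt v R)) + ((δ v w + cnt v Y₂) + cnt v Res)))
            eq₁ = trans (cnt-spider v u (reverse M₁ ++ c ∷ Z) (M₂ ++ b ∷ R) (w ∷ Y₂) Res)
              (cong (δ v u +_) (cong₂ _+_ (trans (cnt-++ v (reverse M₁) (c ∷ Z)) (cong (_+ (δ v c + cnt v Z)) (cnt-reverse v M₁)))
                (cong (_+ ((δ v w + cnt v Y₂) + cnt v Res)) (cnt-++ v M₂ (b ∷ R)))))
            eq₂ : cnt v (c ∷ ((M₁ ++ u ∷ M₂) ++ b ∷ R) ++ Y ++ Z ++ Res)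
              ≡ δ v c + ((cnt v M₁ + (δ v u + (cnt v M₂ + (δ v b + cnt v R)))) + ((cnt v Y₁ + (δ v w + cnt v Y₂)) + (cnt v Z + cnt v Res)))
            eq₂ = trans (cnt-spider v c ((M₁ ++ u ∷ M₂) ++ b ∷ R) Y Z Res)
              (cong (δ v c +_) (cong₂ _+_ (trans (cong (cnt v) eqX) (cnt-split v M₁ u M₂ b R))
                (cong (_+ (cnt v Z + cnt v Res)) (trans (cong (cnt v) eqY) (cnt-++ v Y₁ (w ∷ Y₂))))))
        crossed : IsSpider Res u (reverse M₁ ++ c ∷ Z) (M₂ ++ b ∷ R) (w ∷ Y₂)
        crossed = spider
          (Linked-glue (u ∷ reverse M₁) (subst (Linked _~_) turn (Linked-reverse ~-sym (c ∷ M₁ ++ [ u ]) (Linked-left (c ∷ M₁) lX))) (legZ S))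
          (Linked-++ʳ (c ∷ M₁) lX)
          (u~w ∷ Linked-++ʳ (c ∷ Y₁) lY)
          (Distinct-mono le (unique S))

-- Non-adjacent positions and the chords they force

data AtDepth {t : ℕ} (i : Fin 3) : ℕ → SPos t → Set where
  centre : AtDepth i 0 ctr
  along : ∀ s → AtDepth i (suc (toℕ s)) (leg i s)

data Nonadjacent {t : ℕ} : SPos t → SPos t → Set where
  sameLeg : ∀ i {q e a b} → AtDepth i q a → AtDepth i (q + suc (suc e)) b → Nonadjacent a b
  twoLegs : ∀ {i j s s'} → i ≢ j → Nonadjacent (leg i s) (leg j s')

private
  gap : ∀ {m n} → m < n → suc m ≢ n → ∃[ e ] n ≡ m + suc (suc e)
  gap {m} {n} lt ne with m≤n⇒∃[o]m+o≡n (≤∧≢⇒< lt ne)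
  ... | e , eq = e , sym (trans (trans (+-suc m (suc e)) (cong suc (+-suc m e))) eq)

classify : ∀ {t} (a b : SPos t) → a ≢ b → ¬ (Down a b ⊎ Down b a) → Nonadjacent a b ⊎ Nonadjacent b a
classify ctr ctr ne _ = ⊥-elim (ne refl)
classify ctr (leg i s) _ na with gap {0} {suc (toℕ s)} (s≤s z≤n) (λ e → na (inj₁ (first (suc-injective (sym e)))))
... | e , eq = inj₁ (sameLeg i centre (subst (λ k → AtDepth i k (leg i s)) eq (along s)))
classify (leg i s) ctr _ na with gap {0} {suc (toℕ s)} (s≤s z≤n) (λ e → na (inj₂ (first (suc-injective (sym e)))))
... | e , eq = inj₂ (sameLeg i centre (subst (λ k → AtDepth i k (leg i s)) eq (along s)))
classify (leg i s) (leg j s') ne na with i Fin.≟ j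
... | no i≢j = inj₁ (twoLegs i≢j)
... | yes refl with <-cmp (toℕ s) (toℕ s')
... | tri≈ _ e _ = ⊥-elim (ne (cong (leg i) (Fin.toℕ-injective e)))
... | tri< lt _ _ with gap (s≤s lt) (λ e → na (inj₁ (next (suc-injective e))))
... | e , eq = inj₁ (sameLeg i (along s) (subst (λ k → AtDepth i k (leg i s')) eq (along s')))
classify (leg i s) (leg j s') ne na | yes refl | tri> _ _ lt with gap (s≤s lt) (λ e → na (inj₂ (next (suc-injective e))))
... | e , eq = inj₂ (sameLeg i (along s') (subst (λ k → AtDepth i k (leg i s)) eq (along s)))

AtDepth≤ : ∀ {t i q a} → AtDepth {t} i q a → q ≤ t
AtDepth≤ centre = z≤n
AtDepth≤ (along s) = Fin.toℕ<n s

module Homogeneous (G : Graph) (simple : IsSimple G) (t L : ℕ) (t≤L : t ≤ L) where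
  open Walks G simple
  open Embeddings G simple t
  open Family G simple L
  open Bicliques G simple

  -- The chord statements speak of the first one or two legs of a spider; permuting the legs makes
  -- them cover any legs `i` and `j` of a copy.
  assign : Fin 3 → Fin 3 → List V → List V → List V → Fin 3 → List V
  assign i j X Y Z k = if does (k Fin.≟ i) then X else if does (k Fin.≟ j) then Y else Z

  assign-all : ∀ {P : List V → Set} i j {X Y Z} → P X → P Y → P Z → ∀ k → P (assign i j X Y Z k)
  assign-all i j x y z k with does (k Fin.≟ i) | does (k Fin.≟ j)
  ... | true | _ = x
  ... | false | true = y
  ... | false | false = z

  assign-fst : ∀ i j {X Y Z} → assign i j X Y Z i ≡ X
  assign-fst i j with i Fin.≟ i
  ... | yes _ = refl
  ... | no ne = ⊥-elim (ne refl)

  assign-snd : ∀ {i j X Y Z} → i ≢ j → assign i j X Y Z j ≡ Y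
  assign-snd {i} {j} ne with j Fin.≟ i | j Fin.≟ j
  ... | yes e | _ = ⊥-elim (ne (sym e))
  ... | no _ | yes _ = refl
  ... | no _ | no ne' = ⊥-elim (ne' refl)

  cnt-assign : ∀ v {i j} X Y Z → i ≢ j →
    cnt v (assign i j X Y Z fz) + (cnt v (assign i j X Y Z (fs fz)) + cnt v (assign i j X Y Z (fs (fs fz)))) ≡ cnt v X + (cnt v Y + cnt v Z)
  cnt-assign v {i} {j} X Y Z = go i j
    where
      x = cnt v X
      y = cnt v Y
      z = cnt v Z
      p₁ : ∀ x y z → y + (x + z) ≡ x + (y + z)
      p₁ = solve-∀
      p₂ : ∀ x y z → y + (z + x) ≡ x + (y + z)
      p₂ = solve-∀
      p₃ : ∀ x y z → z + (x + y) ≡ x + (y + z)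
      p₃ = solve-∀
      p₄ : ∀ x y z → z + (y + x) ≡ x + (y + z)
      p₄ = solve-∀
      p₅ : ∀ x y z → x + (z + y) ≡ x + (y + z)
      p₅ = solve-∀
      go : ∀ i j → i ≢ j → cnt v (assign i j X Y Z fz) + (cnt v (assign i j X Y Z (fs fz)) + cnt v (assign i j X Y Z (fs (fs fz)))) ≡ x + (y + z)
      go fz fz ne = ⊥-elim (ne refl)
      go (fs fz) (fs fz) ne = ⊥-elim (ne refl)
      go (fs (fs fz)) (fs (fs fz)) ne = ⊥-elim (ne refl)
      go fz (fs fz) _ = refl
      go fz (fs (fs fz)) _ = p₅ x y z
      go (fs fz) fz _ = p₁ x y z
      go (fs fz) (fs (fs fz)) _ = p₃ x y z
      go (fs (fs fz)) fz _ = p₂ x y z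
      go (fs (fs fz)) (fs fz) _ = p₄ x y z

  module _ {Res : List V} {c : V} {X Y Z : List V} (S : IsSpider Res c X Y Z)
    (tX : t ≤ length X) (tY : t ≤ length Y) (tZ : t ≤ length Z) {i j : Fin 3} (i≢j : i ≢ j) where
    private
      arms = assign i j X Y Z
      cnt-arms : ∀ v → cnt v ((c ∷ arms fz ++ arms (fs fz) ++ arms (fs (fs fz))) ++ Res) ≡ cnt v (c ∷ X ++ Y ++ Z ++ Res)
      cnt-arms v = trans (trans (cnt-++ v (c ∷ arms fz ++ arms (fs fz) ++ arms (fs (fs fz))) Res)
        (trans (cong (λ k → (δ v c + k) + cnt v Res) (trans (cnt-++ v (arms fz) _) (trans (cong (cnt v (arms fz) +_) (cnt-++ v (arms (fs fz)) _)) (cnt-assign v X Y Z i≢j))))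
          (arith (δ v c) (cnt v X) (cnt v Y) (cnt v Z) (cnt v Res)))) (sym (cnt-spider v c X Y Z Res))
        where
          arith : ∀ c x y z r → (c + (x + (y + z))) + r ≡ c + (x + (y + (z + r)))
          arith = solve-∀
      unique' : Distinct ((c ∷ arms fz ++ arms (fs fz) ++ arms (fs (fs fz))) ++ Res)
      unique' = Distinct-mono (λ v → ≤-reflexive (cnt-arms v)) (unique S)

    toTripod : Tripod
    toTripod = record
      { centre = c ; arm = arms
      ; linked = assign-all {λ A → Linked _~_ (c ∷ A)} i j (legX S) (legY S) (legZ S)
      ; long = assign-all {λ A → t ≤ length A} i j tX tY tZ
      ; distinct-arms = Distinct-++ˡ (c ∷ arms fz ++ arms (fs fz) ++ arms (fs (fs fz))) unique' }

    toTripod-avoids : ∀ {v} → v ∈ Tripod.support toTripod → v ∉ Res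
    toTripod-avoids = Distinct-disjoint (Tripod.support toTripod) unique'

    toTripod-⊆ : ∀ {v} → v ∈ Tripod.support toTripod → v ∈ c ∷ X ++ Y ++ Z ++ Res
    toTripod-⊆ {v} m = cnt⇒∈ (c ∷ X ++ Y ++ Z ++ Res) (≤-trans (∈⇒cnt (∈-++⁺ˡ {ys = Res} m)) (≤-reflexive (cnt-arms v)))

    place-fst : ∀ {q a} → AtDepth i q a → Tripod.place toTripod a ≡ nth c (c ∷ X) q
    place-fst centre = refl
    place-fst (along s) = cong (λ A → nth c A (toℕ s)) (assign-fst i j)

    place-snd : ∀ s → Tripod.place toTripod (leg j s) ≡ nth c Y (toℕ s)
    place-snd s = cong (λ A → nth c A (toℕ s)) (assign-snd {X = X} {Z = Z} i≢j)

  fz≢1 : _≢_ {A = Fin 3} fz (fs fz)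
  fz≢1 ()

  module _ {Res : List V} (S : HasSpider L Res) where
    open HasSpider S
    private
      long : (A : List V) → length A ≡ L → t ≤ length A
      long A e = ≤-trans t≤L (≤-reflexive (sym e))

    headTripod : Tripod
    headTripod = toTripod isSpider (long X lengthX) (long Y lengthY) (long Z lengthZ) fz≢1

    headTripod-⊆ : ∀ {v} → v ∈ Tripod.support headTripod → v ∈ c ∷ X ++ Y ++ Z ++ Res
    headTripod-⊆ = toTripod-⊆ isSpider (long X lengthX) (long Y lengthY) (long Z lengthZ) fz≢1

    headTripod-avoids : ∀ {v} → v ∈ Tripod.support headTripod → v ∉ Res
    headTripod-avoids = toTripod-avoids isSpider (long X lengthX) (long Y lengthY) (long Z lengthZ) fz≢1

  -- The tripod `T₀` is the default for indices beyond the family.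
  member : Tripod → ∀ {k Res} → Spiders k Res → ℕ → Tripod
  member T₀ none _ = T₀
  member T₀ (add F S) zero = headTripod S
  member T₀ (add F S) (suc i) = member T₀ F i

  member⊆ : ∀ T₀ {k Res} (F : Spiders k Res) i → i < k → ∀ {v} → v ∈ Tripod.support (member T₀ F i) → v ∈ Res
  member⊆ T₀ (add F S) zero _ m = headTripod-⊆ S m
  member⊆ T₀ (add F S) (suc i) (s≤s i<) m = ∈-++⁺ʳ (HasSpider.c S ∷ HasSpider.X S) (∈-++⁺ʳ (HasSpider.Y S) (∈-++⁺ʳ (HasSpider.Z S) (member⊆ T₀ F i i< m)))

  member-disjoint : ∀ T₀ {k Res} (F : Spiders k Res) i j → i < k → j < k → ∀ {v} →
    v ∈ Tripod.support (member T₀ F i) → v ∈ Tripod.support (member T₀ F j) → i ≡ j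
  member-disjoint T₀ (add F S) zero zero _ _ _ _ = refl
  member-disjoint T₀ (add F S) zero (suc j) _ (s≤s j<) m m' = ⊥-elim (headTripod-avoids S m (member⊆ T₀ F j j< m'))
  member-disjoint T₀ (add F S) (suc i) zero (s≤s i<) _ m m' = ⊥-elim (headTripod-avoids S m' (member⊆ T₀ F i i< m))
  member-disjoint T₀ (add F S) (suc i) (suc j) (s≤s i<) (s≤s j<) m m' = cong suc (member-disjoint T₀ F i j i< j< m m')

  module SameCopy {Res : List V} {k : ℕ} (F : Spiders k Res) (t≤k : t ≤ k) (T₀ : Tripod) (κ : Fin t) (a b : SPos t)
    (H : ∀ e → φ e (κ , a) ~ φ e (κ , b)) where
    open Rerouting Res

    -- The other copies stay on the fixed family, so copy `κ` may be any tripod that avoids it. This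
    -- freedom is what the rerouting exploits.
    atTripod : (T : Tripod) → (∀ {v} → v ∈ Tripod.support T → v ∉ Res) → Tripod.place T a ~ Tripod.place T b
    atTripod T avoids = subst (λ T' → Tripod.place T' a ~ Tripod.place T' b) here-κ (H (fromTripods (λ k → tri (k Fin.≟ κ) k) disj))
      where
        tri : ∀ {k} → Dec (k ≡ κ) → Fin t → Tripod
        tri (yes _) k = T
        tri (no _) k = member T₀ F (toℕ k)
        here-κ : tri (κ Fin.≟ κ) κ ≡ T
        here-κ with κ Fin.≟ κ
        ... | yes _ = refl
        ... | no ne = ⊥-elim (ne refl)
        bnd : ∀ (k' : Fin t) → toℕ k' < k
        bnd k' = ≤-trans (Fin.toℕ<n k') t≤k
        disj : ∀ k k' {v} → v ∈ Tripod.support (tri (k Fin.≟ κ) k) → v ∈ Tripod.support (tri (k' Fin.≟ κ) k') → k ≡ k'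
        disj k k' m m' with k Fin.≟ κ | k' Fin.≟ κ
        ... | yes e | yes e' = trans e (sym e')
        ... | yes _ | no _ = ⊥-elim (avoids m (member⊆ T₀ F (toℕ k') (bnd k') m'))
        ... | no _ | yes _ = ⊥-elim (avoids m' (member⊆ T₀ F (toℕ k) (bnd k) m))
        ... | no _ | no _ = Fin.toℕ-injective (member-disjoint T₀ F (toℕ k) (toℕ k') (bnd k) (bnd k') m m')

    legChord : ∀ {i q e} → AtDepth i q a → AtDepth i (q + suc e) b → LegChord q e t
    legChord {i} {q} {e} da db {c} {X} S tX tY tZ P {x} M {y} {R} eq lP lM =
      subst₂ _~_ (trans (place-fst S tX tY tZ i≢j da) (trans (cong (λ W → nth c W q) eq) (nth-++ c P lP)))
                 (trans (place-fst S tX tY tZ i≢j db) (trans (cong (λ W → nth c W (q + suc e)) (trans eq (sym (++-assoc P (x ∷ M) (y ∷ R)))))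
                    (nth-++ c (P ++ x ∷ M) (trans (length-++ P) (cong₂ (λ p m → p + suc m) lP lM)))))
        (atTripod (toTripod S tX tY tZ i≢j) (toTripod-avoids S tX tY tZ i≢j))
      where
        other : Fin 3 → Fin 3
        other fz = fs fz
        other (fs _) = fz
        i≢j : i ≢ other i
        i≢j = ne i
          where
            ne : ∀ i → i ≢ other i
            ne fz ()
            ne (fs _) ()

    crossChord : ∀ {i j s s'} → i ≢ j → a ≡ leg i s → b ≡ leg j s' → CrossChord (toℕ s) (toℕ s') t
    crossChord {i} {j} {s} {s'} i≢j refl refl {c} {X} {Y} S tX tY tZ P Q eqX eqY lP lQ =
      subst₂ _~_ (trans (place-fst S tX tY tZ i≢j (along s)) (trans (cong (λ W → nth c W (toℕ s)) eqX) (nth-++ c P lP)))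
                 (trans (place-snd S tX tY tZ i≢j s') (trans (cong (λ W → nth c W (toℕ s')) eqY) (nth-++ c Q lQ)))
        (atTripod (toTripod S tX tY tZ i≢j) (toTripod-avoids S tX tY tZ i≢j))

    -- The inequality is the one of `legChord⇒biclique` in the worst case: the chord starts at depth
    -- at most t, spans at most 2t inner vertices and requires legs of length at most 3t. The last
    -- two values come from positions on different legs, whose chord first has to be moved onto a
    -- single leg.
    sameCopy⇒biclique : ∀ N → Nonadjacent a b → HasSpider L Res →
      t + suc (t + suc ((t + t + t + N + N) * (t + t))) + (t + t + t) ≤ L → Biclique N
    sameCopy⇒biclique N nonadj S big = go nonadj refl refl
      where
        open HasSpider S
        T₃ = t + t + t
        T₂ = t + t
        T₃≤L : T₃ ≤ L
        T₃≤L = ≤-trans (m≤n+m T₃ (t + suc (t + suc ((t + t + t + N + N) * (t + t))))) big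
        longY : L ≤ length Y
        longY = ≤-reflexive (sym lengthY)
        longZ : L ≤ length Z
        longZ = ≤-reflexive (sym lengthZ)
        from-chord : ∀ {q e l} → LegChord q (suc e) l → q ≤ t → suc e ≤ T₂ → l ≤ T₃ → Biclique N
        from-chord chord q≤ e≤ l≤ = legChord⇒biclique chord N isSpider (≤-trans (≤-trans l≤ T₃≤L) longY)
          (≤-trans (≤-trans l≤ T₃≤L) longZ)
          (≤-trans (+-mono-≤ (+-mono-≤ q≤ (s≤s (+-mono-≤ q≤ (s≤s (*-mono-≤ (+-monoˡ-≤ N (+-monoˡ-≤ N l≤)) e≤))))) l≤) (≤-trans big (≤-reflexive (sym lengthX))))
        t≤T₃ : t ≤ T₃
        t≤T₃ = m≤n+m t (t + t)
        go : ∀ {a' b'} → Nonadjacent a' b' → a' ≡ a → b' ≡ b → Biclique N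
        go (sameLeg i {q} {e} da db) refl refl = from-chord (legChord da db) (AtDepth≤ da)
          (≤-trans (≤-trans (n≤1+n _) (m≤n+m _ q)) (≤-trans (AtDepth≤ db) (m≤m+n t t))) t≤T₃
        go (twoLegs {i} {j} {s} {s'} i≢j) refl refl = from-chord
          (subst (λ z → LegChord 0 z (z + t)) (+-suc (toℕ s) (toℕ s')) (crossChord⇒legChord (crossChord i≢j refl refl)))
          z≤n (+-mono-≤ (Fin.toℕ<n s) (<⇒≤ (Fin.toℕ<n s'))) (+-monoˡ-≤ t (+-mono-≤ (Fin.toℕ<n s) (<⇒≤ (Fin.toℕ<n s'))))

  -- The two copies move independently: `κ` runs over the first N spiders and `κ'` over the next N,
  -- while the last t hold the remaining copies.
  differentCopies⇒biclique : ∀ N {Res} → Spiders (N + N + t) Res → Tripod → ∀ {κ κ' : Fin t} {a b} → κ ≢ κ' →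
    (∀ e → φ e (κ , a) ~ φ e (κ' , b)) → Biclique N
  differentCopies⇒biclique N {Res} F T₀ {κ} {κ'} {a} {b} κ≢κ' H =
      biclique N (λ i → Tripod.place (T i) a) (λ j → Tripod.place (T (N + j)) b)
        (λ i< j< e → same a (small i<) (small j<) e)
        (λ i< j< e → +-cancelˡ-≡ N _ _ (same b (mid i<) (mid j<) e))
        (λ {i} {j} i< j< → subst₂ (λ x y → Tripod.place (T x) a ~ Tripod.place (T y) b) (σ-κ i j) (σ-κ' i j) (H (fromTripods (λ k → T (σ i j k)) (disj i< j<))))
    where
      K = N + N + t
      T = member T₀ F
      small : ∀ {i} → i < N → i < K
      small i< = ≤-trans i< (≤-trans (m≤m+n N N) (m≤m+n (N + N) t))
      mid : ∀ {j} → j < N → N + j < K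
      mid j< = ≤-trans (+-monoʳ-< N j<) (m≤m+n (N + N) t)
      same : ∀ c {i j} → i < K → j < K → Tripod.place (T i) c ≡ Tripod.place (T j) c → i ≡ j
      same c {i} {j} i< j< e = member-disjoint T₀ F i j i< j< (Tripod.place∈ (T i) c) (subst (_∈ Tripod.support (T j)) (sym e) (Tripod.place∈ (T j) c))
      σ : ℕ → ℕ → Fin t → ℕ
      σ i j k = if does (k Fin.≟ κ) then i else if does (k Fin.≟ κ') then N + j else N + N + toℕ k
      σ-κ : ∀ i j → σ i j κ ≡ i
      σ-κ i j with κ Fin.≟ κ
      ... | yes _ = refl
      ... | no ne = ⊥-elim (ne refl)
      σ-κ' : ∀ i j → σ i j κ' ≡ N + j
      σ-κ' i j with κ' Fin.≟ κ | κ' Fin.≟ κ'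
      ... | yes e | _ = ⊥-elim (κ≢κ' (sym e))
      ... | no _ | yes _ = refl
      ... | no _ | no ne = ⊥-elim (ne refl)
      σ-injective : ∀ {i j} → i < N → j < N → ∀ k k' → σ i j k ≡ σ i j k' → k ≡ k'
      σ-injective {i} {j} i< j< k k' e with k Fin.≟ κ | k Fin.≟ κ' | k' Fin.≟ κ | k' Fin.≟ κ'
      ... | yes p | _ | yes q | _ = trans p (sym q)
      ... | yes p | _ | no _ | yes q = ⊥-elim (<⇒≢ (≤-trans i< (m≤m+n N j)) e)
      ... | yes p | _ | no _ | no _ = ⊥-elim (<⇒≢ (≤-trans i< (≤-trans (m≤m+n N N) (m≤m+n (N + N) _))) e)
      ... | no _ | yes p | yes q | _ = ⊥-elim (<⇒≢ (≤-trans i< (m≤m+n N j)) (sym e))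
      ... | no _ | no _ | yes q | _ = ⊥-elim (<⇒≢ (≤-trans i< (≤-trans (m≤m+n N N) (m≤m+n (N + N) _))) (sym e))
      ... | no _ | yes p | no _ | yes q = trans p (sym q)
      ... | no _ | yes p | no _ | no _ = ⊥-elim (<⇒≢ (≤-trans (+-monoʳ-< N j<) (m≤m+n (N + N) _)) e)
      ... | no _ | no _ | no _ | yes q = ⊥-elim (<⇒≢ (≤-trans (+-monoʳ-< N j<) (m≤m+n (N + N) _)) (sym e))
      ... | no _ | no _ | no _ | no _ = Fin.toℕ-injective (+-cancelˡ-≡ (N + N) _ _ e)
      σ< : ∀ {i j} → i < N → j < N → ∀ k → σ i j k < K
      σ< i< j< k with does (k Fin.≟ κ) | does (k Fin.≟ κ')
      ... | true | _ = small i<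
      ... | false | true = mid j<
      ... | false | false = +-monoʳ-< (N + N) (Fin.toℕ<n k)
      disj : ∀ {i j} → i < N → j < N → ∀ k k' {v} → v ∈ Tripod.support (T (σ i j k)) → v ∈ Tripod.support (T (σ i j k')) → k ≡ k'
      disj {i} {j} i< j< k k' m m' = σ-injective i< j< k k' (member-disjoint T₀ F (σ i j k) (σ i j k') (σ< i< j< k) (σ< i< j< k') m m')

-- Embeddings with prescribed vertices

par : ℕ → Bool
par zero = false
par (suc k) = not (par k)

par-double : ∀ k → par (k + k) ≡ false
par-double zero = refl
par-double (suc k) = trans (cong (λ z → not (par z)) (+-suc k k)) (trans (Bool.not-involutive _) (par-double k))

par-+ : ∀ k l m → par k ≡ par l → par (k + m) ≡ par (l + m)
par-+ k l zero e = trans (cong par (+-identityʳ k)) (trans e (cong par (sym (+-identityʳ l))))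
par-+ k l (suc m) e = trans (cong par (+-suc k m)) (trans (cong not (par-+ k l m e)) (cong par (sym (+-suc l m))))

≢not : ∀ b → b ≢ not b
≢not true ()
≢not false ()

depth : ∀ {t} → SPos t → ℕ
depth ctr = 0
depth (leg i s) = suc (toℕ s)

Down-depth : ∀ {t} {a b : SPos t} → Down a b → depth b ≡ suc (depth a)
Down-depth (first e) = cong suc e
Down-depth (next e) = cong suc (sym e)

Down-irrefl : ∀ {t} {a b : SPos t} → Down a b → a ≢ b
Down-irrefl D refl = <⇒≢ ≤-refl (Down-depth D)

monus : ℕ → ℕ → Maybe ℕ
monus zero δ = just δ
monus (suc s) zero = nothing
monus (suc s) (suc δ) = monus s δ

-- Distance past depth s along leg i, the centre having depth 0 on every leg.
past : ∀ {t} → Fin 3 → ℕ → SPos t → Maybe ℕ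
past i s ctr = monus s 0
past i s (leg j p) with j Fin.≟ i
... | yes _ = monus s (suc (toℕ p))
... | no _ = nothing

-- The start is met from outside in two ways: by `enter` from its parent or, if the start is the
-- centre, by `leave` towards another leg.
data PastStep : Maybe ℕ → Maybe ℕ → Set where
  inside : ∀ {k} → PastStep (just k) (just (suc k))
  enter : PastStep nothing (just 0)
  leave : PastStep (just 0) nothing
  outside : PastStep nothing nothing

monus-step : ∀ s δ → PastStep (monus s δ) (monus s (suc δ))
monus-step zero δ = inside
monus-step (suc zero) zero = enter
monus-step (suc (suc s)) zero = outside
monus-step (suc s) (suc δ) = monus-step s δ

monus-just : ∀ s δ {k} → monus s δ ≡ just k → δ ≡ s + k
monus-just zero δ refl = refl
monus-just (suc s) (suc δ) e = cong suc (monus-just s δ e)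

past-just : ∀ {t} i s (c : SPos t) {k} → past i s c ≡ just k → depth c ≡ s + k
past-just i s ctr e = monus-just s 0 e
past-just i s (leg j p) e with j Fin.≟ i
... | yes _ = monus-just s (suc (toℕ p)) e

past-injective : ∀ {t} i s (c c' : SPos t) {k} → past i s c ≡ just k → past i s c' ≡ just k → c ≡ c'
past-injective i s c c' e e' = go c c' e e' (trans (past-just i s c e) (sym (past-just i s c' e')))
  where
    go : ∀ c c' {k} → past i s c ≡ just k → past i s c' ≡ just k → depth c ≡ depth c' → c ≡ c'
    go ctr ctr _ _ _ = refl
    go (leg j p) (leg j' p') e e' d with j Fin.≟ i | j' Fin.≟ i
    ... | yes refl | yes refl = cong (leg j) (Fin.toℕ-injective (suc-injective d))

past-step : ∀ {t} i s {c c' : SPos t} → Down c c' → PastStep (past i s c) (past i s c')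
past-step i s (first {j} {p} e) with j Fin.≟ i
... | yes _ rewrite e = monus-step s 0
past-step i zero (first e) | no _ = leave
past-step i (suc s) (first e) | no _ = outside
past-step i s (next {j} {p} {p'} e) with j Fin.≟ i
... | yes _ = subst (λ z → PastStep (monus s (suc (toℕ p))) (monus s (suc z))) e (monus-step s (suc (toℕ p)))
... | no _ = outside

module _ {A : Set} where
  look : List A → ℕ → Maybe A
  look [] k = nothing
  look (x ∷ xs) zero = just x
  look (x ∷ xs) (suc k) = look xs k

  look-∈ : ∀ xs k {x} → look xs k ≡ just x → x ∈ xs
  look-∈ (y ∷ xs) zero refl = here refl
  look-∈ (y ∷ xs) (suc k) e = there (look-∈ xs k e)

  data LookStep (R : A → A → Set) (l : A) (len : ℕ) (k : ℕ) : Maybe A → Maybe A → Set where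
    within : ∀ {x y} → R x y → LookStep R l len k (just x) (just y)
    end : suc k ≡ len → LookStep R l len k (just l) nothing
    beyond : LookStep R l len k nothing nothing

  look-step : ∀ {R : A → A → Set} I {l} → Linked R (I ++ [ l ]) → ∀ k → LookStep R l (length I + 1) k (look (I ++ [ l ]) k) (look (I ++ [ l ]) (suc k))
  look-step [] lk zero = end refl
  look-step [] lk (suc k) = beyond
  look-step (x ∷ []) (r ∷ lk) zero = within r
  look-step (x ∷ y ∷ I) (r ∷ lk) zero = within r
  look-step (x ∷ I) lk (suc k) = up (look-step I (Linked.tail lk) k)
    where
      up : ∀ {R l len k m m'} → LookStep R l len k m m' → LookStep R l (suc len) (suc k) m m'
      up (within r) = within r
      up (end e) = end (cong suc e)
      up beyond = beyond

look-injective : ∀ {n} (xs : List (Fin n)) {k k' x} → Distinct xs → look xs k ≡ just x → look xs k' ≡ just x → k ≡ k'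
look-injective (x ∷ xs) {zero} {zero} D e e' = refl
look-injective (x ∷ xs) {zero} {suc k'} D refl e' = ⊥-elim (Distinct-head D (look-∈ xs k' e'))
look-injective (x ∷ xs) {suc k} {zero} D e refl = ⊥-elim (Distinct-head D (look-∈ xs k e))
look-injective (x ∷ xs) {suc k} {suc k'} D e e' = cong suc (look-injective xs (Distinct-++ʳ [ x ] D) e e')

module Completions (G : Graph) (simple : IsSimple G) (t : ℕ) (d : Fin (n G)) (A : Bool → List (Fin (n G))) (A! : ∀ g → Distinct (A g))
  (cross : ∀ {a b} → a ∈ A false → b ∈ A true → Adj G a b) (large : ∀ g → Coding.size t + Coding.size t ≤ length (A g)) where
  open Walks G simple
  open Coding t
  open Embeddings G simple t
  open Fill d A A! cross large public

  -- Copies are 2-coloured by depth, that of `u` relative to `u` and all others relative to `v`.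
  -- Then `u` and `v` both have colour false, and any two vertices of that side can take their
  -- places.
  module SameSide {κ κ' : Fin t} {a b : SPos t} (u≢v : (κ , a) ≢ (κ' , b)) (¬uv : ¬ PAdj (κ , a) (κ' , b))
    (even : κ ≡ κ' → par (depth a) ≡ par (depth b)) {x y : V} (x∈ : x ∈ A false) (y∈ : y ∈ A false) (x≢y : x ≢ y) where

    private
      ψ : Pos t → Maybe V
      ψ p with p ≟P (κ , a) | p ≟P (κ' , b)
      ... | yes _ | _ = just x
      ... | no _ | yes _ = just y
      ... | no _ | no _ = nothing

      γ : Pos t → Bool
      γ (k , c) with k Fin.≟ κ
      ... | yes _ = par (depth c + depth a)
      ... | no _ = par (depth c + depth b)

      γ-down : ∀ k {c c'} → Down c c' → γ (k , c') ≡ not (γ (k , c))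
      γ-down k D with k Fin.≟ κ
      ... | yes _ = cong (λ z → par (z + depth a)) (Down-depth D)
      ... | no _ = cong (λ z → par (z + depth b)) (Down-depth D)

      γ-up : ∀ k {c c'} → Down c c' → γ (k , c) ≡ not (γ (k , c'))
      γ-up k D = trans (sym (Bool.not-involutive _)) (cong not (sym (γ-down k D)))

      γ-u : γ (κ , a) ≡ false
      γ-u with κ Fin.≟ κ
      ... | yes _ = par-double (depth a)
      ... | no ne = ⊥-elim (ne refl)

      γ-v : γ (κ' , b) ≡ false
      γ-v with κ' Fin.≟ κ
      ... | yes e = trans (par-+ (depth b) (depth a) (depth a) (sym (even (sym e)))) (par-double (depth a))
      ... | no _ = par-double (depth b)

      ψ-u : ψ (κ , a) ≡ just x
      ψ-u with (κ , a) ≟P (κ , a) | (κ , a) ≟P (κ' , b)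
      ... | yes _ | _ = refl
      ... | no ne | _ = ⊥-elim (ne refl)

      ψ-v : ψ (κ' , b) ≡ just y
      ψ-v with (κ' , b) ≟P (κ , a) | (κ' , b) ≟P (κ' , b)
      ... | yes e | _ = ⊥-elim (u≢v (sym e))
      ... | no _ | yes _ = refl
      ... | no _ | no ne = ⊥-elim (ne refl)

      ψ-just : ∀ p {z} → ψ p ≡ just z → (p ≡ (κ , a) × z ≡ x) ⊎ (p ≡ (κ' , b) × z ≡ y)
      ψ-just p e with p ≟P (κ , a) | p ≟P (κ' , b)
      ... | yes q | _ = inj₁ (q , sym (just-injective e))
      ... | no _ | yes q = inj₂ (q , sym (just-injective e))

      inj : ∀ {p q z} → ψ p ≡ just z → ψ q ≡ just z → p ≡ q
      inj {p} {q} e e' with ψ-just p e | ψ-just q e'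
      ... | inj₁ (r , _) | inj₁ (r' , _) = trans r (sym r')
      ... | inj₂ (r , _) | inj₂ (r' , _) = trans r (sym r')
      ... | inj₁ (_ , f) | inj₂ (_ , f') = ⊥-elim (x≢y (trans (sym f) f'))
      ... | inj₂ (_ , f) | inj₁ (_ , f') = ⊥-elim (x≢y (trans (sym f') f))

      complete : ∀ p {z} → ψ p ≡ just z → CompleteTo z (not (γ p))
      complete p e m _ with ψ-just p e
      ... | inj₁ (refl , refl) = cross x∈ (subst (λ g → _ ∈ A (not g)) γ-u m)
      ... | inj₂ (refl , refl) = cross y∈ (subst (λ g → _ ∈ A (not g)) γ-v m)

      fits : ∀ k {c c'} → Down c c' → Fits (ψ (k , c)) (γ (k , c)) (ψ (k , c')) (γ (k , c'))
      fits k {c} {c'} D with ψ (k , c) in e | ψ (k , c') in e'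
      ... | nothing | nothing = λ q → ≢not _ (trans q (γ-down k D))
      ... | just z | nothing = subst (CompleteTo z) (sym (γ-down k D)) (complete (k , c) e)
      ... | nothing | just z = subst (CompleteTo z) (sym (γ-up k D)) (complete (k , c') e')
      ... | just z | just z' with ψ-just (k , c) e | ψ-just (k , c') e'
      ... | inj₁ (refl , _) | inj₁ (refl , _) = ⊥-elim (Down-irrefl D refl)
      ... | inj₂ (refl , _) | inj₂ (refl , _) = ⊥-elim (Down-irrefl D refl)
      ... | inj₁ (refl , _) | inj₂ (refl , _) = ⊥-elim (¬uv (refl , inj₁ D))
      ... | inj₂ (refl , _) | inj₁ (refl , _) = ⊥-elim (¬uv (refl , inj₂ D))

    sameSide : ∃[ e ] (φ e (κ , a) ≡ x × φ e (κ' , b) ≡ y)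
    sameSide with fill ψ γ (λ {p} {q} → inj {p} {q}) fits
    ... | e , ext = e , ext ψ-u , ext ψ-v

  step-fits : ∀ {l len k m m' g h} → LookStep _~_ l len k m m' → (suc k ≡ len → CompleteTo l h) → (m ≡ nothing → g ≢ h) → Fits m g m' h
  step-fits (within r) _ _ = r
  step-fits (end e) f _ = f e
  step-fits beyond _ f = f refl

  -- The parent of `u` goes to `w` and `u` to `x`, which need not be adjacent to anything but its
  -- neighbours on the path. The leg follows the path to `l` and then returns to the two sides; a
  -- leg that ends sooner uses only a part of the path. By `sep`, the only vertex of the path that
  -- can be a required neighbour of `y` is `w`, which is the case covered by `close`.
  module OuterVertex {κ κ' : Fin t} {i : Fin 3} {s : Fin t} {b : SPos t} (sep : κ ≡ κ' → past i (toℕ s) b ≡ nothing)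
    {w x y l : V} {I : List V} (path : Linked _~_ (w ∷ x ∷ I ++ [ l ])) (path! : Distinct (y ∷ w ∷ x ∷ I ++ [ l ]))
    {g : Bool} (l-complete : CompleteTo l g) (w-complete : CompleteTo w true)
    (y-complete : CompleteTo y (not (par (depth b + toℕ s)))) (close : κ ≡ κ' → par (depth b + toℕ s) ≡ true → w ~ y) where

    private
      u v : Pos t
      u = κ , leg i s
      v = κ' , b
      s₀ = toℕ s
      Λ : List V
      Λ = w ∷ x ∷ I ++ [ l ]

      other : ∀ {p} → Dec (p ≡ v) → Maybe V
      other (yes _) = just y
      other (no _) = nothing

      ψ' : ∀ {k p} → Dec (k ≡ κ) → Maybe ℕ → Dec (p ≡ v) → Maybe V
      ψ' (yes _) (just j) _ = look Λ j
      ψ' (yes _) nothing e = other e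
      ψ' (no _) _ e = other e

      ψ : Pos t → Maybe V
      ψ (k , c) = ψ' {k} {k , c} (k Fin.≟ κ) (past i s₀ c) ((k , c) ≟P v)

      bit : Bool → ℕ
      bit true = 1
      bit false = 0

      r : ℕ
      r = length I + 1

      -- On the leg beyond u the colouring continues from the end of the path; elsewhere w has colour false.
      γ' : ∀ {k} → Dec (k ≡ κ) → Maybe ℕ → ℕ → Bool
      γ' (yes _) (just (suc (suc j))) _ = par (j + (r + bit g))
      γ' _ _ δ = par (δ + s₀)

      γ : Pos t → Bool
      γ (k , c) = γ' {k} (k Fin.≟ κ) (past i s₀ c) (depth c)

      -- In `Λ` the vertex `l` has index r + 1, so the first position after the path is the one with
      -- j = r.
      end-colour : par (r + (r + bit g)) ≡ g
      end-colour = trans (cong par (sym (+-assoc r r (bit g)))) (lemma (r + r) g (par-double r))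
        where
          lemma : ∀ m g → par m ≡ false → par (m + bit g) ≡ g
          lemma m true e = trans (cong par (+-comm m 1)) (cong not e)
          lemma m false e = trans (cong par (+-identityʳ m)) e

      y∉Λ : y ∉ Λ
      y∉Λ = Distinct-head path!

      Λ! : Distinct Λ
      Λ! = Distinct-++ʳ [ y ] path!

      ψ-just : ∀ p {z} → ψ p ≡ just z → (proj₁ p ≡ κ × ∃[ j ] (past i s₀ (proj₂ p) ≡ just j × look Λ j ≡ just z)) ⊎ (p ≡ v × z ≡ y)
      ψ-just (k , c) e with k Fin.≟ κ | past i s₀ c | (k , c) ≟P v
      ... | yes q | just j | _ = inj₁ (q , j , refl , e)
      ... | yes _ | nothing | yes q = inj₂ (q , sym (just-injective e))
      ... | no _ | _ | yes q = inj₂ (q , sym (just-injective e))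

      inj : ∀ {p q z} → ψ p ≡ just z → ψ q ≡ just z → p ≡ q
      inj {p} {q} e e' with ψ-just p e | ψ-just q e'
      ... | inj₂ (f , _) | inj₂ (f' , _) = trans f (sym f')
      ... | inj₁ (_ , j , _ , f) | inj₂ (_ , refl) = ⊥-elim (y∉Λ (look-∈ Λ j f))
      ... | inj₂ (_ , refl) | inj₁ (_ , j , _ , f) = ⊥-elim (y∉Λ (look-∈ Λ j f))
      inj {_ , c} {_ , c'} e e' | inj₁ (refl , j , f , h) | inj₁ (refl , j' , f' , h') =
        cong (κ ,_) (past-injective i s₀ c c' f (trans f' (cong just (sym (look-injective Λ Λ! h h')))))

      free-free : ∀ {k c c'} → Down c c' → (e : Dec ((k , c) ≡ v)) (e' : Dec ((k , c') ≡ v)) →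
        Fits (other e) (par (depth c + s₀)) (other e') (par (depth c' + s₀))
      free-free D (yes refl) (yes f) = ⊥-elim (Down-irrefl D (cong proj₂ (sym f)))
      free-free D (yes refl) (no _) = subst (λ δ → CompleteTo y (par (δ + s₀))) (sym (Down-depth D)) y-complete
      free-free {c = c} D (no _) (yes refl) = subst (CompleteTo y) (trans (cong (λ δ → not (par (δ + s₀))) (Down-depth D)) (Bool.not-involutive (par (depth c + s₀)))) y-complete
      free-free D (no _) (no _) q = ≢not _ (trans q (cong (λ δ → par (δ + s₀)) (Down-depth D)))

      w-free : ∀ {c} → par (depth c + s₀) ≡ true → (e : Dec ((κ , c) ≡ v)) → Fits (just w) false (other e) (par (depth c + s₀))
      w-free q (yes refl) = close refl q
      w-free q (no _) = subst (CompleteTo w) (sym q) w-complete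

      free-w : ∀ {c} → par (depth c + s₀) ≡ true → (e : Dec ((κ , c) ≡ v)) → Fits (other e) (par (depth c + s₀)) (just w) false
      free-w q (yes refl) = ~-sym (close refl q)
      free-w q (no _) = subst (CompleteTo w) (sym q) w-complete

      fits-leg : ∀ {c c'} (q : κ ≡ κ) → Down c c' → ∀ {m m'} → PastStep m m' → past i s₀ c ≡ m → past i s₀ c' ≡ m' →
        (e : Dec ((κ , c) ≡ v)) (e' : Dec ((κ , c') ≡ v)) →
        Fits (ψ' {κ} {κ , c} (yes q) m e) (γ' {κ} (yes q) m (depth c)) (ψ' {κ} {κ , c'} (yes q) m' e') (γ' {κ} (yes q) m' (depth c'))
      fits-leg q D (inside {j}) _ _ _ _ = step-fits (look-step (w ∷ x ∷ I) path j) (λ f → fin j f) (far j)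
        where
          fin : ∀ j → suc j ≡ suc (suc (length I + 1)) → ∀ {δ} → CompleteTo l (γ' {κ} (yes q) (just (suc j)) δ)
          fin j refl = subst (CompleteTo l) (sym end-colour) l-complete
          far : ∀ j {δ δ'} → look Λ j ≡ nothing → γ' {κ} (yes q) (just j) δ ≢ γ' {κ} (yes q) (just (suc j)) δ'
          far (suc (suc j)) _ f = ≢not _ f
      fits-leg {c} {c'} q D enter _ p' e _ = subst (λ h → Fits (other e) (par (depth c + s₀)) (just w) h) (sym (trans (cong (λ z → par (z + s₀)) depth-c') (par-double s₀))) (free-w odd e)
        where
          depth-c' : depth c' ≡ s₀
          depth-c' = trans (past-just i s₀ c' p') (+-identityʳ s₀)
          odd : par (depth c + s₀) ≡ true
          odd = trans (sym (Bool.not-involutive _)) (cong not (trans (cong (λ z → par (z + s₀)) (trans (sym (Down-depth D)) depth-c')) (par-double s₀)))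
      fits-leg {c} {c'} q D leave p _ _ e' = subst (λ h → Fits (just w) h (other e') (par (depth c' + s₀))) (sym (trans (cong (λ z → par (z + s₀)) depth-c) (par-double s₀))) (w-free odd e')
        where
          depth-c : depth c ≡ s₀
          depth-c = trans (past-just i s₀ c p) (+-identityʳ s₀)
          odd : par (depth c' + s₀) ≡ true
          odd = trans (cong (λ z → par (z + s₀)) (trans (Down-depth D) (cong suc depth-c))) (cong not (par-double s₀))
      fits-leg q D outside _ _ e e' = free-free D e e'

      fits : ∀ k {c c'} → Down c c' → Fits (ψ (k , c)) (γ (k , c)) (ψ (k , c')) (γ (k , c'))
      fits k {c} {c'} D with k Fin.≟ κ
      ... | yes refl = fits-leg refl D (past-step i s₀ D) refl refl _ _
      ... | no _ = free-free D _ _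

      monus-self : ∀ s → monus s (suc s) ≡ just 1
      monus-self zero = refl
      monus-self (suc s) = monus-self s

      past-self : past i s₀ (leg i s) ≡ just 1
      past-self with i Fin.≟ i
      ... | yes _ = monus-self s₀
      ... | no ne = ⊥-elim (ne refl)

      ψ-u : ψ u ≡ just x
      ψ-u with κ Fin.≟ κ
      ... | no ne = ⊥-elim (ne refl)
      ... | yes q = cong (λ m → ψ' {κ} {u} (yes q) m (u ≟P v)) past-self

      ψ-v : ψ v ≡ just y
      ψ-v with κ' Fin.≟ κ | v ≟P v
      ... | _ | no ne = ⊥-elim (ne refl)
      ... | no _ | yes _ = refl
      ... | yes e | yes f = cong (λ m → ψ' {κ'} {v} (yes e) m (yes f)) (sep (sym e))

    outerVertex : ∃[ e ] (φ e (κ , leg i s) ≡ x × φ e (κ' , b) ≡ y)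
    outerVertex with fill ψ γ (λ {p} {q} → inj {p} {q}) fits
    ... | e , ext = e , ext ψ-u , ext ψ-v

  -- A centre has no parent that could be put on a vertex of a side, so all three legs at `w` need a
  -- path. The lengths of the paths have arbitrary parities, hence their ends must be complete to
  -- both sides.
  module TwoCentres {κ κ' : Fin t} (κ≢κ' : κ ≢ κ') {w z : V} (I : Fin 3 → List V) (l : Fin 3 → V)
    (linked : ∀ j → Linked _~_ (w ∷ I j ++ [ l j ])) (paths! : ∀ j → Distinct (w ∷ I j ++ [ l j ]))
    (disjoint : ∀ {j j' v} → v ∈ I j ++ [ l j ] → v ∈ I j' ++ [ l j' ] → j ≡ j') (z∉ : ∀ j → z ∉ w ∷ I j ++ [ l j ])
    (l-complete : ∀ j g → CompleteTo (l j) g) (z-complete : ∀ g → CompleteTo z g) where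

    private
      Λ : Fin 3 → List V
      Λ j = w ∷ I j ++ [ l j ]

      ψ' : ∀ {k} → Dec (k ≡ κ) → SPos t → Dec (k ≡ κ') → Maybe V
      ψ' (yes _) ctr _ = just w
      ψ' (yes _) (leg j p) _ = look (Λ j) (suc (toℕ p))
      ψ' (no _) ctr (yes _) = just z
      ψ' (no _) ctr (no _) = nothing
      ψ' (no _) (leg _ _) _ = nothing

      ψ : Pos t → Maybe V
      ψ (k , c) = ψ' {k} (k Fin.≟ κ) c (k Fin.≟ κ')

      γ : Pos t → Bool
      γ (k , c) = par (depth c)

      fits : ∀ k {c c'} → Down c c' → Fits (ψ (k , c)) (γ (k , c)) (ψ (k , c')) (γ (k , c'))
      fits k D with k Fin.≟ κ | k Fin.≟ κ'
      fits k (first {j} {p} e) | yes _ | _ rewrite e = step-fits (look-step (w ∷ I j) (linked j) 0) (λ _ → l-complete j true) (λ ())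
      fits k (next {j} {p} {p'} e) | yes _ | _ rewrite sym e =
        step-fits (look-step (w ∷ I j) (linked j) (suc (toℕ p))) (λ _ → l-complete j _) (λ _ → ≢not _)
      fits k (first e) | no _ | yes _ = z-complete _
      fits k (first e) | no _ | no _ = λ f → ≢not _ (trans f (cong (λ q → par (suc q)) e))
      fits k (next e) | no _ | _ = λ f → ≢not _ (trans f (cong (λ q → par (suc q)) (sym e)))

      w∉ : ∀ j → w ∉ I j ++ [ l j ]
      w∉ j = Distinct-head (paths! j)

      inj' : ∀ {k k'} (e : Dec (k ≡ κ)) (f : Dec (k ≡ κ')) (e' : Dec (k' ≡ κ)) (f' : Dec (k' ≡ κ')) c c' {x} →
        ψ' {k} e c f ≡ just x → ψ' {k'} e' c' f' ≡ just x → (k , c) ≡ (k' , c')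
      inj' (yes refl) _ (yes refl) _ ctr ctr _ _ = refl
      inj' (yes refl) _ (yes refl) _ ctr (leg j p) refl q = ⊥-elim (w∉ j (look-∈ (I j ++ [ l j ]) (toℕ p) q))
      inj' (yes refl) _ (yes refl) _ (leg j p) ctr q refl = ⊥-elim (w∉ j (look-∈ (I j ++ [ l j ]) (toℕ p) q))
      inj' (yes refl) _ (yes refl) _ (leg j p) (leg j' p') q q'
        with disjoint (look-∈ (I j ++ [ l j ]) (toℕ p) q) (look-∈ (I j' ++ [ l j' ]) (toℕ p') q')
      ... | refl = cong (λ z → κ , leg j z) (Fin.toℕ-injective (suc-injective (look-injective (Λ j) {suc (toℕ p)} {suc (toℕ p')} (paths! j) q q')))
      inj' (yes _) _ (no _) (yes _) ctr ctr refl q = ⊥-elim (z∉ fz (here (just-injective q)))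
      inj' (yes _) _ (no _) (yes _) (leg j p) ctr q refl = ⊥-elim (z∉ j (there (look-∈ (I j ++ [ l j ]) (toℕ p) q)))
      inj' (no _) (yes _) (yes _) _ ctr ctr q refl = ⊥-elim (z∉ fz (here (just-injective q)))
      inj' (no _) (yes _) (yes _) _ ctr (leg j p) refl q = ⊥-elim (z∉ j (there (look-∈ (I j ++ [ l j ]) (toℕ p) q)))
      inj' (no _) (yes e) (no _) (yes e') ctr ctr q q' = cong (_, ctr) (trans e (sym e'))

      ψ-u : ψ (κ , ctr) ≡ just w
      ψ-u with κ Fin.≟ κ
      ... | yes _ = refl
      ... | no ne = ⊥-elim (ne refl)

      ψ-v : ψ (κ' , ctr) ≡ just z
      ψ-v with κ' Fin.≟ κ | κ' Fin.≟ κ'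
      ... | yes e | _ = ⊥-elim (κ≢κ' (sym e))
      ... | no _ | yes _ = refl
      ... | no _ | no ne = ⊥-elim (ne refl)

    twoCentres : ∃[ e ] (φ e (κ , ctr) ≡ w × φ e (κ' , ctr) ≡ z)
    twoCentres with fill ψ γ (λ {(k , c)} {(k' , c')} → inj' (k Fin.≟ κ) (k Fin.≟ κ') (k' Fin.≟ κ) (k' Fin.≟ κ') c c') fits
    ... | e , ext = e , ext ψ-u , ext ψ-v

-- Cliques and connectivity

-- The condition on an ordered pair under which `OuterVertex` applies: the first position has a
-- parent, and the second is neither this parent nor beyond it on the leg.
data Oriented {t : ℕ} : Pos t → Pos t → Set where
  oriented : ∀ {κ κ' i s b} → (κ ≡ κ' → past i (toℕ s) b ≡ nothing) → Oriented (κ , leg i s) (κ' , b)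

data BothCentres {t : ℕ} : Pos t → Pos t → Set where
  bothCentres : ∀ {κ κ'} → κ ≢ κ' → BothCentres (κ , ctr) (κ' , ctr)

monus-nothing : ∀ {s δ} → δ < s → monus s δ ≡ nothing
monus-nothing {suc s} {zero} _ = refl
monus-nothing {suc s} {suc δ} (s≤s lt) = monus-nothing lt

past-depth : ∀ {t i q} {a : SPos t} s → AtDepth i q a → past i s a ≡ monus s q
past-depth s centre = refl
past-depth {i = i} s (along p) with i Fin.≟ i
... | yes _ = refl
... | no ne = ⊥-elim (ne refl)

-- On a common leg the deeper position has to come first, since the path occupies everything from
-- its parent outwards.
orientSame : ∀ {t} {κ : Fin t} {a b} → Nonadjacent a b → Oriented (κ , a) (κ , b) ⊎ Oriented (κ , b) (κ , a)
orientSame {κ = κ} {a} {b} (sameLeg i {q} {e} da db) = inj₂ (deeper db refl)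
  where
    deeper : ∀ {m b} → AtDepth i m b → m ≡ q + suc (suc e) → Oriented (κ , b) (κ , a)
    deeper centre eq = ⊥-elim (0≢1+n (trans eq (+-suc q (suc e))))
    deeper (along s) eq = oriented (λ _ → trans (past-depth (toℕ s) da) (monus-nothing
      (≤-trans (≤-trans (s≤s (m≤m+n q e)) (≤-reflexive (sym (+-suc q e)))) (≤-reflexive (suc-injective (trans (sym (+-suc q (suc e))) (sym eq)))))))
orientSame (twoLegs {i} {j} {s} {s'} i≢j) = inj₁ (oriented (λ _ → off-leg))
  where
    off-leg : past i (toℕ s) (leg j s') ≡ nothing
    off-leg with j Fin.≟ i
    ... | yes e = ⊥-elim (i≢j (sym e))
    ... | no _ = refl

orient : ∀ {t} (u v : Pos t) → u ≢ v → ¬ PAdj u v → Oriented u v ⊎ Oriented v u ⊎ BothCentres u v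
orient (κ , a) (κ' , b) ne na with κ Fin.≟ κ'
orient (κ , ctr) (κ' , ctr) ne na | no κ≢ = inj₂ (inj₂ (bothCentres κ≢))
orient (κ , leg i s) (κ' , b) ne na | no κ≢ = inj₁ (oriented (λ e → ⊥-elim (κ≢ e)))
orient (κ , ctr) (κ' , leg i s) ne na | no κ≢ = inj₂ (inj₁ (oriented (λ e → ⊥-elim (κ≢ (sym e)))))
orient (κ , a) (κ , b) ne na | yes refl with classify a b (λ e → ne (cong (κ ,_) e)) (λ d → na (refl , d))
... | inj₁ x with orientSame {κ = κ} x
... | inj₁ o = inj₁ o
... | inj₂ o = inj₂ (inj₁ o)
orient (κ , a) (κ , b) ne na | yes refl | inj₂ x with orientSame {κ = κ} x
... | inj₁ o = inj₂ (inj₁ o)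
... | inj₂ o = inj₁ o

module Separation (G : Graph) (simple : IsSimple G) (nocut : ¬ HasSmallCliqueCutset G) where
  open Walks G simple

  Clique : List V → Set
  Clique K = ∀ {x y} → x ∈ K → y ∈ K → x ≢ y → x ~ y

  connect : ∀ D → Clique D → length D ≤ 2 → ∀ {x y} → x ∉ D → y ∉ D → Star (Off D) x y
  connect D clique small {x} {y} x∉ y∉ with star? (off? D) x y
  ... | yes s = s
  ... | no ¬s = ⊥-elim (nocut (fromList D , (x , y , (λ m → x∉ (∈-fromList⁻ D m)) , (λ m → y∉ (∈-fromList⁻ D m))
      , λ s → ¬s (gmap (λ v → v) (λ (a , l , r) → off a (λ m → l (∈-fromList⁺ m)) (λ m → r (∈-fromList⁺ m))) s))
      , (λ a b i j → clique (∈-fromList⁻ D i) (∈-fromList⁻ D j)) , ≤-trans (∣fromList∣ D) small))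

  record Escape (Hs S : List V) (w x : V) : Set where
    field
      I : List V
      l y : V
      path : Linked _~_ (w ∷ x ∷ I ++ [ l ])
      path! : Distinct (y ∷ w ∷ x ∷ I ++ [ l ])
      l∈Hs : l ∈ Hs
      y∈S : y ∈ S
      x≁y : ¬ x ~ y

  -- If `x` has a second neighbour in `Hs`, the path ends there. Otherwise `x` is outside `Hs` with
  -- `w` as its only neighbour in it. As `w` is not a cutset, a path off `w` leads from `x` to some
  -- `l` in `Hs`, and any member of `S` other than `w` and `l` can replace `y`.
  escape : ∀ {Hs S w x y} → (∀ {v} → v ∈ S → v ∈ Hs) → Distinct S → 3 ≤ length S → w ∈ S → y ∈ S → w ~ x → ¬ x ~ y → x ≢ y →
    x ∉ Hs ⊎ (∃[ r ] (r ∈ Hs × r ≢ w × x ~ r)) → Escape Hs S w x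
  escape {Hs} {S} {w} {x} {y} S⊆ S! three w∈ y∈ w~x x≁y x≢y free
    with Fin.any? (λ r → r ∈? Hs ×-dec ¬? (r Fin.≟ w) ×-dec x ~? r)
  ... | yes (r , r∈ , r≢w , x~r) = record
    { I = [] ; l = r ; y = y ; path = w~x ∷ x~r ∷ [-]
    ; path! = Distinct-∷ (λ { (here refl) → x≁y (~-sym w~x) ; (there (here e)) → x≢y (sym e) ; (there (there (here refl))) → x≁y x~r })
        (Distinct-∷ (λ { (here e) → ~⇒≢ w~x e ; (there (here e)) → r≢w (sym e) })
          (Distinct-∷ (λ { (here e) → ~⇒≢ x~r e }) (Distinct-[-] r)))
    ; l∈Hs = r∈ ; y∈S = y∈ ; x≁y = x≁y }
  ... | no ¬r = walk (firstHit {R = Off [ w ]} (_∈? Hs)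
        (connect [ w ] (λ { (here refl) (here refl) ne → ⊥-elim (ne refl) }) (s≤s z≤n)
          {x} {h} (λ { (here e) → w≢x (sym e) }) (proj₂ (proj₂ target)))
        (S⊆ (proj₁ (proj₂ target))))
    where
      x∉ : x ∉ Hs
      x∉ m = case free
        where
          case : x ∉ Hs ⊎ (∃[ r ] (r ∈ Hs × r ≢ w × x ~ r)) → ⊥
          case (inj₁ f) = f m
          case (inj₂ h) = ¬r h
      target = fresh [ w ] S S! (≤-trans (s≤s (s≤s z≤n)) three)
      h = proj₁ target
      w≢x = ~⇒≢ w~x
      walk : FirstHit {R = Off [ w ]} (_∈ Hs) x → Escape Hs S w x
      walk record { inner = [] ; split = refl ; last∈ = l∈ } = ⊥-elim (x∉ l∈)
      walk record { inner = _ ∷ I ; last = l ; split = refl ; linked = linked ; unique = unique ; last∈ = l∈ ; inner∉ = inner∉ } = record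
        { I = I ; l = l ; y = y' ; path = w~x ∷ linked-adj linked
        ; path! = Distinct-∷ y'∉ (Distinct-∷ (λ m → Linked-all {R = Off [ w ]} right (λ { (here e) → w≢x (sym e) }) linked m (here refl)) unique)
        ; l∈Hs = l∈ ; y∈S = y'∈ ; x≁y = λ a → ¬r (y' , S⊆ y'∈ , (λ e → proj₂ (proj₂ choice) (here e)) , a) }
        where
          choice = fresh (w ∷ l ∷ []) S S! three
          y' = proj₁ choice
          y'∈ = proj₁ (proj₂ choice)
          y'∉ : y' ∉ w ∷ x ∷ I ++ [ l ]
          y'∉ (here e) = proj₂ (proj₂ choice) (here e)
          y'∉ (there m) with ∈-++⁻ (x ∷ I) m
          ... | inj₁ m' = inner∉ m' (S⊆ y'∈)
          ... | inj₂ (here e) = proj₂ (proj₂ choice) (there (here e))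

  record Maximal (K : List V) : Set where
    field
      clique! : Distinct K
      clique : Clique K
      blocked : ∀ {y} → y ∉ K → ∃[ k ] (k ∈ K × ¬ y ~ k)

  private
    grow : ∀ ys K → Distinct K → Clique K → ∃[ K' ] (Distinct K' × Clique K' × length K ≤ length K' × (∀ {k} → k ∈ K → k ∈ K') ×
      (∀ {y} → y ∈ ys → y ∈ K' ⊎ ∃[ k ] (k ∈ K' × ¬ y ~ k)))
    grow [] K K! c = K , K! , c , ≤-refl , (λ m → m) , λ ()
    grow (y ∷ ys) K K! c with y ∈? K | Fin.any? (λ k → k ∈? K ×-dec ¬? (y ~? k))
    ... | no y∉ | no all with grow ys (y ∷ K) (Distinct-∷ y∉ K!) clique'
      where
        y~ : ∀ {k} → k ∈ K → y ~ k
        y~ {k} m = decidable-stable (y ~? k) (λ ne → all (k , m , ne))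
        clique' : Clique (y ∷ K)
        clique' (here refl) (here refl) ne = ⊥-elim (ne refl)
        clique' (here refl) (there m) _ = y~ m
        clique' (there m) (here refl) _ = ~-sym (y~ m)
        clique' (there m) (there m') ne = c m m' ne
    ... | K' , K'! , c' , le , sub , out = K' , K'! , c' , ≤-trans (n≤1+n _) le , (λ m → sub (there m)) , λ { (here refl) → inj₁ (sub (here refl)) ; (there m) → out m }
    grow (y ∷ ys) K K! c | yes y∈ | _ with grow ys K K! c
    ... | K' , K'! , c' , le , sub , out = K' , K'! , c' , le , sub , λ { (here refl) → inj₁ (sub y∈) ; (there m) → out m }
    grow (y ∷ ys) K K! c | no _ | yes (k , k∈ , ne) with grow ys K K! c
    ... | K' , K'! , c' , le , sub , out = K' , K'! , c' , le , sub , λ { (here refl) → inj₂ (k , sub k∈ , ne) ; (there m) → out m }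

  maximal : ∀ K → Distinct K → Clique K → ∃[ K' ] (Maximal K' × length K ≤ length K')
  maximal K K! c with grow (allFin (n G)) K K! c
  ... | K' , K'! , c' , le , _ , out = K' , record { clique! = K'! ; clique = c' ; blocked = λ {y} y∉ → decide y∉ (out (∈-allFin y)) } , le
    where
      decide : ∀ {y} → y ∉ K' → y ∈ K' ⊎ (∃[ k ] (k ∈ K' × ¬ y ~ k)) → ∃[ k ] (k ∈ K' × ¬ y ~ k)
      decide y∉ (inj₁ m) = ⊥-elim (y∉ m)
      decide y∉ (inj₂ r) = r

  crossing : ∀ {D K x k} → Star (Off D) x k → x ∉ K → k ∈ K → ∃[ x' ] ∃[ k' ] (x' ∉ K × k' ∈ K × x' ~ k')
  crossing ε x∉ k∈ = ⊥-elim (x∉ k∈)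
  crossing {K = K} (_◅_ {j = z} r s) x∉ k∈ with z ∈? K
  ... | yes z∈ = _ , z , x∉ , z∈ , adj r
  ... | no z∉ = crossing s z∉ k∈

  record TripodInto (K : List V) : Set where
    field
      w : V
      I : Fin 3 → List V
      l : Fin 3 → V
      w∉K : w ∉ K
      l∈K : ∀ j → l j ∈ K
      linked : ∀ j → Linked _~_ (w ∷ I j ++ [ l j ])
      inner∉K : ∀ j {v} → v ∈ I j → v ∉ K
      unique : Distinct (w ∷ (I fz ++ [ l fz ]) ++ (I (fs fz) ++ [ l (fs fz) ]) ++ (I (fs (fs fz)) ++ [ l (fs (fs fz)) ]))

  three : ∀ {B : Set} → B → B → B → Fin 3 → B
  three a b c fz = a
  three a b c (fs fz) = b
  three a b c (fs (fs fz)) = c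

  every : ∀ {P : Fin 3 → Set} → P fz → P (fs fz) → P (fs (fs fz)) → ∀ j → P j
  every a b c fz = a
  every a b c (fs fz) = b
  every a b c (fs (fs fz)) = c

  reverse-cap : ∀ (k w : V) xs → reverse (k ∷ xs ++ [ w ]) ≡ w ∷ reverse xs ++ [ k ]
  reverse-cap k w xs = trans (reverse-++-∷ (k ∷ xs) w) (cong (w ∷_) (unfold-reverse k xs))

  -- A component of G - K with at most two neighbours in the clique K would be cut off by them.
  tripodInto : ∀ {K x} → Distinct K → Clique K → 3 ≤ length K → x ∉ K → TripodInto K
  tripodInto {K} {x} K! clique 3≤ x∉ = go (filter att? K) refl
    where
      Att : V → Set
      Att k = ∃[ z ] (Star (Off K) x z × z ~ k)
      att? : Decidable Att
      att? k = Fin.any? (λ z → star? (off? K) x z ×-dec z ~? k)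
      few : length (filter att? K) ≤ 2 → ⊥
      few small with fresh (filter att? K) K K! (≤-trans (s≤s small) 3≤)
      ... | k , k∈ , k∉ = stays ε (connect (filter att? K) (λ m m' → clique (proj₁ (∈-filter⁻ att? {xs = K} m)) (proj₁ (∈-filter⁻ att? {xs = K} m')))
            small (λ m → x∉ (proj₁ (∈-filter⁻ att? {xs = K} m))) k∉)
        where
          stays : ∀ {z} → Star (Off K) x z → Star (Off (filter att? K)) z k → ⊥
          stays s ε = Star-last {R = Off K} right x∉ s k∈
          stays {z} s (_◅_ {j = z'} r s') with z' ∈? K
          ... | yes m = right r (∈-filter⁺ att? m (z , s , adj r))
          ... | no z'∉ = stays (s ◅◅ (off (adj r) (Star-last {R = Off K} right x∉ s) z'∉ ◅ ε)) s'
      attached : ∀ {k} → k ∈ filter att? K → k ∈ K × Att k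
      attached = ∈-filter⁻ att? {xs = K}
      build : ∀ {k₁ k₂ k₃} → Distinct (k₁ ∷ k₂ ∷ k₃ ∷ []) → k₁ ∈ K × Att k₁ → k₂ ∈ K × Att k₂ → k₃ ∈ K × Att k₃ → TripodInto K
      -- A path `Q` in the component leads from a neighbour of `k₁` to one of `k₂`. A walk from a
      -- neighbour of `k₃` meets `Q` first at `w`, where the three legs separate.
      build {k₁} {k₂} {k₃} ks! (k₁∈ , y₁ , s₁ , a₁) (k₂∈ , y₂ , s₂ , a₂) (k₃∈ , y₃ , s₃ , a₃) = assemble (∈-∃++ F₂.last∈)
        where
          module F₁ = FirstHit (firstHit {R = Off K} (λ v → v Fin.≟ y₂) (star-sym s₁ ◅◅ s₂) refl)
          Q : List V
          Q = y₁ ∷ F₁.rest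
          module F₂ = FirstHit (firstHit {R = Off K} (_∈? Q) (star-sym s₃ ◅◅ s₁) (here refl))
          I₃ = F₂.inner
          w = F₂.last
          out : ∀ {y v rest} → Star (Off K) x y → Linked (Off K) (y ∷ rest) → v ∈ y ∷ rest → v ∉ K
          out s lk m = Linked-all {R = Off K} right (Star-last {R = Off K} right x∉ s) lk m
          Q∉ : ∀ {v} → v ∈ Q → v ∉ K
          Q∉ = out s₁ F₁.linked
          I₃∉ : ∀ {v} → v ∈ I₃ → v ∉ K
          I₃∉ m = out s₃ F₂.linked (subst (_ ∈_) (sym F₂.split) (∈-++⁺ˡ m))
          Qk₂ : Linked _~_ (k₁ ∷ Q ++ [ k₂ ])
          Qk₂ = subst (λ xs → Linked _~_ (k₁ ∷ xs)) (sym (trans (cong (_++ [ k₂ ]) F₁.split) (++-assoc F₁.inner [ F₁.last ] [ k₂ ])))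
            (Linked-glue (k₁ ∷ F₁.inner) (subst (λ xs → Linked _~_ (k₁ ∷ xs)) F₁.split (~-sym a₁ ∷ linked-adj F₁.linked))
              (subst (_~ k₂) (sym F₁.last∈) a₂ ∷ [-]))
          assemble : ∃[ A ] ∃[ B ] Q ≡ A ++ w ∷ B → TripodInto K
          assemble (A , B , eq) = record
            { w = w ; I = three (reverse A) B (reverse I₃) ; l = three k₁ k₂ k₃ ; w∉K = Q∉ F₂.last∈
            ; l∈K = every k₁∈ k₂∈ k₃∈
            ; linked = every
                (subst (Linked _~_) (reverse-cap k₁ w A) (Linked-reverse ~-sym (k₁ ∷ A ++ [ w ]) (Linked-left (k₁ ∷ A) AwB)))
                (Linked-++ʳ (k₁ ∷ A) AwB)
                (subst (Linked _~_) (reverse-cap k₃ w I₃) (Linked-reverse ~-sym (k₃ ∷ I₃ ++ [ w ])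
                  (subst (λ xs → Linked _~_ (k₃ ∷ xs)) F₂.split (~-sym a₃ ∷ linked-adj F₂.linked))))
            ; inner∉K = every (λ m → Q∉ (subst (_ ∈_) (sym eq) (∈-++⁺ˡ {xs = A} (reverse⁻ {xs = A} m))))
                (λ m → Q∉ (subst (_ ∈_) (sym eq) (∈-++⁺ʳ A (there m)))) (λ m → I₃∉ (reverse⁻ m))
            ; unique = Distinct-mono (λ v → ≤-reflexive (count v)) all! }
            where
              AwB : Linked _~_ ((k₁ ∷ A) ++ w ∷ B ++ [ k₂ ])
              AwB = subst (λ xs → Linked _~_ (k₁ ∷ xs)) (trans (cong (_++ [ k₂ ]) eq) (++-assoc A (w ∷ B) [ k₂ ])) Qk₂
              ks : List V
              ks = k₁ ∷ k₂ ∷ k₃ ∷ []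
              ks⊆ : ∀ {v} → v ∈ ks → v ∈ K
              ks⊆ (here refl) = k₁∈
              ks⊆ (there (here refl)) = k₂∈
              ks⊆ (there (there (here refl))) = k₃∈
              all! : Distinct (Q ++ I₃ ++ ks)
              all! = Distinct-++ F₁.unique (Distinct-++ (Distinct-++ˡ I₃ (subst Distinct F₂.split F₂.unique)) ks! (λ m m' → I₃∉ m (ks⊆ m'))) disj
                where
                  disj : ∀ {v} → v ∈ Q → v ∈ I₃ ++ ks → ⊥
                  disj m m' with ∈-++⁻ I₃ m'
                  ... | inj₁ i = F₂.inner∉ i m
                  ... | inj₂ k = Q∉ m (ks⊆ k)
              arith : ∀ w a b i p q r → w + ((a + (p + 0)) + ((b + (q + 0)) + (i + (r + 0)))) ≡ (a + (w + b)) + (i + (p + (q + (r + 0))))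
              arith = solve-∀
              count : ∀ v → cnt v (w ∷ (reverse A ++ [ k₁ ]) ++ (B ++ [ k₂ ]) ++ (reverse I₃ ++ [ k₃ ])) ≡ cnt v (Q ++ I₃ ++ ks)
              count v = trans (cong (δ v w +_) (trans (cnt-++ v (reverse A ++ [ k₁ ]) _) (cong₂ _+_ (trans (cnt-++ v (reverse A) [ k₁ ]) (cong (_+ cnt v [ k₁ ]) (cnt-reverse v A)))
                    (trans (cnt-++ v (B ++ [ k₂ ]) _) (cong₂ _+_ (cnt-++ v B [ k₂ ]) (trans (cnt-++ v (reverse I₃) [ k₃ ]) (cong (_+ cnt v [ k₃ ]) (cnt-reverse v I₃))))))))
                (trans (arith (δ v w) (cnt v A) (cnt v B) (cnt v I₃) (δ v k₁) (δ v k₂) (δ v k₃))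
                  (sym (trans (cnt-++ v Q (I₃ ++ ks)) (cong₂ _+_ (trans (cong (cnt v) eq) (cnt-++ v A (w ∷ B))) (cnt-++ v I₃ ks)))))
      go : ∀ ks → filter att? K ≡ ks → TripodInto K
      go [] e = ⊥-elim (few (subst (λ l → length l ≤ 2) (sym e) z≤n))
      go (_ ∷ []) e = ⊥-elim (few (subst (λ l → length l ≤ 2) (sym e) (s≤s z≤n)))
      go (_ ∷ _ ∷ []) e = ⊥-elim (few (subst (λ l → length l ≤ 2) (sym e) (s≤s (s≤s z≤n))))
      go (k₁ ∷ k₂ ∷ k₃ ∷ ks) e = build (Distinct-++ˡ (k₁ ∷ k₂ ∷ k₃ ∷ []) (subst Distinct e (Distinct-filter att? K!)))
        (attached (subst (k₁ ∈_) (sym e) (here refl))) (attached (subst (k₂ ∈_) (sym e) (there (here refl)))) (attached (subst (k₃ ∈_) (sym e) (there (there (here refl)))))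

-- Placing a non-adjacent pair

-- A side that is a clique is extended to a maximal one, which is cut into two hosts of at least 2
-- `size` vertices each. The 7 leaves room for three path ends and three further neighbours even if
-- `size` is 0.
sideSize : ℕ → ℕ
sideSize t = (size + size) + ((size + size) + 7)
  where open Coding t

module Endgame (G : Graph) (simple : IsSimple G) (t : ℕ) (nocut : ¬ HasSmallCliqueCutset G) (notwins : ¬ HasFalseTwins G)
  {p q : Fin (n G)} (p≢q : p ≢ q) (p≁q : ¬ Adj G p q) where
  open Walks G simple
  open Separation G simple nocut
  open Embeddings G simple t
  open Bicliques G simple
  open Coding t

  Good : Pos t → Pos t → Set
  Good u v = ∃[ e ] ¬ (φ e u ~ φ e v)

  Good-sym : ∀ {u v} → Good u v → Good v u
  Good-sym (e , bad) = e , λ a → bad (~-sym a)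

  module InClique {K₀ K₁ : List V} (max : Maximal (K₀ ++ K₁)) (large₀ : size + size ≤ length K₀) (large₁ : size + size ≤ length K₁)
    (seven : 7 ≤ length (K₀ ++ K₁)) where
    open Maximal max

    private
      K = K₀ ++ K₁

      A : Bool → List V
      A false = K₀
      A true = K₁

      A⊆K : ∀ g {v} → v ∈ A g → v ∈ K
      A⊆K false m = ∈-++⁺ˡ m
      A⊆K true m = ∈-++⁺ʳ K₀ m

      A! : ∀ g → Distinct (A g)
      A! false = Distinct-++ˡ K₀ clique!
      A! true = Distinct-++ʳ K₀ clique!

      A-cross : ∀ {a b} → a ∈ K₀ → b ∈ K₁ → a ~ b
      A-cross m m' = clique (∈-++⁺ˡ m) (∈-++⁺ʳ K₀ m') (λ { refl → Distinct-disjoint K₀ clique! m m' })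

      A-large : ∀ g → size + size ≤ length (A g)
      A-large false = large₀
      A-large true = large₁

      module C = Completions G simple t p A A! A-cross A-large

      complete : ∀ {y} → y ∈ K → ∀ g → C.CompleteTo y g
      complete y∈ g m ne = clique y∈ (A⊆K g m) (λ e → ne (sym e))

      outsider : ∃[ x ] x ∉ K
      outsider with p ∈? K | q ∈? K
      ... | no p∉ | _ = p , p∉
      ... | yes _ | no q∉ = q , q∉
      ... | yes p∈ | yes q∈ = ⊥-elim (p≁q (clique p∈ q∈ p≢q))

      member-of-K = fresh [] K clique! (≤-trans (s≤s z≤n) seven)

    -- No parity condition arises, since every vertex of `K` is complete to both hosts. It is enough
    -- that `u` goes outside `K`, its parent and `v` inside.
    outer : ∀ {u v} → Oriented u v → Good u v
    outer (oriented {κ} {κ'} {i} {s} {b} sep)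
      with crossing {[]} (connect [] (λ ()) z≤n (λ ()) (λ ())) (proj₂ outsider) (proj₁ (proj₂ member-of-K))
    ... | x , w , x∉ , w∈ , x~w with blocked x∉
    ... | y , y∈ , x≁y with escape (λ m → m) clique! (≤-trans (s≤s (s≤s (s≤s z≤n))) seven) w∈ y∈ (~-sym x~w) x≁y (λ { refl → x∉ y∈ }) (inj₁ x∉)
    ... | E with C.OuterVertex.outerVertex {κ} {κ'} {i} {s} {b} sep path path! (complete l∈Hs false) (complete w∈ true) (complete y∈S _)
        (λ _ _ → clique w∈ y∈S (λ e → Distinct-head path! (here (sym e))))
      where open Escape E
    ... | e , eu , ev = e , λ a → Escape.x≁y E (subst₂ _~_ eu ev a)

    private
      place-centres : ∀ {κ κ'} → κ ≢ κ' → ∀ {w z} (I : Fin 3 → List V) (l : Fin 3 → V) → z ∈ K → (∀ j → l j ∈ K) →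
        (∀ j → Linked _~_ (w ∷ I j ++ [ l j ])) → (let R = λ j → I j ++ [ l j ] in Distinct (w ∷ R fz ++ R (fs fz) ++ R (fs (fs fz)))) →
        (∀ j → z ∉ w ∷ I j ++ [ l j ]) → ¬ w ~ z → Good (κ , ctr) (κ' , ctr)
      place-centres κ≢κ' {w} {z} I l z∈ l∈ linked unique z∉ w≁z
        with C.TwoCentres.twoCentres κ≢κ' I l linked (λ j → Distinct-∷ (λ m → Distinct-head unique (arm⊆ R j m)) (arm-distinct R R! j))
          (arms-disjoint R R! _ _) z∉ (λ j → complete (l∈ j)) (complete z∈)
        where
          R = λ j → I j ++ [ l j ]
          R! = Distinct-++ʳ [ w ] unique
      ... | e , eu , ev = e , λ a → w≁z (subst₂ _~_ eu ev a)

    centres : ∀ {u v} → BothCentres u v → Good u v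
    centres (bothCentres κ≢κ') with tripodInto clique! clique (≤-trans (s≤s (s≤s (s≤s z≤n))) seven) (proj₂ outsider)
    ... | P = decide (Fin.any? (λ z → z ∈? K ×-dec ¬? (z ∈? ls) ×-dec ¬? (w ~? z)))
      where
        open TripodInto P renaming (unique to into!)
        ls : List V
        ls = l fz ∷ l (fs fz) ∷ l (fs (fs fz)) ∷ []
        l∈ls : ∀ j → l j ∈ ls
        l∈ls = every (here refl) (there (here refl)) (there (there (here refl)))
        decide : Dec (∃[ z ] (z ∈ K × z ∉ ls × ¬ w ~ z)) → Good _ _
        decide (yes (z , z∈ , z∉ls , w≁z)) = place-centres κ≢κ' I l z∈ l∈K linked into! z∉ w≁z
          where
            z∉ : ∀ j → z ∉ w ∷ I j ++ [ l j ]
            z∉ j (here refl) = w∉K z∈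
            z∉ j (there m) with ∈-++⁻ (I j) m
            ... | inj₁ m' = inner∉K j m' z∈
            ... | inj₂ (here refl) = z∉ls (l∈ls j)
        -- Otherwise w is adjacent to all of K except some of the three ends, and single edges serve as legs.
        decide (no none) = place-centres κ≢κ' (λ _ → []) h z∈ h∈ (λ j → w~h j ∷ [-]) unique' z∉ w≁z
          where
            z = proj₁ (blocked w∉K)
            z∈ = proj₁ (proj₂ (blocked w∉K))
            w≁z = proj₂ (proj₂ (blocked w∉K))
            below : ∀ {k} → k ≤ 7 → k ≤ length K
            below le = ≤-trans le seven
            f₁ = fresh ls K clique! (below (s≤s (s≤s (s≤s (s≤s z≤n)))))
            f₂ = fresh (proj₁ f₁ ∷ ls) K clique! (below (s≤s (s≤s (s≤s (s≤s (s≤s z≤n))))))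
            f₃ = fresh (proj₁ f₂ ∷ proj₁ f₁ ∷ ls) K clique! (below (s≤s (s≤s (s≤s (s≤s (s≤s (s≤s z≤n)))))))
            h : Fin 3 → V
            h = three (proj₁ f₁) (proj₁ f₂) (proj₁ f₃)
            h∈ : ∀ j → h j ∈ K
            h∈ = every (proj₁ (proj₂ f₁)) (proj₁ (proj₂ f₂)) (proj₁ (proj₂ f₃))
            h∉ : ∀ j → h j ∉ ls
            h∉ = every (proj₂ (proj₂ f₁)) (λ m → proj₂ (proj₂ f₂) (there m)) (λ m → proj₂ (proj₂ f₃) (there (there m)))
            w~h : ∀ j → w ~ h j
            w~h j = decidable-stable (w ~? h j) (λ na → none (h j , h∈ j , h∉ j , na))
            z∉ : ∀ j → z ∉ w ∷ [ h j ]
            z∉ j (here e) = w∉K (subst (_∈ K) e z∈)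
            z∉ j (there (here e)) = w≁z (subst (w ~_) (sym e) (w~h j))
            w≢h : ∀ j → w ≢ h j
            w≢h j = ~⇒≢ (w~h j)
            unique' : Distinct (w ∷ h fz ∷ h (fs fz) ∷ h (fs (fs fz)) ∷ [])
            unique' = Distinct-∷ (λ { (here e) → w≢h fz e ; (there (here e)) → w≢h (fs fz) e ; (there (there (here e))) → w≢h (fs (fs fz)) e })
              (Distinct-∷ (λ { (here e) → proj₂ (proj₂ f₂) (here (sym e)) ; (there (here e)) → proj₂ (proj₂ f₃) (there (here (sym e))) })
                (Distinct-∷ (λ { (here e) → proj₂ (proj₂ f₃) (here (sym e)) }) (Distinct-[-] _)))

  module InBiclique {N : ℕ} (B : Biclique N) (large : size + size ≤ N) (three≤ : 3 ≤ N) where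
    open Biclique B renaming (left to P; right to Q)

    private
      A : Bool → List V
      A false = P
      A true = Q

      A! : ∀ g → Distinct (A g)
      A! false = left!
      A! true = right!

      A-large : ∀ g → size + size ≤ length (A g)
      A-large false = ≤-trans large (≤-reflexive (sym length-left))
      A-large true = ≤-trans large (≤-reflexive (sym length-right))

      module C = Completions G simple t p A A! cross A-large

    even : ∀ {κ κ' : Fin t} {a b} → (κ , a) ≢ (κ' , b) → ¬ PAdj (κ , a) (κ' , b) → (κ ≡ κ' → par (depth a) ≡ par (depth b)) →
      ∀ {x y} → x ∈ P → y ∈ P → x ≢ y → ¬ x ~ y → Good (κ , a) (κ' , b)
    even u≢v na ev x∈ y∈ x≢y x≁y with C.SameSide.sameSide u≢v na ev x∈ y∈ x≢y
    ... | e , eu , ev = e , λ a → x≁y (subst₂ _~_ eu ev a)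

    private
      distinguish : ∀ {x y} → x ≢ y → ¬ x ~ y → ∃[ z ] ((x ~ z × ¬ y ~ z) ⊎ (y ~ z × ¬ x ~ z))
      distinguish {x} {y} x≢y x≁y with Fin.any? (λ z → (x ~? z ×-dec ¬? (y ~? z)) ⊎-dec (y ~? z ×-dec ¬? (x ~? z)))
      ... | yes r = r
      ... | no none = ⊥-elim (notwins (x , y , x≢y , x≁y , λ z → mk⇔
              (λ a → decidable-stable (y ~? z) (λ na → none (z , inj₁ (a , na))))
              (λ a → decidable-stable (x ~? z) (λ na → none (z , inj₂ (a , na))))))

      -- The parent of `u` has the parity of `v`, so `w` and `y` fit on the same side `P`, and `x`
      -- at position `u` is exempt from the colouring. The substitute for `y` is sought in `P` alone
      -- to keep it on this side, whereas the path may end on either side.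
      odd-from : ∀ {κ κ' : Fin t} {i s b} → (κ ≡ κ' → past i (toℕ s) b ≡ nothing) → par (suc (toℕ s)) ≢ par (depth b) →
        ∀ {w y x} → w ∈ P → y ∈ P → ¬ w ~ y → w ~ x → ¬ y ~ x → Good (κ , leg i s) (κ' , b)
      odd-from {κ} {κ'} {i} {s} {b} sep odd {w} {y} {x} w∈ y∈ w≁y w~x y≁x
        with escape {P ++ Q} {P} (λ m → ∈-++⁺ˡ m) left! (≤-trans three≤ (≤-reflexive (sym length-left))) w∈ y∈ w~x (λ a → y≁x (~-sym a)) (λ { refl → w≁y w~x }) free
        where
          free : x ∉ P ++ Q ⊎ (∃[ r ] (r ∈ P ++ Q × r ≢ w × x ~ r))
          free with x ∈? (P ++ Q)
          ... | no x∉ = inj₁ x∉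
          ... | yes x∈ with ∈-++⁻ P x∈
          ... | inj₂ x∈Q = ⊥-elim (y≁x (cross y∈ x∈Q))
          ... | inj₁ x∈P with fresh [] Q right! (≤-trans (≤-trans (s≤s z≤n) three≤) (≤-reflexive (sym length-right)))
          ... | r , r∈ , _ = inj₂ (r , ∈-++⁺ʳ P r∈ , (λ { refl → ~⇒≢ (cross w∈ r∈) refl }) , cross x∈P r∈)
      ... | E = conclude (∈-++⁻ P l∈Hs)
        where
          open Escape E
          parity : par (depth b + toℕ s) ≡ false
          parity = trans (par-+ (depth b) (toℕ s) (toℕ s) (agree (par (toℕ s)) (par (depth b)) odd)) (par-double (toℕ s))
            where
              agree : ∀ g h → not g ≢ h → h ≡ g
              agree false false _ = refl
              agree true true _ = refl
              agree false true ne = ⊥-elim (ne refl)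
              agree true false ne = ⊥-elim (ne refl)
          run : ∀ g → C.CompleteTo l g → Good _ _
          run g l-complete with C.OuterVertex.outerVertex {κ} {κ'} {i} {s} {b} sep path path! {g} l-complete (λ m _ → cross w∈ m)
            (λ m _ → cross y∈S (subst (λ h → _ ∈ A (not h)) parity m)) (λ _ h → ⊥-elim (false≢true (trans (sym parity) h)))
            where
              false≢true : false ≢ true
              false≢true ()
          ... | e , eu , ev = e , λ a → x≁y (subst₂ _~_ eu ev a)
          conclude : l ∈ P ⊎ l ∈ Q → Good _ _
          conclude (inj₁ l∈) = run true (λ m _ → cross l∈ m)
          conclude (inj₂ l∈) = run false (λ m _ → ~-sym (cross m l∈))

    odd : ∀ {u v} → Oriented u v → par (depth (proj₂ u)) ≢ par (depth (proj₂ v)) → ∀ {x y} → x ∈ P → y ∈ P → x ≢ y → ¬ x ~ y → Good u v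
    odd (oriented sep) ne x∈ y∈ x≢y x≁y with distinguish x≢y x≁y
    ... | z , inj₁ (a , na) = odd-from sep ne x∈ y∈ x≁y a na
    ... | z , inj₂ (a , na) = odd-from sep ne y∈ x∈ (λ h → x≁y (~-sym h)) a na

  biclique⇒good : Biclique (sideSize t) → ∀ u v → u ≢ v → ¬ PAdj u v → Good u v
  biclique⇒good B u@(κ , a) v@(κ' , b) u≢v na
    with Fin.any? (λ x → Fin.any? (λ y → x ∈? P ×-dec y ∈? P ×-dec ¬? (x Fin.≟ y) ×-dec ¬? (x ~? y)))
    where open Biclique B renaming (left to P)
  ... | yes (x , y , x∈ , y∈ , x≢y , x≁y) = parity (κ Fin.≟ κ') (par (depth a) Bool.≟ par (depth b))
    where
      module I = InBiclique B (m≤m+n (size + size) _) (≤-trans (≤-trans (s≤s (s≤s (s≤s z≤n))) (m≤n+m 7 (size + size))) (m≤n+m _ (size + size)))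
      parity : Dec (κ ≡ κ') → Dec (par (depth a) ≡ par (depth b)) → Good u v
      parity (no ne) _ = I.even u≢v na (λ e → ⊥-elim (ne e)) x∈ y∈ x≢y x≁y
      parity (yes _) (yes e) = I.even u≢v na (λ _ → e) x∈ y∈ x≢y x≁y
      parity (yes e) (no ne) with orient u v u≢v na
      ... | inj₁ o = I.odd o ne x∈ y∈ x≢y x≁y
      ... | inj₂ (inj₁ o) = Good-sym (I.odd o (λ f → ne (sym f)) x∈ y∈ x≢y x≁y)
      ... | inj₂ (inj₂ (bothCentres κ≢)) = ⊥-elim (κ≢ e)
  ... | no all = fromClique (maximal P left! (λ {x} {y} x∈ y∈ ne → decidable-stable (x ~? y) (λ h → all (x , y , x∈ , y∈ , ne , h))))
    where
      open Biclique B renaming (left to P)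
      fromClique : ∃[ K ] (Maximal K × length P ≤ length K) → Good u v
      fromClique (K , max , le) with split-++ (size + size) K (sym (m+[n∸m]≡n {size + size} (≤-trans (m≤m+n (size + size) ((size + size) + 7)) big)))
        where
          big : sideSize t ≤ length K
          big = ≤-trans (≤-reflexive (sym length-left)) le
      ... | K₀ , K₁ , refl , l₀ , l₁ = go (orient u v u≢v na)
        where
          big : sideSize t ≤ length (K₀ ++ K₁)
          big = ≤-trans (≤-reflexive (sym length-left)) le
          large₁ : size + size ≤ length K₁
          large₁ = ≤-trans (m≤m+n _ 7) (+-cancelˡ-≤ (size + size) _ _ (≤-trans big (≤-reflexive (trans (length-++ K₀) (cong (_+ length K₁) l₀)))))
          module I = InClique {K₀} {K₁} max (≤-reflexive (sym l₀)) large₁ (≤-trans (≤-trans (m≤n+m 7 (size + size)) (m≤n+m _ (size + size))) big)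
          go : Oriented u v ⊎ Oriented v u ⊎ BothCentres u v → Good u v
          go (inj₁ o) = I.outer o
          go (inj₂ (inj₁ o)) = Good-sym (I.outer o)
          go (inj₂ (inj₂ c)) = I.centres c

-- Lets the pairs of positions be treated one at a time although none of them comes with an explicit
-- separating embedding.
¬¬-∀ : ∀ {m} {P : Fin m → Set} → (∀ i → ¬ ¬ P i) → ¬ ¬ (∀ i → P i)
¬¬-∀ {zero} f k = k (λ ())
¬¬-∀ {suc m} f k = f fz (λ p → ¬¬-∀ (λ i → f (fs i)) (λ g → k (λ { fz → p ; (fs i) → g i })))

module _ (t : ℕ) where
  open Coding t

  -- `legLength` meets the requirement of `sameCopy⇒biclique` and `spiderCount` that of
  -- `differentCopies⇒biclique`. The treewidth bound provides one spider more: it is rerouted while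
  -- the family stays fixed.
  N legLength spiderCount treewidthBound : ℕ
  N = sideSize t
  legLength = t + suc (t + suc ((t + t + t + N + N) * (t + t))) + (t + t + t)
  spiderCount = N + N + t
  treewidthBound = suc spiderCount * suc (legLength + (legLength + legLength)) + (2 + (legLength + legLength + legLength))

  private
    t≤L : t ≤ legLength
    t≤L = ≤-trans (m≤m+n t (t + t)) (≤-trans (≤-reflexive (sym (+-assoc t t t))) (m≤n+m (t + t + t) (t + suc (t + suc ((t + t + t + N + N) * (t + t))))))

  module _ (G : Graph) (simple : IsSimple G) (notwins : ¬ HasFalseTwins G) (nocut : ¬ HasSmallCliqueCutset G)
    {p q : Fin (n G)} (p≢q : p ≢ q) (p≁q : ¬ Adj G p q)
    {Res : List (Fin (n G))} (F : Family.Spiders G simple legLength spiderCount Res) (S : Walks.HasSpider G simple legLength Res) where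
    open Walks G simple
    open Embeddings G simple t
    open Bicliques G simple
    open Homogeneous G simple t legLength t≤L
    open Endgame G simple t nocut notwins p≢q p≁q

    private
      T₀ : Tripod
      T₀ = headTripod S

      anyEmb : Emb
      anyEmb = fromTripods (λ k → member T₀ F (toℕ k)) (λ k k' m m' →
        Fin.toℕ-injective (member-disjoint T₀ F (toℕ k) (toℕ k') (bnd k) (bnd k') m m'))
        where
          bnd : ∀ (k : Fin t) → toℕ k < spiderCount
          bnd k = ≤-trans (Fin.toℕ<n k) (m≤n+m t (N + N))

      homogeneous⇒biclique : ∀ u v → u ≢ v → ¬ PAdj u v → (∀ e → φ e u ~ φ e v) → Biclique N
      homogeneous⇒biclique (κ , a) (κ' , b) u≢v na H with κ Fin.≟ κ'
      ... | no κ≢κ' = differentCopies⇒biclique N F T₀ κ≢κ' H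
      ... | yes refl with classify a b (λ e → u≢v (cong (κ ,_) e)) (λ d → na (refl , d))
      ... | inj₁ x = SameCopy.sameCopy⇒biclique F (m≤n+m t (N + N)) T₀ κ a b H N x S ≤-refl
      ... | inj₂ x = SameCopy.sameCopy⇒biclique F (m≤n+m t (N + N)) T₀ κ b a (λ e → ~-sym (H e)) N x S ≤-refl

      -- If no embedding separates the pair, then all of them join it; this forces a biclique, which
      -- in turn supplies a separating embedding.
      good : ∀ u v → u ≢ v → ¬ PAdj u v → ¬ ¬ Good u v
      good u v u≢v na bad = bad (biclique⇒good
        (homogeneous⇒biclique u v u≢v na (λ e → decidable-stable (φ e u ~? φ e v) (λ h → bad (e , h)))) u v u≢v na)

    contains-tS : ¬ InX t G
    contains-tS inX = ¬¬-∀ (λ i → ¬¬-∀ (λ j → local i j)) (λ g → inX (selfIntersects anyEmb (λ u v →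
        subst₂ (λ u v → u ≢ v → ¬ PAdj u v → Good u v) (decode-encode u) (decode-encode v) (g (encode u) (encode v)))))
      where
        local : ∀ i j → ¬ ¬ (decode i ≢ decode j → ¬ PAdj (decode i) (decode j) → Good (decode i) (decode j))
        local i j ¬f = ¬f (λ ne na → ⊥-elim (good (decode i) (decode j) ne na (λ g → ¬f (λ _ _ → g))))

theorem3 : (t : ℕ) → ∃[ c ] ((G : Graph) → IsSimple G → InX t G →
    ¬ HasFalseTwins G → ¬ HasSmallCliqueCutset G →
    Complete G ⊎ TwAtMost G c)
theorem3 t = treewidthBound t , dichotomy
  where
    dichotomy : (G : Graph) → IsSimple G → InX t G → ¬ HasFalseTwins G → ¬ HasSmallCliqueCutset G → Complete G ⊎ TwAtMost G (treewidthBound t)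
    dichotomy G simple inX notwins nocut with Family.tw⊎spiders G simple (legLength t) (suc (spiderCount t)) {treewidthBound t} (n≤1+n _)
    ... | inj₁ tw = inj₂ tw
    ... | inj₂ (_ , Family.add F S) with Fin.any? (λ x → Fin.any? (λ y → ¬? (x Fin.≟ y) ×-dec ¬? (E G x y Bool.≟ true)))
    ... | no none = inj₁ (λ x y ne → decidable-stable (E G x y Bool.≟ true) (λ h → none (x , y , ne , h)))
    ... | yes (p , q , p≢q , p≁q) = ⊥-elim (contains-tS t G simple notwins nocut p≢q p≁q F S inX)
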